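{- Let $\mathcal C$ be one of the classes $\Sigma_{2,\le}$, $\texttt{b- }\Sigma_{2,\le}$, $\texttt{b- }\Sigma^{++}_{2,\le}$. Given a $\mathcal C$-sentence, one can compute in polynomial time an equivalent $\mathcal C$-sentence all of whose atoms involve polynomials of total degree at most four. In particular one can compute in polynomial time an equivalent $\mathcal C$-sentence whose atomic polynomials are given in the standard encoding as lists of (multi-index, coefficient) pairs.
   Context: $\mathcal L$ is the first-order language over the signature $\langle \mathbb Z,+,\times,<,\le\rangle$ with connectives $\land,\lor$ (negation, implication, equality as abbreviations), integer constants in binary, polynomials in atoms given as terms over $\langle\mathbb Z,+,\times\rangle$, interpreted over $\mathbb R$. A $\mathrm{QFF}_\le$-formula is a quantifier-free $\mathcal L$-formula not containing $<$. $I=[-1,1]$; $|X|\le y$ abbreviates $\bigwedge_j(-y\le x_j\le y)$ and $|X|>y$ its negation; $\exists X\in I^m.\forall Y\in I^n.\Phi_0$ abbreviates $\exists X\in\mathbb R^m.\forall Y\in\mathbb R^n.(|Y|>1\lor(|X|\le1\land\Phi_0))$. Classes: $\Sigma_{2,\le}$ = sentences $\exists X\in\mathbb R^m.\forall Y\in\mathbb R^n.\Phi_{0,\le}(X,Y)$; $\texttt{b- }\Sigma_{2,\le}$ = sentences $\exists X\in I^m.\forall Y\in I^n.\Phi_{0,\le}(X,Y)$; $\texttt{b- }\Sigma^{++}_{2,\le}$ = sentences $\exists X\in I^m.\forall Y\in I^n.(\Psi_{0,\le}(Y)\to\Phi_{0,\le}(X,Y))$; here $\Phi_{0,\le},\Psi_{0,\le}$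 are $\mathrm{QFF}_\le$-formulas. Standard encoding of $P\in\mathbb Z[x_1,\dots,x_n]$: a list of pairs $(\alpha_k,c_k)$ with $\alpha_k\in\mathbb N^n$ in unary and $c_k\in\mathbb Z$ in binary such that $P=\sum_kc_kx^{\alpha_k}$. -}

module Defs where

open import Algebra.Bundles using (CommutativeRing; Semiring)
import Algebra.Definitions.RawSemiring as RawSemiringOps
open import Data.Fin.Base using (Fin; toℕ; _↑ˡ_; _↑ʳ_)
open import Data.Integer.Base as ℤ using (ℤ; +_; -[1+_]; 0ℤ; 1ℤ)
open import Data.List.Base using (List; []; _∷_; [_]; _++_; map; foldr; concatMap; replicate; length; allFin; cartesianProductWith)
open import Data.Maybe.Base using (Maybe; just; nothing)
open import Data.Nat.Base as ℕ using (ℕ; zero; suc)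
import Data.Nat.Properties as ℕ
open import Data.Nat.Binary.Base as ℕᵇ using (ℕᵇ; 2[1+_]; 1+[2_])
open import Data.Product.Base using (∃; _×_; _,_; proj₁; proj₂)
open import Data.Sum.Base using (_⊎_; inj₁; inj₂)
open import Data.Vec.Base as Vec using (Vec; []; _∷_; _[_]≔_)
open import Data.Vec.Properties using (≡-dec)
open import Function.Bundles using (_⇔_)
open import Level using (0ℓ)
open import Relation.Binary.Core using (Rel)
import Relation.Binary.Construct.NonStrictToStrict as ToStrict
open import Relation.Binary.PropositionalEquality.Core using (_≡_)
open import Relation.Binary.Structures using (IsDecTotalOrder)
open import Relation.Nullary.Decidable.Core using (yes; no)
open import Relation.Nullary.Negation.Core using (¬_)

------------------------------------------------------------------------
-- The real numbers

-- ℝ is axiomatised, classically, as a Dedekind-complete ordered field; this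
-- determines it up to unique isomorphism.  The decidability of the order is
-- automatic in classical mathematics.
record RealNumbers : Set₁ where
  field
    commutativeRing : CommutativeRing 0ℓ 0ℓ

  open CommutativeRing commutativeRing public

  infix 4 _≤_

  field
    _≤_             : Rel Carrier 0ℓ
    isDecTotalOrder : IsDecTotalOrder _≈_ _≤_
    +-monoˡ-≤       : ∀ z {x y} → x ≤ y → x + z ≤ y + z
    *-nonNegative   : ∀ {x y} → 0# ≤ x → 0# ≤ y → 0# ≤ x * y
    0≉1             : ¬ 0# ≈ 1#
    inverse         : ∀ x → ¬ x ≈ 0# → ∃ λ y → x * y ≈ 1#

  IsUpperBound : (Carrier → Set) → Carrier → Set
  IsUpperBound P b = ∀ x → P x → x ≤ b

  field
    supremum : (P : Carrier → Set) → ∃ P → ∃ (IsUpperBound P) →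
               ∃ λ s → IsUpperBound P s × (∀ b → IsUpperBound P b → s ≤ b)

  open ToStrict _≈_ _≤_ public using (_<_)
  open RawSemiringOps (Semiring.rawSemiring semiring) public using (_^_) renaming (_×_ to _·_)

  fromℤ : ℤ → Carrier
  fromℤ (+ n)    = n · 1#
  fromℤ -[1+ n ] = - (suc n · 1#)

------------------------------------------------------------------------
-- Polynomials with integer coefficients in n variables

data Term (n : ℕ) : Set where
  con     : ℤ → Term n
  var     : Fin n → Term n
  _⊕_ _⊗_ : Term n → Term n → Term n

-- The list of pairs (α , c) stands for the sum of the monomials c x^α;
-- exponents may be repeated and coefficients may be zero.
Monomials : ℕ → Set
Monomials n = List (Vec ℕ n × ℤ)

monoCon : ∀ {n} → ℤ → Monomials n
monoCon {n} c = [ (Vec.replicate n 0 , c) ]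

monoVar : ∀ {n} → Fin n → Monomials n
monoVar {n} i = [ (Vec.replicate n 0 [ i ]≔ 1 , 1ℤ) ]

expandTerm : ∀ {n} → Term n → Monomials n
expandTerm (con c) = monoCon c
expandTerm (var i) = monoVar i
expandTerm (s ⊕ t) = expandTerm s ++ expandTerm t
expandTerm (s ⊗ t) = cartesianProductWith
  (λ (α , c) (β , d) → Vec.zipWith ℕ._+_ α β , c ℤ.* d)
  (expandTerm s) (expandTerm t)

coefficient : ∀ {n} → Monomials n → Vec ℕ n → ℤ
coefficient []            α = 0ℤ
coefficient ((β , c) ∷ P) α with ≡-dec ℕ._≟_ β α
... | yes _ = c ℤ.+ coefficient P α
... | no  _ = coefficient P α

-- The two ways of writing down the polynomials occurring in atoms: as terms
-- over ⟨ℤ,+,×⟩, or in the standard encoding.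
data Notation : Set where
  terms standard : Notation

Poly : Notation → ℕ → Set
Poly terms    = Term
Poly standard = Monomials

conₚ : ∀ κ {n} → ℤ → Poly κ n
conₚ terms    = con
conₚ standard = monoCon

varₚ : ∀ κ {n} → Fin n → Poly κ n
varₚ terms    = var
varₚ standard = monoVar

expand : ∀ κ {n} → Poly κ n → Monomials n
expand terms    t = expandTerm t
expand standard P = P

weakenTerm : ∀ m {n} → Term n → Term (n ℕ.+ m)
weakenTerm m (con c) = con c
weakenTerm m (var i) = var (i ↑ˡ m)
weakenTerm m (s ⊕ t) = weakenTerm m s ⊕ weakenTerm m t
weakenTerm m (s ⊗ t) = weakenTerm m s ⊗ weakenTerm m t

weakenₚ : ∀ κ m {n} → Poly κ n → Poly κ (n ℕ.+ m)
weakenₚ terms    m t = weakenTerm m t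
weakenₚ standard m P = map (λ (α , c) → α Vec.++ Vec.replicate m 0 , c) P

-- This concerns the polynomial denoted, after collecting equal monomials.
TotalDegree≤ : ∀ κ {n} → ℕ → Poly κ n → Set
TotalDegree≤ κ d P = ∀ α → d ℕ.< Vec.sum α → coefficient (expand κ P) α ≡ 0ℤ

------------------------------------------------------------------------
-- The first-order language

infix  7 _≺_ _≼_
infixr 6 _∧_
infixr 5 _∨_
infixr 4 _⇒_

-- Formulas with free variables in Fin n; quantifiers bind variable zero.
data Formula (κ : Notation) (n : ℕ) : Set where
  _≺_ _≼_   : Poly κ n → Poly κ n → Formula κ n
  _∧_ _∨_   : Formula κ n → Formula κ n → Formula κ n
  exists all : Formula κ (suc n) → Formula κ n

Sentence : Notation → Set
Sentence κ = Formula κ 0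

neg : ∀ {κ n} → Formula κ n → Formula κ n
neg (p ≺ q)    = q ≼ p
neg (p ≼ q)    = q ≺ p
neg (φ ∧ ψ)    = neg φ ∨ neg ψ
neg (φ ∨ ψ)    = neg φ ∧ neg ψ
neg (exists φ) = all (neg φ)
neg (all φ)    = exists (neg φ)

_⇒_ : ∀ {κ n} → Formula κ n → Formula κ n → Formula κ n
φ ⇒ ψ = neg φ ∨ ψ

-- The m additional free variables are placed after the n existing ones, so
-- no shifting is needed under binders.
weaken : ∀ {κ} m {n} → Formula κ n → Formula κ (n ℕ.+ m)
weaken {κ} m (p ≺ q) = weakenₚ κ m p ≺ weakenₚ κ m q
weaken {κ} m (p ≼ q) = weakenₚ κ m p ≼ weakenₚ κ m q
weaken m (φ ∧ ψ)     = weaken m φ ∧ weaken m ψ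
weaken m (φ ∨ ψ)     = weaken m φ ∨ weaken m ψ
weaken m (exists φ)  = exists (weaken m φ)
weaken m (all φ)     = all (weaken m φ)

-- Quantifier-free formulas not containing <.
data QFF≤ {κ n} : Formula κ n → Set where
  atom : ∀ p q → QFF≤ (p ≼ q)
  _∧_  : ∀ {φ ψ} → QFF≤ φ → QFF≤ ψ → QFF≤ (φ ∧ ψ)
  _∨_  : ∀ {φ ψ} → QFF≤ φ → QFF≤ ψ → QFF≤ (φ ∨ ψ)

AtomsOfDegree≤ : ∀ {κ n} → ℕ → Formula κ n → Set
AtomsOfDegree≤ {κ} d (p ≺ q) = TotalDegree≤ κ d p × TotalDegree≤ κ d q
AtomsOfDegree≤ {κ} d (p ≼ q) = TotalDegree≤ κ d p × TotalDegree≤ κ d q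
AtomsOfDegree≤ d (φ ∧ ψ)     = AtomsOfDegree≤ d φ × AtomsOfDegree≤ d ψ
AtomsOfDegree≤ d (φ ∨ ψ)     = AtomsOfDegree≤ d φ × AtomsOfDegree≤ d ψ
AtomsOfDegree≤ d (exists φ)  = AtomsOfDegree≤ d φ
AtomsOfDegree≤ d (all φ)     = AtomsOfDegree≤ d φ

------------------------------------------------------------------------
-- The classes of sentences

existsBlock : ∀ {κ} m → Formula κ m → Sentence κ
existsBlock zero    φ = φ
existsBlock (suc m) φ = existsBlock m (exists φ)

allBlock : ∀ {κ} n {m} → Formula κ (n ℕ.+ m) → Formula κ m
allBlock zero    φ = φ
allBlock (suc n) φ = allBlock n (all φ)

-- ∃ X ∈ ℝᵐ. ∀ Y ∈ ℝⁿ. Φ(X,Y); in Φ the variables Y come before the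
-- variables X.
∃∀ : ∀ {κ} m n → Formula κ (n ℕ.+ m) → Sentence κ
∃∀ m n Φ = existsBlock m (allBlock n Φ)

-- |X| ≤ y for an integer constant y; the empty conjunction is 0 ≤ 0.
∣_∣≤_ : ∀ {κ n} → List (Fin n) → ℤ → Formula κ n
∣_∣≤_ {κ} xs y = foldr
  (λ x φ → (conₚ κ (ℤ.- y) ≼ varₚ κ x ∧ varₚ κ x ≼ conₚ κ y) ∧ φ)
  (conₚ κ 0ℤ ≼ conₚ κ 0ℤ) xs

∣_∣>_ : ∀ {κ n} → List (Fin n) → ℤ → Formula κ n
∣ xs ∣> y = neg (∣ xs ∣≤ y)

-- ∃ X ∈ Iᵐ. ∀ Y ∈ Iⁿ. Φ(X,Y) with I = [-1,1].
∃∀ᴵ : ∀ {κ} m n → Formula κ (n ℕ.+ m) → Sentence κ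
∃∀ᴵ m n Φ = ∃∀ m n (∣ Y ∣> 1ℤ ∨ (∣ X ∣≤ 1ℤ ∧ Φ))
  where
  X Y : List (Fin (n ℕ.+ m))
  X = map (n ↑ʳ_) (allFin m)
  Y = map (_↑ˡ m) (allFin n)

data Class : Set where
  Σ₂≤ b-Σ₂≤ b-Σ₂≤⁺⁺ : Class

infix 4 _∈_

data _∈_ {κ} : Sentence κ → Class → Set where
  Σ₂-sentence     : ∀ m n {Φ : Formula κ (n ℕ.+ m)} → QFF≤ Φ →
                    ∃∀ m n Φ ∈ Σ₂≤
  b-Σ₂-sentence   : ∀ m n {Φ : Formula κ (n ℕ.+ m)} → QFF≤ Φ →
                    ∃∀ᴵ m n Φ ∈ b-Σ₂≤
  b-Σ₂⁺⁺-sentence : ∀ m n {Ψ : Formula κ n} {Φ : Formula κ (n ℕ.+ m)} →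
                    QFF≤ Ψ → QFF≤ Φ →
                    ∃∀ᴵ m n (weaken m Ψ ⇒ Φ) ∈ b-Σ₂≤⁺⁺

SentenceIn : Class → Notation → Set
SentenceIn 𝒞 κ = ∃ λ (φ : Sentence κ) → φ ∈ 𝒞

------------------------------------------------------------------------
-- Truth over the reals

module Semantics (ℝ : RealNumbers) where
  open RealNumbers ℝ

  evalTerm : ∀ {n} → Term n → Vec Carrier n → Carrier
  evalTerm (con c) ρ = fromℤ c
  evalTerm (var i) ρ = Vec.lookup ρ i
  evalTerm (s ⊕ t) ρ = evalTerm s ρ + evalTerm t ρ
  evalTerm (s ⊗ t) ρ = evalTerm s ρ * evalTerm t ρ

  power : ∀ {n} → Vec Carrier n → Vec ℕ n → Carrier
  power ρ α = Vec.foldr′ _*_ 1# (Vec.zipWith _^_ ρ α)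

  evalMonomials : ∀ {n} → Monomials n → Vec Carrier n → Carrier
  evalMonomials P ρ = foldr (λ (α , c) s → fromℤ c * power ρ α + s) 0# P

  eval : ∀ κ {n} → Poly κ n → Vec Carrier n → Carrier
  eval terms    t ρ = evalTerm t ρ
  eval standard P ρ = evalMonomials P ρ

  Holds : ∀ {κ n} → Formula κ n → Vec Carrier n → Set
  Holds {κ} (p ≺ q) ρ = eval κ p ρ < eval κ q ρ
  Holds {κ} (p ≼ q) ρ = eval κ p ρ ≤ eval κ q ρ
  Holds (φ ∧ ψ)     ρ = Holds φ ρ × Holds ψ ρ
  Holds (φ ∨ ψ)     ρ = Holds φ ρ ⊎ Holds ψ ρ
  Holds (exists φ)  ρ = ∃ λ x → Holds φ (x ∷ ρ)
  Holds (all φ)     ρ = ∀ x → Holds φ (x ∷ ρ)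

Equivalent : ∀ {κ κ′} → Sentence κ → Sentence κ′ → Set₁
Equivalent φ ψ = (ℝ : RealNumbers) → let open Semantics ℝ in
                 Holds φ [] ⇔ Holds ψ []

------------------------------------------------------------------------
-- Sentences as words, in Polish notation

data Letter : Set where
  ⟨∃⟩ ⟨∀⟩ ⟨<⟩ ⟨≤⟩ ⟨∧⟩ ⟨∨⟩ : Letter
  ⟨con⟩ ⟨var⟩ ⟨+⟩ ⟨×⟩      : Letter
  ⟨monomial⟩               : Letter
  ⟨pos⟩ ⟨neg⟩ ⟨1⟩ ⟨2⟩ ⟨end⟩ : Letter

unary : ℕ → List Letter
unary n = replicate n ⟨1⟩ ++ [ ⟨end⟩ ]

-- Bijective base 2, least significant digit first: the digits are 1 and 2,
-- and zero is the empty string.  This has the length of ordinary binary up to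
-- one digit.
binaryDigits : ℕᵇ → List Letter
binaryDigits ℕᵇ.zero  = [ ⟨end⟩ ]
binaryDigits 1+[2 b ] = ⟨1⟩ ∷ binaryDigits b
binaryDigits 2[1+ b ] = ⟨2⟩ ∷ binaryDigits b

binary : ℤ → List Letter
binary (+ n)    = ⟨pos⟩ ∷ binaryDigits (ℕᵇ.fromℕ n)
binary -[1+ n ] = ⟨neg⟩ ∷ binaryDigits (ℕᵇ.fromℕ (suc n))

encodeTerm : ∀ {n} → Term n → List Letter
encodeTerm (con c) = ⟨con⟩ ∷ binary c
encodeTerm (var i) = ⟨var⟩ ∷ unary (toℕ i)
encodeTerm (s ⊕ t) = ⟨+⟩ ∷ encodeTerm s ++ encodeTerm t
encodeTerm (s ⊗ t) = ⟨×⟩ ∷ encodeTerm s ++ encodeTerm t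

encodeMonomials : ∀ {n} → Monomials n → List Letter
encodeMonomials P = concatMap
  (λ (α , c) → ⟨monomial⟩ ∷ concatMap unary (Vec.toList α) ++ binary c) P
  ++ [ ⟨end⟩ ]

encodePoly : ∀ κ {n} → Poly κ n → List Letter
encodePoly terms    = encodeTerm
encodePoly standard = encodeMonomials

encode : ∀ {κ n} → Formula κ n → List Letter
encode {κ} (p ≺ q) = ⟨<⟩ ∷ encodePoly κ p ++ encodePoly κ q
encode {κ} (p ≼ q) = ⟨≤⟩ ∷ encodePoly κ p ++ encodePoly κ q
encode (φ ∧ ψ)     = ⟨∧⟩ ∷ encode φ ++ encode ψ
encode (φ ∨ ψ)     = ⟨∨⟩ ∷ encode φ ++ encode ψ
encode (exists φ)  = ⟨∃⟩ ∷ encode φ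
encode (all φ)     = ⟨∀⟩ ∷ encode φ

------------------------------------------------------------------------
-- Deterministic multi-tape Turing machines

data Move : Set where
  left stay right : Move

-- The cells to the left of the head are listed starting from the head; all
-- cells not listed are blank.
record Tape (Γ : Set) : Set where
  constructor tape
  field
    before : List Γ
    head   : Γ
    after  : List Γ

-- A is the (finite) input and output alphabet.
record Machine (A : Set) : Set where
  field
    states auxiliaries extraTapes : ℕ

  -- nothing is the blank.
  Symbol : Set
  Symbol = Maybe (A ⊎ Fin auxiliaries)

  tapes : ℕ
  tapes = suc extraTapes

  -- δ yields nothing when the machine halts.
  field
    start : Fin states
    δ     : Fin states → Vec Symbol tapes →
            Maybe (Fin states × Vec (Symbol × Move) tapes)

  load : List Symbol → Tape Symbol
  load []       = tape [] nothing []
  load (s ∷ ss) = tape [] s ss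

  act : Symbol × Move → Tape Symbol → Tape Symbol
  act (s , stay)  (tape ls       _ rs)       = tape ls s rs
  act (s , left)  (tape []       _ rs)       = tape [] nothing (s ∷ rs)
  act (s , left)  (tape (l ∷ ls) _ rs)       = tape ls l (s ∷ rs)
  act (s , right) (tape ls       _ [])       = tape (s ∷ ls) nothing []
  act (s , right) (tape ls       _ (r ∷ rs)) = tape (s ∷ ls) r rs

  Configuration : Set
  Configuration = Fin states × Vec (Tape Symbol) tapes

  step : Configuration → Maybe Configuration
  step (q , ts) with δ q (Vec.map Tape.head ts)
  ... | nothing       = nothing
  ... | just (q′ , a) = just (q′ , Vec.zipWith act a ts)

  -- c ↓⟨ t ⟩ d: started in c, the machine halts in d after at most t steps.
  data _↓⟨_⟩_ : Configuration → ℕ → Configuration → Set where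
    halted  : ∀ {c t} → step c ≡ nothing → c ↓⟨ t ⟩ c
    stepped : ∀ {c c′ d t} → step c ≡ just c′ → c′ ↓⟨ t ⟩ d → c ↓⟨ suc t ⟩ d

  initial : List A → Configuration
  initial w = start , load (map (λ a → just (inj₁ a)) w)
                      ∷ Vec.replicate extraTapes (load [])

  word : List Symbol → List A
  word (just (inj₁ a) ∷ ss) = a ∷ word ss
  word _                    = []

  -- The output is the longest word over A on the first tape that starts at
  -- the head.
  output : Configuration → List A
  output (_ , tape _ s ss ∷ _) = word (s ∷ ss)

  Computes_from_within_ : List A → List A → ℕ → Set
  Computes v from w within t = ∃ λ d → initial w ↓⟨ t ⟩ d × output d ≡ v

-- Some Turing machine turns, in time polynomial in the length of its input,
-- the code of every x : X into the code of some y : Y with R x y.  Every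
-- polynomial in ℓ is dominated by one of the form k * ℓ ^ e + k.
PolyTime : {A X Y : Set} → (X → List A) → (Y → List A) → (X → Y → Set₁) → Set₁
PolyTime {A} {X} {Y} codeX codeY R =
  ∃ λ (M : Machine A) → ∃ λ (k : ℕ) → ∃ λ (e : ℕ) →
    let open Machine M in
    (x : X) → ∃ λ (y : Y) → R x y ×
      (Computes (codeY y) from (codeX x)
        within (k ℕ.* length (codeX x) ℕ.^ e ℕ.+ k))

-- Given a 𝒞-sentence with polynomials written as terms, one can compute in
-- polynomial time an equivalent 𝒞-sentence in notation κ satisfying P.
PolyTimeEquivalent : Class → (κ : Notation) → (Sentence κ → Set) → Set₁
PolyTimeEquivalent 𝒞 κ P =
  PolyTime {X = SentenceIn 𝒞 terms} {Y = SentenceIn 𝒞 κ}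
    (λ φ → encode (proj₁ φ)) (λ ψ → encode (proj₁ ψ))
    (λ φ ψ → Equivalent (proj₁ φ) (proj₁ ψ) × P (proj₁ ψ))

{-# OPTIONS --safe #-}
module Submission where

-- Only the block of universal quantifiers is enlarged.  Every node of a term
-- gets an interval, whose end points are two new universal variables, and an
-- atom p ≤ q becomes the disjunction of "some interval is wrong" and
-- "inf p ≤ sup q".  The interval of a leaf is wrong if the value of the leaf
-- is not in its interior; that of an inner node, if the image of the intervals
-- of the two children is not in its interior.  This is expressed by atoms of
-- degree at most two, without <.  If p ≤ q and no interval is wrong, then
-- inf p < p ≤ q < sup q.  If q < p, then sufficiently small intervals around
-- the values falsify all disjuncts.  So no equations between terms, whose
-- negations would be strict, are needed.  With < instead of ≤, and with
-- degenerate intervals, the same translation works for the strict atoms of ¬Ψ.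
-- The new variables are the end points divided by M = 2^N - 1, where N is the
-- length of the input: over I all subterms have values in [1 - M , M - 1], so
-- that the new variables can be restricted to I as well.
--
-- In Polish notation the translation is a pass from left to right, in which a
-- node waits on a stack until its right child is met.  The Turing machine
-- comes from a program over finitely many stacks, one per tape.

open import Defs
open import Data.Product.Base using (_×_; _,_)
open import Data.Unit.Base using (⊤; tt)

-- A universal quantifier does not distribute over a disjunction. Translating atom by atom works
-- because different nodes have different new variables: the boxes that refute two disjuncts are
-- chosen independently and put side by side. The class `b-Σ₂≤⁺⁺` adds the constraint that the
-- premise may speak of `Y` only. It is met because the variables of a node depend on its position
-- alone, so that `Ψ` can be translated before or after `X` is added, with the same result.
--
-- The numbers are chosen for the machine. How many nodes a sentence has is known only after a
-- parse, so `2N + 4` new variables are taken, a number read off from the length. The scale has `N`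
-- equal digits in bijective binary notation and is therefore obtained by counting letters. The new
-- variables precede the old ones, so that every old variable is shifted by the same amount. Each
-- letter of the matrix causes a bounded number of copying operations, each linear in the number of
-- variables, which makes the time quadratic.

module IntervalTranslation where

  open import Data.Bool.Base using (Bool; true; false)
  open import Data.Fin.Base using (Fin; zero; suc; toℕ; _↑ˡ_; _↑ʳ_; splitAt)
  open import Data.Fin.Properties using (splitAt-↑ˡ; splitAt-↑ʳ; splitAt⁻¹-↑ˡ; splitAt⁻¹-↑ʳ; toℕ-↑ˡ; toℕ-↑ʳ)
  open import Data.Integer.Base as ℤ using (ℤ; 0ℤ; 1ℤ)
  open import Data.List.Base as List using (List; []; _∷_; [_]; map; _++_; allFin)
  open import Data.List.Relation.Unary.All as All using (All; []; _∷_)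
  import Data.List.Relation.Unary.All.Properties as All
  open import Data.Nat.Base as ℕ using (ℕ; zero; suc; _+_; _≤_; _<_; s≤s; z≤n)
  open import Data.Nat.Properties as ℕ using (≤-trans; +-mono-≤)
  open import Data.Product.Base using (∃; _×_; _,_)
  open import Data.Sum.Base as Sum using (inj₁; inj₂; [_,_]′)
  open import Data.Vec.Base as Vec using (Vec; []; _∷_; lookup; _[_]≔_)
  open import Data.Vec.Properties using ([]≔-++-↑ˡ; zipWith-++; ≡-dec)
  open import Relation.Binary.PropositionalEquality using (_≡_; refl; sym; trans; cong; cong₂; subst; module ≡-Reasoning)
  open import Relation.Nullary.Decidable.Core using (yes; no; True; toWitness)
  open import Relation.Nullary.Negation.Core using (contradiction)

  -- The interval translation: its atoms, its degrees, its effect on the three classes.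

  data Comparison : Set where
    lt le : Comparison

  rel : ∀ κ {n} → Comparison → Poly κ n → Poly κ n → Formula κ n
  rel κ lt = _≺_
  rel κ le = _≼_

  scaledₚ : ∀ κ {n} → ℤ → Fin n → Poly κ n
  scaledₚ terms    c i = con c ⊗ var i
  scaledₚ standard {n} c i = [ (Vec.replicate n 0 [ i ]≔ 1 , c) ]

  sumₚ : ∀ κ {n} → Fin n → Fin n → Poly κ n
  sumₚ terms    i j = var i ⊕ var j
  sumₚ standard i j = monoVar i ++ monoVar j

  prodₚ : ∀ κ {n} → ℤ → Fin n → Fin n → Poly κ n
  prodₚ terms    c i j = con c ⊗ (var i ⊗ var j)
  prodₚ standard {n} c i j = [ (Vec.zipWith ℕ._+_ (Vec.replicate n 0 [ i ]≔ 1) (Vec.replicate n 0 [ j ]≔ 1) , c) ]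

  termNodes : ∀ {n} → Term n → ℕ
  termNodes (con _) = 1
  termNodes (var _) = 1
  termNodes (s ⊕ t) = suc (termNodes s + termNodes t)
  termNodes (s ⊗ t) = suc (termNodes s + termNodes t)

  nodes : ∀ {n} → Formula terms n → ℕ
  nodes (p ≺ q)    = suc (termNodes p + termNodes q)
  nodes (p ≼ q)    = suc (termNodes p + termNodes q)
  nodes (φ ∧ ψ)    = nodes φ + nodes ψ
  nodes (φ ∨ ψ)    = nodes φ + nodes ψ
  nodes (exists φ) = 0
  nodes (all φ)    = 0

  -- Unlike `QFF≤` this admits strict atoms, which enter through `neg Ψ` when the implication
  -- `Ψ ⇒ Φ` is taken as a matrix.
  data QuantifierFree {κ n} : Formula κ n → Set where
    _≺_ : ∀ p q → QuantifierFree (p ≺ q)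
    _≼_ : ∀ p q → QuantifierFree (p ≼ q)
    _∧_ : ∀ {φ ψ} → QuantifierFree φ → QuantifierFree ψ → QuantifierFree (φ ∧ ψ)
    _∨_ : ∀ {φ ψ} → QuantifierFree φ → QuantifierFree ψ → QuantifierFree (φ ∨ ψ)

  QFF≤⇒quantifierFree : ∀ {κ n} {φ : Formula κ n} → QFF≤ φ → QuantifierFree φ
  QFF≤⇒quantifierFree (atom p q) = p ≼ q
  QFF≤⇒quantifierFree (f ∧ g)    = QFF≤⇒quantifierFree f ∧ QFF≤⇒quantifierFree g
  QFF≤⇒quantifierFree (f ∨ g)    = QFF≤⇒quantifierFree f ∨ QFF≤⇒quantifierFree g

  neg-quantifierFree : ∀ {κ n} {φ : Formula κ n} → QuantifierFree φ → QuantifierFree (neg φ)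
  neg-quantifierFree (p ≺ q) = q ≼ p
  neg-quantifierFree (p ≼ q) = q ≺ p
  neg-quantifierFree (f ∧ g) = neg-quantifierFree f ∨ neg-quantifierFree g
  neg-quantifierFree (f ∨ g) = neg-quantifierFree f ∧ neg-quantifierFree g

  weaken-quantifierFree : ∀ {κ} m {n} {φ : Formula κ n} → QuantifierFree φ → QuantifierFree (weaken m φ)
  weaken-quantifierFree m (p ≺ q) = _ ≺ _
  weaken-quantifierFree m (p ≼ q) = _ ≼ _
  weaken-quantifierFree m (f ∧ g) = weaken-quantifierFree m f ∧ weaken-quantifierFree m g
  weaken-quantifierFree m (f ∨ g) = weaken-quantifierFree m f ∨ weaken-quantifierFree m g

  -- An atom counts as a third kind of inner node. It takes a number of its own, so that numbering,
  -- correctness proof and machine treat it like a sum or a product.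
  data Kind : Set where
    add mul cmp : Kind

  -- Every node i of a term, in preorder, carries two new variables
  -- slot (2i) and slot (2i+1).  If M is the scale, they stand for the end points
  -- of an interval (M lo , M hi); the formula translating the term is false iff
  -- the intervals of the leaves contain the values of the leaves and the
  -- interval of each inner node contains the image of those of its children.
  module Translation (κ : Notation) {n v} (slot : ℕ → Fin v) (ι : Fin n → Fin v) (M : ℤ) where

    -- The parameter e selects: 0 and 1 the end points at i, 2 and 3 those at
    -- suc i, the left child of i.
    end : ℕ → ℕ → Fin v
    end i e = slot (i + (i + e))

    leaf : Comparison → Poly κ v → ℕ → Formula κ v
    leaf r p i = rel κ r p (scaledₚ κ M (end i 0)) ∨ rel κ r (scaledₚ κ M (end i 1)) p

    -- The product of the true end points `M x` and `M y` is to be compared with a true end point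
    -- `M z`. One factor `M` is cancelled, which leaves `M x y` against `z`; in a sum it cancels
    -- altogether.
    corner : Comparison → ℕ → Fin v → Fin v → Formula κ v
    corner r i x y = rel κ r (prodₚ κ M x y) (varₚ κ (end i 0)) ∨ rel κ r (varₚ κ (end i 1)) (prodₚ κ M x y)

    glue : Comparison → Kind → ℕ → ℕ → Formula κ v
    glue r add i j = rel κ r (sumₚ κ (end i 2) (end j 0)) (varₚ κ (end i 0))
                   ∨ rel κ r (varₚ κ (end i 1)) (sumₚ κ (end i 3) (end j 1))
    glue r mul i j = (corner r i (end i 2) (end j 0) ∨ corner r i (end i 2) (end j 1))
                   ∨ (corner r i (end i 3) (end j 0) ∨ corner r i (end i 3) (end j 1))
    glue r cmp i j = rel κ r (varₚ κ (end i 2)) (varₚ κ (end j 1))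

    translateTerm : Comparison → Term n → ℕ → Formula κ v

    translateNode : Comparison → Kind → Term n → Term n → ℕ → Formula κ v
    -- The glue stands between the children: it mentions the number `j` of the right child, which a
    -- pass from left to right knows only after the left child.
    translateNode r o s t i = translateTerm r s (suc i) ∨ (glue r o i j ∨ translateTerm r t j)
      where
      j : ℕ
      j = suc i + termNodes s

    translateTerm r (con c) i = leaf r (conₚ κ c) i
    translateTerm r (var x) i = leaf r (varₚ κ (ι x)) i
    translateTerm r (s ⊕ t) i = translateNode r add s t i
    translateTerm r (s ⊗ t) i = translateNode r mul s t i

    translate : Formula terms n → ℕ → Formula κ v
    translate (p ≺ q)    i = translateNode lt cmp p q i
    translate (p ≼ q)    i = translateNode le cmp p q i
    translate (φ ∧ ψ)    i = translate φ i ∧ translate ψ (i + nodes φ)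
    translate (φ ∨ ψ)    i = translate φ i ∨ translate ψ (i + nodes φ)
    translate (exists φ) i = conₚ κ 0ℤ ≼ conₚ κ 0ℤ
    translate (all φ)    i = conₚ κ 0ℤ ≼ conₚ κ 0ℤ

    translateTerm-QFF≤ : ∀ t i → QFF≤ (translateTerm le t i)

    translateNode-QFF≤ : ∀ o s t i → QFF≤ (translateNode le o s t i)
    translateNode-QFF≤ o s t i = translateTerm-QFF≤ s _ ∨ (glue-QFF≤ o ∨ translateTerm-QFF≤ t _)
      where
      glue-QFF≤ : ∀ o {j} → QFF≤ (glue le o i j)
      glue-QFF≤ add = atom _ _ ∨ atom _ _
      glue-QFF≤ mul = ((atom _ _ ∨ atom _ _) ∨ (atom _ _ ∨ atom _ _)) ∨ ((atom _ _ ∨ atom _ _) ∨ (atom _ _ ∨ atom _ _))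
      glue-QFF≤ cmp = atom _ _

    translateTerm-QFF≤ (con c) i = atom _ _ ∨ atom _ _
    translateTerm-QFF≤ (var x) i = atom _ _ ∨ atom _ _
    translateTerm-QFF≤ (s ⊕ t) i = translateNode-QFF≤ add s t i
    translateTerm-QFF≤ (s ⊗ t) i = translateNode-QFF≤ mul s t i

    translate-QFF≤ : ∀ {φ} → QFF≤ φ → ∀ i → QFF≤ (translate φ i)
    translate-QFF≤ (atom p q) i = translateNode-QFF≤ cmp p q i
    translate-QFF≤ (f ∧ g)    i = translate-QFF≤ f i ∧ translate-QFF≤ g _
    translate-QFF≤ (f ∨ g)    i = translate-QFF≤ f i ∨ translate-QFF≤ g _

    neg-translateTerm-QFF≤ : ∀ t i → QFF≤ (neg (translateTerm lt t i))

    neg-translateNode-QFF≤ : ∀ o s t i → QFF≤ (neg (translateNode lt o s t i))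
    neg-translateNode-QFF≤ o s t i = neg-translateTerm-QFF≤ s _ ∧ (glue-QFF≤ o ∧ neg-translateTerm-QFF≤ t _)
      where
      glue-QFF≤ : ∀ o {j} → QFF≤ (neg (glue lt o i j))
      glue-QFF≤ add = atom _ _ ∧ atom _ _
      glue-QFF≤ mul = ((atom _ _ ∧ atom _ _) ∧ (atom _ _ ∧ atom _ _)) ∧ ((atom _ _ ∧ atom _ _) ∧ (atom _ _ ∧ atom _ _))
      glue-QFF≤ cmp = atom _ _

    neg-translateTerm-QFF≤ (con c) i = atom _ _ ∧ atom _ _
    neg-translateTerm-QFF≤ (var x) i = atom _ _ ∧ atom _ _
    neg-translateTerm-QFF≤ (s ⊕ t) i = neg-translateNode-QFF≤ add s t i
    neg-translateTerm-QFF≤ (s ⊗ t) i = neg-translateNode-QFF≤ mul s t i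

    -- The premise of the new implication has this form. The atoms of `neg φ` are strict, hence also
    -- those of its translation, and the outer negation makes them non-strict again.
    neg-translate-QFF≤ : ∀ {φ} → QFF≤ φ → ∀ i → QFF≤ (neg (translate (neg φ) i))
    neg-translate-QFF≤ (atom p q) i = neg-translateNode-QFF≤ cmp q p i
    neg-translate-QFF≤ (f ∧ g)    i = neg-translate-QFF≤ f i ∧ neg-translate-QFF≤ g _
    neg-translate-QFF≤ (f ∨ g)    i = neg-translate-QFF≤ f i ∨ neg-translate-QFF≤ g _

  neg-involutive : ∀ {κ n} (φ : Formula κ n) → neg (neg φ) ≡ φ
  neg-involutive (p ≺ q)    = refl
  neg-involutive (p ≼ q)    = refl
  neg-involutive (φ ∧ ψ)    = cong₂ _∧_ (neg-involutive φ) (neg-involutive ψ)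
  neg-involutive (φ ∨ ψ)    = cong₂ _∨_ (neg-involutive φ) (neg-involutive ψ)
  neg-involutive (exists φ) = cong exists (neg-involutive φ)
  neg-involutive (all φ)    = cong all (neg-involutive φ)

  neg-weaken : ∀ {κ} m {n} (φ : Formula κ n) → neg (weaken m φ) ≡ weaken m (neg φ)
  neg-weaken m (p ≺ q)    = refl
  neg-weaken m (p ≼ q)    = refl
  neg-weaken m (φ ∧ ψ)    = cong₂ _∨_ (neg-weaken m φ) (neg-weaken m ψ)
  neg-weaken m (φ ∨ ψ)    = cong₂ _∧_ (neg-weaken m φ) (neg-weaken m ψ)
  neg-weaken m (exists φ) = cong all (neg-weaken m φ)
  neg-weaken m (all φ)    = cong exists (neg-weaken m φ)

  termNodes-weaken : ∀ m {n} (t : Term n) → termNodes (weakenTerm m t) ≡ termNodes t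
  termNodes-weaken m (con _) = refl
  termNodes-weaken m (var _) = refl
  termNodes-weaken m (s ⊕ t) = cong suc (cong₂ _+_ (termNodes-weaken m s) (termNodes-weaken m t))
  termNodes-weaken m (s ⊗ t) = cong suc (cong₂ _+_ (termNodes-weaken m s) (termNodes-weaken m t))

  nodes-weaken : ∀ m {n} (φ : Formula terms n) → nodes (weaken m φ) ≡ nodes φ
  nodes-weaken m (p ≺ q)    = cong suc (cong₂ _+_ (termNodes-weaken m p) (termNodes-weaken m q))
  nodes-weaken m (p ≼ q)    = cong suc (cong₂ _+_ (termNodes-weaken m p) (termNodes-weaken m q))
  nodes-weaken m (φ ∧ ψ)    = cong₂ _+_ (nodes-weaken m φ) (nodes-weaken m ψ)
  nodes-weaken m (φ ∨ ψ)    = cong₂ _+_ (nodes-weaken m φ) (nodes-weaken m ψ)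
  nodes-weaken m (exists φ) = refl
  nodes-weaken m (all φ)    = refl

  replicate-++ : ∀ {A : Set} m n {x : A} → Vec.replicate m x Vec.++ Vec.replicate n x ≡ Vec.replicate (m + n) x
  replicate-++ zero    n = refl
  replicate-++ (suc m) n = cong (_ ∷_) (replicate-++ m n)

  unit-weaken : ∀ m {n} (i : Fin n) →
                (Vec.replicate n 0 [ i ]≔ 1) Vec.++ Vec.replicate m 0 ≡ Vec.replicate (n + m) 0 [ i ↑ˡ m ]≔ 1
  unit-weaken m {n} i = trans (sym ([]≔-++-↑ˡ (Vec.replicate n 0) (Vec.replicate m 0) i))
                              (cong (_[ i ↑ˡ m ]≔ 1) (replicate-++ n m))

  weaken-con : ∀ κ m {n} c → weakenₚ κ m {n} (conₚ κ c) ≡ conₚ κ c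
  weaken-con terms    m     c = refl
  weaken-con standard m {n} c = cong (λ α → [ (α , c) ]) (replicate-++ n m)

  weaken-var : ∀ κ m {n} (i : Fin n) → weakenₚ κ m (varₚ κ i) ≡ varₚ κ (i ↑ˡ m)
  weaken-var terms    m i = refl
  weaken-var standard m i = cong (λ α → [ (α , 1ℤ) ]) (unit-weaken m i)

  weaken-scaled : ∀ κ m {n} c (i : Fin n) → weakenₚ κ m (scaledₚ κ c i) ≡ scaledₚ κ c (i ↑ˡ m)
  weaken-scaled terms    m c i = refl
  weaken-scaled standard m c i = cong (λ α → [ (α , c) ]) (unit-weaken m i)

  weaken-sum : ∀ κ m {n} (i j : Fin n) → weakenₚ κ m (sumₚ κ i j) ≡ sumₚ κ (i ↑ˡ m) (j ↑ˡ m)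
  weaken-sum terms    m i j = refl
  weaken-sum standard m i j = cong₂ (λ α β → (α , 1ℤ) ∷ (β , 1ℤ) ∷ []) (unit-weaken m i) (unit-weaken m j)

  weaken-prod : ∀ κ m {n} c (i j : Fin n) → weakenₚ κ m (prodₚ κ c i j) ≡ prodₚ κ c (i ↑ˡ m) (j ↑ˡ m)
  weaken-prod terms    m c i j = refl
  weaken-prod standard m {n} c i j = cong (λ α → [ (α , c) ]) (begin
    Vec.zipWith _+_ e f Vec.++ Vec.replicate m 0
      ≡⟨ cong (Vec.zipWith _+_ e f Vec.++_) (sym (zipWith-0 m)) ⟩
    Vec.zipWith _+_ e f Vec.++ Vec.zipWith _+_ (Vec.replicate m 0) (Vec.replicate m 0)
      ≡⟨ zipWith-++ _+_ e _ f _ ⟨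
    Vec.zipWith _+_ (e Vec.++ Vec.replicate m 0) (f Vec.++ Vec.replicate m 0)
      ≡⟨ cong₂ (Vec.zipWith _+_) (unit-weaken m i) (unit-weaken m j) ⟩
    Vec.zipWith _+_ (Vec.replicate (n + m) 0 [ i ↑ˡ m ]≔ 1) (Vec.replicate (n + m) 0 [ j ↑ˡ m ]≔ 1) ∎)
    where
    open ≡-Reasoning
    e f : Vec ℕ n
    e = Vec.replicate n 0 [ i ]≔ 1
    f = Vec.replicate n 0 [ j ]≔ 1
    zipWith-0 : ∀ m → Vec.zipWith _+_ (Vec.replicate m 0) (Vec.replicate m 0) ≡ Vec.replicate m 0
    zipWith-0 zero    = refl
    zipWith-0 (suc m) = cong (0 ∷_) (zipWith-0 m)

  weaken-rel : ∀ κ m {n} r {p q : Poly κ n} {p′ q′} → weakenₚ κ m p ≡ p′ → weakenₚ κ m q ≡ q′ →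
               weaken m (rel κ r p q) ≡ rel κ r p′ q′
  weaken-rel κ m lt refl refl = refl
  weaken-rel κ m le refl refl = refl

  module _ (κ : Notation) {n v} (slot : ℕ → Fin v) (ι : Fin n → Fin v) (M : ℤ)
           (m : ℕ) (ι′ : Fin (n + m) → Fin (v + m)) (ι′-↑ˡ : ∀ x → ι′ (x ↑ˡ m) ≡ ι x ↑ˡ m) where

    private
      module T  = Translation κ slot ι M
      module T′ = Translation κ (λ i → slot i ↑ˡ m) ι′ M

    weaken-translateTerm : ∀ r t i → weaken m (T.translateTerm r t i) ≡ T′.translateTerm r (weakenTerm m t) i

    weaken-translateNode : ∀ r o s t i →
      weaken m (T.translateNode r o s t i) ≡ T′.translateNode r o (weakenTerm m s) (weakenTerm m t) i
    weaken-translateNode r o s t i rewrite termNodes-weaken m s =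
      cong₂ _∨_ (weaken-translateTerm r s _) (cong₂ _∨_ (weaken-glue o) (weaken-translateTerm r t _))
      where
      weaken-corner : ∀ x y → weaken m (T.corner r i x y) ≡ T′.corner r i (x ↑ˡ m) (y ↑ˡ m)
      weaken-corner x y = cong₂ _∨_ (weaken-rel κ m r (weaken-prod κ m M x y) (weaken-var κ m _))
                                    (weaken-rel κ m r (weaken-var κ m _) (weaken-prod κ m M x y))
      weaken-glue : ∀ o {j} → weaken m (T.glue r o i j) ≡ T′.glue r o i j
      weaken-glue add = cong₂ _∨_ (weaken-rel κ m r (weaken-sum κ m _ _) (weaken-var κ m _))
                                  (weaken-rel κ m r (weaken-var κ m _) (weaken-sum κ m _ _))
      weaken-glue mul = cong₂ _∨_ (cong₂ _∨_ (weaken-corner _ _) (weaken-corner _ _))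
                                  (cong₂ _∨_ (weaken-corner _ _) (weaken-corner _ _))
      weaken-glue cmp = weaken-rel κ m r (weaken-var κ m _) (weaken-var κ m _)

    weaken-leaf : ∀ r {p p′} i → weakenₚ κ m p ≡ p′ → weaken m (T.leaf r p i) ≡ T′.leaf r p′ i
    weaken-leaf r i eq = cong₂ _∨_ (weaken-rel κ m r eq (weaken-scaled κ m M _)) (weaken-rel κ m r (weaken-scaled κ m M _) eq)

    weaken-translateTerm r (con c) i = weaken-leaf r i (weaken-con κ m c)
    weaken-translateTerm r (var x) i = weaken-leaf r i (trans (weaken-var κ m (ι x)) (cong (varₚ κ) (sym (ι′-↑ˡ x))))
    weaken-translateTerm r (s ⊕ t) i = weaken-translateNode r add s t i
    weaken-translateTerm r (s ⊗ t) i = weaken-translateNode r mul s t i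

    -- Adding variables changes no node count, so every node keeps its slots. This keeps the premise
    -- in the third class free of `X`.
    weaken-translate : ∀ {φ} → QuantifierFree φ → ∀ i → weaken m (T.translate φ i) ≡ T′.translate (weaken m φ) i
    weaken-translate (p ≺ q) i = weaken-translateNode lt cmp p q i
    weaken-translate (p ≼ q) i = weaken-translateNode le cmp p q i
    weaken-translate (_∧_ {φ} f g) i rewrite nodes-weaken m φ = cong₂ _∧_ (weaken-translate f i) (weaken-translate g _)
    weaken-translate (_∨_ {φ} f g) i rewrite nodes-weaken m φ = cong₂ _∨_ (weaken-translate f i) (weaken-translate g _)

  degree : ∀ {n} → Term n → ℕ
  degree (con _) = 0
  degree (var _) = 1
  degree (s ⊕ t) = degree s ℕ.⊔ degree t
  degree (s ⊗ t) = degree s + degree t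

  sum-zipWith-+ : ∀ {n} (α β : Vec ℕ n) → Vec.sum (Vec.zipWith _+_ α β) ≡ Vec.sum α + Vec.sum β
  sum-zipWith-+ []      []      = refl
  sum-zipWith-+ (a ∷ α) (b ∷ β) = trans (cong (_+_ (a + b)) (sum-zipWith-+ α β)) (interchange a b (Vec.sum α) (Vec.sum β))
    where
    open import Algebra.Properties.CommutativeSemigroup ℕ.+-commutativeSemigroup using (interchange)

  sum-replicate-0 : ∀ n → Vec.sum (Vec.replicate n 0) ≡ 0
  sum-replicate-0 zero    = refl
  sum-replicate-0 (suc n) = sum-replicate-0 n

  sum-unit : ∀ {n} (i : Fin n) → Vec.sum (Vec.replicate n 0 [ i ]≔ 1) ≡ 1
  sum-unit {suc n} zero    = cong suc (sum-replicate-0 n)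
  sum-unit         (suc i) = sum-unit i

  expandTerm-degree : ∀ {n} (t : Term n) → All (λ (α , _) → Vec.sum α ≤ degree t) (expandTerm t)
  expandTerm-degree {n} (con c) = ℕ.≤-reflexive (sum-replicate-0 n) ∷ []
  expandTerm-degree (var i) = ℕ.≤-reflexive (sum-unit i) ∷ []
  expandTerm-degree (s ⊕ t) = All.++⁺ (All.map (λ h → ≤-trans h (ℕ.m≤m⊔n _ _)) (expandTerm-degree s))
                                      (All.map (λ h → ≤-trans h (ℕ.m≤n⊔m (degree s) _)) (expandTerm-degree t))
  expandTerm-degree (s ⊗ t) = All.cartesianProductWith⁺ (≡.setoid _) (≡.setoid _) _ (expandTerm s) (expandTerm t)
    λ {(α , _)} {(β , _)} ∈s ∈t → ≤-trans (ℕ.≤-reflexive (sum-zipWith-+ α β))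
      (+-mono-≤ (All.lookup (expandTerm-degree s) ∈s) (All.lookup (expandTerm-degree t) ∈t))
    where
    import Relation.Binary.PropositionalEquality as ≡

  coefficient-≡0 : ∀ {n d} {P : Monomials n} → All (λ (α , _) → Vec.sum α ≤ d) P →
                   ∀ α → d < Vec.sum α → coefficient P α ≡ 0ℤ
  coefficient-≡0 []                     α d<α = refl
  coefficient-≡0 (_∷_ {β , c} β≤d hs) α d<α with ≡-dec ℕ._≟_ β α
  ... | yes refl = contradiction β≤d (ℕ.<⇒≱ d<α)
  ... | no  _    = coefficient-≡0 hs α d<α

  -- `degree` does not look at the names of variables, so for the atoms of the translation the
  -- implicit argument is found by evaluation.
  totalDegree≤ : ∀ {n} d (t : Term n) → {True (degree t ℕ.≤? d)} → TotalDegree≤ terms d t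
  totalDegree≤ d t {w} = coefficient-≡0 (All.map (λ h → ≤-trans h (toWitness w)) (expandTerm-degree t))

  module _ {n v} (slot : ℕ → Fin v) (ι : Fin n → Fin v) (M : ℤ) where
    open Translation terms slot ι M

    rel-degree : ∀ r (s t : Term v) → {True (degree s ℕ.≤? 4)} → {True (degree t ℕ.≤? 4)} → AtomsOfDegree≤ 4 (rel terms r s t)
    rel-degree lt s t {h} {k} = totalDegree≤ 4 s {h} , totalDegree≤ 4 t {k}
    rel-degree le s t {h} {k} = totalDegree≤ 4 s {h} , totalDegree≤ 4 t {k}

    translateTerm-degree : ∀ r t i → AtomsOfDegree≤ 4 (translateTerm r t i)

    translateNode-degree : ∀ r o s t i → AtomsOfDegree≤ 4 (translateNode r o s t i)
    translateNode-degree r o s t i = translateTerm-degree r s _ , glue-degree o , translateTerm-degree r t _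
      where
      corner-degree : ∀ x y → AtomsOfDegree≤ 4 (corner r i x y)
      corner-degree x y = rel-degree r _ _ , rel-degree r _ _
      glue-degree : ∀ o {j} → AtomsOfDegree≤ 4 (glue r o i j)
      glue-degree add = rel-degree r _ _ , rel-degree r _ _
      glue-degree mul = (corner-degree _ _ , corner-degree _ _) , (corner-degree _ _ , corner-degree _ _)
      glue-degree cmp = rel-degree r _ _

    translateTerm-degree r (con c) i = rel-degree r _ _ , rel-degree r _ _
    translateTerm-degree r (var x) i = rel-degree r _ _ , rel-degree r _ _
    translateTerm-degree r (s ⊕ t) i = translateNode-degree r add s t i
    translateTerm-degree r (s ⊗ t) i = translateNode-degree r mul s t i

    translate-degree : ∀ φ i → AtomsOfDegree≤ 4 (translate φ i)
    translate-degree (p ≺ q)    i = translateNode-degree lt cmp p q i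
    translate-degree (p ≼ q)    i = translateNode-degree le cmp p q i
    translate-degree (φ ∧ ψ)    i = translate-degree φ i , translate-degree ψ _
    translate-degree (φ ∨ ψ)    i = translate-degree φ i , translate-degree ψ _
    translate-degree (exists φ) i = rel-degree le (con 0ℤ) (con 0ℤ)
    translate-degree (all φ)    i = rel-degree le (con 0ℤ) (con 0ℤ)

  neg-degree : ∀ {n d} (φ : Formula terms n) → AtomsOfDegree≤ d φ → AtomsOfDegree≤ d (neg φ)
  neg-degree (p ≺ q)    (h , k) = k , h
  neg-degree (p ≼ q)    (h , k) = k , h
  neg-degree (φ ∧ ψ)    (h , k) = neg-degree φ h , neg-degree ψ k
  neg-degree (φ ∨ ψ)    (h , k) = neg-degree φ h , neg-degree ψ k
  neg-degree (exists φ) h       = neg-degree φ h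
  neg-degree (all φ)    h       = neg-degree φ h

  bound-degree : ∀ {n} (xs : List (Fin n)) → AtomsOfDegree≤ 4 (∣_∣≤_ {terms} xs 1ℤ)
  bound-degree []       = totalDegree≤ 4 (con 0ℤ) , totalDegree≤ 4 (con 0ℤ)
  bound-degree (x ∷ xs) =
    ( (totalDegree≤ 4 (con (ℤ.- 1ℤ)) , totalDegree≤ 4 (var x))
    , (totalDegree≤ 4 (var x) , totalDegree≤ 4 (con 1ℤ))) , bound-degree xs

  existsBlock-degree : ∀ m {d} {φ : Formula terms m} → AtomsOfDegree≤ d φ → AtomsOfDegree≤ d (existsBlock m φ)
  existsBlock-degree zero    h = h
  existsBlock-degree (suc m) h = existsBlock-degree m h

  allBlock-degree : ∀ n {m d} {φ : Formula terms (n + m)} → AtomsOfDegree≤ d φ → AtomsOfDegree≤ d (allBlock n φ)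
  allBlock-degree zero    h = h
  allBlock-degree (suc n) h = allBlock-degree n h

  quantify : ∀ {κ} → Bool → ∀ m n → Formula κ (n + m) → Sentence κ
  quantify false = ∃∀
  quantify true  = ∃∀ᴵ

  quantify-degree : ∀ b m n {Φ : Formula terms (n + m)} → AtomsOfDegree≤ 4 Φ → AtomsOfDegree≤ 4 (quantify b m n Φ)
  quantify-degree false m n h = existsBlock-degree m (allBlock-degree n h)
  quantify-degree true  m n h = existsBlock-degree m (allBlock-degree n
    (neg-degree (∣ map (_↑ˡ m) (allFin n) ∣≤ 1ℤ) (bound-degree (map (_↑ˡ m) (allFin n))) , bound-degree (map (n ↑ʳ_) (allFin m)) , h))

  -- Indices beyond k are truncated.
  clamp : ∀ {k} → ℕ → Fin (suc k)
  clamp         zero    = zero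
  clamp {zero}  (suc i) = zero
  clamp {suc k} (suc i) = suc (clamp i)

  toℕ-clamp : ∀ {k i} → i ≤ k → toℕ (clamp {k} i) ≡ i
  toℕ-clamp {zero}  z≤n      = refl
  toℕ-clamp {suc k} z≤n      = refl
  toℕ-clamp {suc k} (s≤s i≤k) = cong suc (toℕ-clamp i≤k)

  shift : ∀ k n m → Fin (n + m) → Fin ((k + n) + m)
  shift k n m x = [ (λ y → (k ↑ʳ y) ↑ˡ m) , (k + n) ↑ʳ_ ]′ (splitAt n x)

  shift-↑ˡ : ∀ k n m y → shift k n m (y ↑ˡ m) ≡ (k ↑ʳ y) ↑ˡ m
  shift-↑ˡ k n m y rewrite splitAt-↑ˡ n y m = refl

  shift-↑ʳ : ∀ k n m x → shift k n m (n ↑ʳ x) ≡ (k + n) ↑ʳ x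
  shift-↑ʳ k n m x rewrite splitAt-↑ʳ n m x = refl

  -- The variables of `Y` and those of `X` move by the same amount; the machine need not tell them
  -- apart and prefixes a fixed number of ones.
  toℕ-shift : ∀ k n m x → toℕ (shift k n m x) ≡ k + toℕ x
  toℕ-shift k n m x with splitAt n x in eq
  ... | inj₁ y = trans (toℕ-↑ˡ (k ↑ʳ y) m) (trans (toℕ-↑ʳ k y)
                   (cong (k +_) (trans (sym (toℕ-↑ˡ y m)) (cong toℕ (splitAt⁻¹-↑ˡ eq)))))
  ... | inj₂ y = trans (toℕ-↑ʳ (k + n) y) (trans (ℕ.+-assoc k n (toℕ y))
                   (cong (k +_) (trans (sym (toℕ-↑ʳ n y)) (cong toℕ (splitAt⁻¹-↑ʳ eq)))))

  slotᴺ : ∀ k n → ℕ → Fin (suc k + n)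
  slotᴺ k n i = clamp {k} i ↑ˡ n

  simplified : ∀ κ k m n → ℤ → Formula terms (n + m) → Formula κ ((suc k + n) + m)
  simplified κ k m n M Φ = Translation.translate κ (λ i → slotᴺ k n i ↑ˡ m) (shift (suc k) n m) M Φ 0

  bounded : Class → Bool
  bounded Σ₂≤     = false
  bounded b-Σ₂≤   = true
  bounded b-Σ₂≤⁺⁺ = true

  -- In the third class the whole implication is the matrix, numbered throughout. What has to be
  -- recovered is the shape of the result: its first disjunct must be the negation of a weakened
  -- `QFF≤` formula in the universal variables.
  simplified-∈ : ∀ 𝒞 κ k M {φ : Sentence terms} → φ ∈ 𝒞 →
    ∃ λ m → ∃ λ n → ∃ λ (Φ : Formula terms (n + m)) →
      QuantifierFree Φ × φ ≡ quantify (bounded 𝒞) m n Φ × quantify (bounded 𝒞) m (suc k + n) (simplified κ k m n M Φ) ∈ 𝒞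
  simplified-∈ Σ₂≤ κ k M (Σ₂-sentence m n {Φ} f) =
    m , n , Φ , QFF≤⇒quantifierFree f , refl , Σ₂-sentence m (suc k + n) (Translation.translate-QFF≤ κ _ _ M f 0)
  simplified-∈ b-Σ₂≤ κ k M (b-Σ₂-sentence m n {Φ} f) =
    m , n , Φ , QFF≤⇒quantifierFree f , refl , b-Σ₂-sentence m (suc k + n) (Translation.translate-QFF≤ κ _ _ M f 0)
  simplified-∈ b-Σ₂≤⁺⁺ κ k M (b-Σ₂⁺⁺-sentence m n {Ψ} {Φ} g f) =
      m , n , (weaken m Ψ ⇒ Φ)
    , neg-quantifierFree (weaken-quantifierFree m (QFF≤⇒quantifierFree g)) ∨ QFF≤⇒quantifierFree f
    , refl
    , subst (λ χ → ∃∀ᴵ m (suc k + n) (χ ∨ translate Φ (nodes (neg (weaken m Ψ)))) ∈ b-Σ₂≤⁺⁺) eq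
        (b-Σ₂⁺⁺-sentence m (suc k + n) (T.neg-translate-QFF≤ g 0) (translate-QFF≤ f _))
    where
    module T = Translation κ (slotᴺ k n) (suc k ↑ʳ_) M
    open Translation κ (λ i → slotᴺ k n i ↑ˡ m) (shift (suc k) n m) M
    open ≡-Reasoning
    eq : neg (weaken m (neg (T.translate (neg Ψ) 0))) ≡ translate (neg (weaken m Ψ)) 0
    eq = begin
      neg (weaken m (neg (T.translate (neg Ψ) 0)))  ≡⟨ neg-weaken m (neg (T.translate (neg Ψ) 0)) ⟩
      weaken m (neg (neg (T.translate (neg Ψ) 0)))  ≡⟨ cong (weaken m) (neg-involutive _) ⟩
      weaken m (T.translate (neg Ψ) 0)
        ≡⟨ weaken-translate κ (slotᴺ k n) (suc k ↑ʳ_) M m (shift (suc k) n m) (shift-↑ˡ (suc k) n m)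
             (neg-quantifierFree (QFF≤⇒quantifierFree g)) 0 ⟩
      translate (weaken m (neg Ψ)) 0                ≡⟨ cong (λ χ → translate χ 0) (neg-weaken m Ψ) ⟨
      translate (neg (weaken m Ψ)) 0                ∎

-- Inequalities in ordered fields, strict and non-strict at once.

module OrderedFields where

  open IntervalTranslation using (Comparison; lt; le)
  open import Algebra.Solver.Ring.AlmostCommutativeRing using (fromCommutativeRing; _-Raw-AlmostCommutative⟶_)
  open import Data.Integer.Base as ℤ using (ℤ; +_; -[1+_]; 0ℤ)
  import Data.Integer.Properties as ℤ
  open import Data.Maybe.Base as Maybe using (just; nothing)
  open import Data.Nat.Base as ℕ using (ℕ; zero; suc; z≤n; s≤s)
  import Data.Nat.Properties as ℕ
  open import Data.Product.Base using (∃; _×_; _,_; proj₁)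
  open import Data.Sum.Base using (inj₁; inj₂)
  open import Function.Base using (_∘_)
  open import Relation.Binary.Definitions using (WeaklyDecidable)
  import Relation.Binary.Construct.NonStrictToStrict as ToStrict
  import Relation.Binary.PropositionalEquality as ≡
  open import Relation.Binary.Structures using (IsDecTotalOrder)
  open import Relation.Nullary.Decidable.Core using (Dec; yes; no)
  open import Relation.Nullary.Negation.Core using (¬_)

  -- `y ≤[ dual r ] x` is the negation of `x ≤[ r ] y`. The translation is analysed through its
  -- failing disjuncts, so its atoms of kind `r` lead to estimates of kind `dual r`: strict ones for
  -- the atoms of `Φ`, non-strict ones for those of `neg Ψ`.
  dual : Comparison → Comparison
  dual lt = le
  dual le = lt

  module OrderedField (ℝ : RealNumbers) where
    open RealNumbers ℝ public renaming (zero to *-zero)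
    open IsDecTotalOrder isDecTotalOrder public
      using (_≤?_; _≟_; total; antisym; ≤-respˡ-≈; ≤-respʳ-≈)
      renaming (refl to ≤-refl; trans to ≤-trans; reflexive to ≤-reflexive)
    import Algebra.Properties.Ring ring as Ring
    open import Algebra.Properties.Semiring.Mult semiring using (×-homo-+; ×1-homo-*; ×-homo-1)
    open import Relation.Binary.Reasoning.Setoid setoid

    fromℤ-⊖ : ∀ m n → fromℤ (m ℤ.⊖ n) ≈ m · 1# - n · 1#
    fromℤ-⊖ zero    zero    = sym (-‿inverseʳ 0#)
    fromℤ-⊖ (suc m) zero    = sym (trans (+-congˡ Ring.-0#≈0#) (+-identityʳ _))
    fromℤ-⊖ zero    (suc n) = sym (+-identityˡ _)
    fromℤ-⊖ (suc m) (suc n) = begin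
      fromℤ (suc m ℤ.⊖ suc n)                  ≡⟨ ≡.cong fromℤ (ℤ.[1+m]⊖[1+n]≡m⊖n m n) ⟩
      fromℤ (m ℤ.⊖ n)                          ≈⟨ fromℤ-⊖ m n ⟩
      m · 1# - n · 1#                          ≈⟨ +-congʳ (+-identityˡ _) ⟨
      (0# + m · 1#) - n · 1#                   ≈⟨ +-congʳ (+-congʳ (-‿inverseʳ 1#)) ⟨
      ((1# - 1#) + m · 1#) - n · 1#            ≈⟨ +-congʳ (+-assoc _ _ _) ⟩
      (1# + (- 1# + m · 1#)) - n · 1#          ≈⟨ +-congʳ (+-congˡ (+-comm _ _)) ⟩
      (1# + (m · 1# - 1#)) - n · 1#            ≈⟨ +-congʳ (+-assoc _ _ _) ⟨
      ((1# + m · 1#) - 1#) - n · 1#            ≈⟨ +-assoc _ _ _ ⟩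
      (1# + m · 1#) + (- 1# - n · 1#)          ≈⟨ +-congˡ (Ring.-‿+-comm 1# (n · 1#)) ⟩
      (1# + m · 1#) - (1# + n · 1#)            ∎

    fromℤ-+ : ∀ i j → fromℤ (i ℤ.+ j) ≈ fromℤ i + fromℤ j
    fromℤ-+ (+ m)    (+ n)    = ×-homo-+ 1# m n
    fromℤ-+ (+ m)    -[1+ n ] = fromℤ-⊖ m (suc n)
    fromℤ-+ -[1+ m ] (+ n)    = trans (fromℤ-⊖ n (suc m)) (+-comm _ _)
    fromℤ-+ -[1+ m ] -[1+ n ] = begin
      - (suc (suc (m ℕ.+ n)) · 1#)             ≡⟨ ≡.cong (λ k → - (k · 1#)) (≡.sym (ℕ.+-suc (suc m) n)) ⟩
      - ((suc m ℕ.+ suc n) · 1#)               ≈⟨ -‿cong (×-homo-+ 1# (suc m) (suc n)) ⟩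
      - (suc m · 1# + suc n · 1#)              ≈⟨ Ring.-‿+-comm _ _ ⟨
      - (suc m · 1#) - suc n · 1#              ∎

    fromℤ-neg : ∀ i → fromℤ (ℤ.- i) ≈ - fromℤ i
    fromℤ-neg (+ zero)  = sym Ring.-0#≈0#
    fromℤ-neg (+ suc n) = refl
    fromℤ-neg -[1+ n ]  = sym (Ring.-‿involutive _)

    fromℤ-pos-* : ∀ m j → fromℤ (+ m ℤ.* j) ≈ fromℤ (+ m) * fromℤ j
    fromℤ-pos-* m (+ n)    = trans (reflexive (≡.cong fromℤ (≡.sym (ℤ.pos-* m n)))) (×1-homo-* m n)
    fromℤ-pos-* m -[1+ n ] = begin
      fromℤ (+ m ℤ.* -[1+ n ])          ≡⟨ ≡.cong fromℤ (ℤ.neg-distribʳ-* (+ m) (+ suc n)) ⟨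
      fromℤ (ℤ.- (+ m ℤ.* + suc n))     ≈⟨ fromℤ-neg (+ m ℤ.* + suc n) ⟩
      - fromℤ (+ m ℤ.* + suc n)         ≈⟨ -‿cong (fromℤ-pos-* m (+ suc n)) ⟩
      - (fromℤ (+ m) * fromℤ (+ suc n)) ≈⟨ Ring.-‿distribʳ-* _ _ ⟩
      fromℤ (+ m) * fromℤ -[1+ n ]      ∎

    fromℤ-* : ∀ i j → fromℤ (i ℤ.* j) ≈ fromℤ i * fromℤ j
    fromℤ-* (+ m)    j = fromℤ-pos-* m j
    fromℤ-* -[1+ m ] j = begin
      fromℤ (-[1+ m ] ℤ.* j)            ≡⟨ ≡.cong fromℤ (ℤ.neg-distribˡ-* (+ suc m) j) ⟨
      fromℤ (ℤ.- (+ suc m ℤ.* j))       ≈⟨ fromℤ-neg (+ suc m ℤ.* j) ⟩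
      - fromℤ (+ suc m ℤ.* j)           ≈⟨ -‿cong (fromℤ-pos-* (suc m) j) ⟩
      - (fromℤ (+ suc m) * fromℤ j)     ≈⟨ Ring.-‿distribˡ-* _ _ ⟩
      fromℤ -[1+ m ] * fromℤ j          ∎

    private
      morphism : ℤ.+-*-rawRing -Raw-AlmostCommutative⟶ fromCommutativeRing commutativeRing
      morphism = record
        { ⟦_⟧    = fromℤ
        ; +-homo = fromℤ-+
        ; *-homo = fromℤ-*
        ; -‿homo = fromℤ-neg
        ; 0-homo = refl
        ; 1-homo = ×-homo-1 1#
        }

      coeff≟ : WeaklyDecidable (λ i j → fromℤ i ≈ fromℤ j)
      coeff≟ i j with i ℤ.≟ j
      ... | yes i≡j = just (reflexive (≡.cong fromℤ i≡j))
      ... | no  _   = nothing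

    open import Algebra.Solver.Ring ℤ.+-*-rawRing (fromCommutativeRing commutativeRing) morphism coeff≟
      using (solve; _:=_; _:+_; _:*_; _:-_; :-_) renaming (con to :con) public

    infix 4 _≤[_]_

    _≤[_]_ : Carrier → Comparison → Carrier → Set
    x ≤[ lt ] y = x < y
    x ≤[ le ] y = x ≤ y

    ≤[]-dec : ∀ r x y → Dec (x ≤[ r ] y)
    ≤[]-dec lt = ToStrict.<-decidable _≈_ _≤_ _≟_ _≤?_
    ≤[]-dec le = _≤?_

    ≤[]⇒≤ : ∀ r {x y} → x ≤[ r ] y → x ≤ y
    ≤[]⇒≤ lt = proj₁
    ≤[]⇒≤ le h = h

    ¬≤[]⇒ : ∀ r {x y} → ¬ x ≤[ r ] y → y ≤[ dual r ] x
    ¬≤[]⇒ lt = ToStrict.≮⇒≥ _≈_ _≤_ sym _≟_ ≤-reflexive total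
    ¬≤[]⇒ le = ToStrict.≰⇒> _≈_ _≤_ sym ≤-reflexive total

    ≤[]⇒¬ : ∀ r {x y} → y ≤[ dual r ] x → ¬ x ≤[ r ] y
    ≤[]⇒¬ lt = ToStrict.≤⇒≯ _≈_ _≤_ antisym
    ≤[]⇒¬ le = ToStrict.<⇒≱ _≈_ _≤_ antisym

    ≤[]-≤-trans : ∀ r {x y z} → x ≤[ r ] y → y ≤ z → x ≤[ r ] z
    ≤[]-≤-trans lt = ToStrict.<-≤-trans _≈_ _≤_ sym ≤-trans antisym ≤-respʳ-≈
    ≤[]-≤-trans le = ≤-trans

    ≤-≤[]-trans : ∀ r {x y z} → x ≤ y → y ≤[ r ] z → x ≤[ r ] z
    ≤-≤[]-trans lt = ToStrict.≤-<-trans _≈_ _≤_ ≤-trans antisym ≤-respˡ-≈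
    ≤-≤[]-trans le = ≤-trans

    ≤[]-resp : ∀ r {x x′ y y′} → x ≈ x′ → y ≈ y′ → x ≤[ r ] y → x′ ≤[ r ] y′
    ≤[]-resp r ex ey h = ≤-≤[]-trans r (≤-reflexive (sym ex)) (≤[]-≤-trans r h (≤-reflexive ey))

    +-monoˡ-≤[] : ∀ r z {x y} → x ≤[ r ] y → x + z ≤[ r ] y + z
    +-monoˡ-≤[] le z h = +-monoˡ-≤ z h
    +-monoˡ-≤[] lt z {x} {y} (h , x≉y) = +-monoˡ-≤ z h , λ eq → x≉y (Ring.+-cancelʳ z x y eq)

    -- Any rearrangement of an inequality becomes an identity between differences, which the ring
    -- solver proves.
    ≤[]-from : ∀ r {x y u v} → x ≤[ r ] y → y - x ≈ v - u → u ≤[ r ] v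
    ≤[]-from r {x} {y} {u} {v} h eq = ≤[]-resp r
      (solve 2 (λ x u → x :+ (u :- x) := u) refl x u)
      (trans (solve 3 (λ x y u → y :+ (u :- x) := (y :- x) :+ u) refl x y u)
        (trans (+-congʳ eq) (solve 2 (λ u v → (v :- u) :+ u := v) refl u v)))
      (+-monoˡ-≤[] r (u - x) h)

    +-mono-≤[] : ∀ r {x y u v} → x ≤[ r ] y → u ≤[ r ] v → x + u ≤[ r ] y + v
    +-mono-≤[] r {x} {y} {u} {v} h k = ≤-≤[]-trans′ (+-monoˡ-≤[] r u h)
      (≤[]-resp r (+-comm u y) (+-comm v y) (+-monoˡ-≤[] r y k))
      where
      ≤-≤[]-trans′ : ∀ {x y z} → x ≤[ r ] y → y ≤[ r ] z → x ≤[ r ] z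
      ≤-≤[]-trans′ h k = ≤-≤[]-trans r (≤[]⇒≤ r h) k

    +-mono-≤ : ∀ {x y u v} → x ≤ y → u ≤ v → x + u ≤ y + v
    +-mono-≤ = +-mono-≤[] le

    *-monoˡ-≤ : ∀ {c x y} → 0# ≤ c → x ≤ y → c * x ≤ c * y
    *-monoˡ-≤ {c} {x} {y} 0≤c x≤y = ≤[]-from le
      (*-nonNegative 0≤c (≤[]-from le x≤y (solve 2 (λ x y → y :- x := (y :- x) :- :con 0ℤ) refl x y)))
      (solve 3 (λ c x y → c :* (y :- x) :- :con 0ℤ := c :* y :- c :* x) refl c x y)

    *-monoˡ-≥ : ∀ {c x y} → c ≤ 0# → x ≤ y → c * y ≤ c * x
    *-monoˡ-≥ {c} {x} {y} c≤0 x≤y = ≤[]-from le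
      (*-monoˡ-≤ (≤[]-from le c≤0 (solve 1 (λ c → :con 0ℤ :- c := :- c :- :con 0ℤ) refl c)) x≤y)
      (solve 3 (λ c x y → (:- c) :* y :- (:- c) :* x := c :* x :- c :* y) refl c x y)

    0≤1 : 0# ≤ 1#
    0≤1 with total 0# 1#
    ... | inj₁ h = h
    ... | inj₂ h = ≤[]-resp le (zeroʳ 1#) (*-identityˡ 1#) (*-monoˡ-≥ h h)

    0<1 : 0# < 1#
    0<1 = 0≤1 , 0≉1

    pos-inverse : ∀ {x} → 0# < x → ∃ λ y → x * y ≈ 1# × 0# < y
    pos-inverse {x} (0≤x , 0≉x) with inverse x (0≉x ∘ sym)
    ... | y , xy≈1 = y , xy≈1 , ¬≤[]⇒ le λ y≤0 →
      ≤[]⇒¬ le 0<1 (≤[]-resp le xy≈1 (zeroʳ x) (*-monoˡ-≤ 0≤x y≤0))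

    *-cancelˡ-≤ : ∀ {c x y} → 0# < c → c * x ≤ c * y → x ≤ y
    *-cancelˡ-≤ {c} {x} {y} 0<c h = divide (pos-inverse 0<c)
      where
      divide : (∃ λ d → c * d ≈ 1# × 0# < d) → x ≤ y
      divide (d , cd≈1 , 0<d) = ≤[]-resp le (cancel x) (cancel y) (*-monoˡ-≤ (proj₁ 0<d) h)
        where
        cancel : ∀ x → d * (c * x) ≈ x
        cancel x = trans (solve 3 (λ c d x → d :* (c :* x) := (c :* d) :* x) refl c d x)
                         (trans (*-congʳ cd≈1) (*-identityˡ x))

    *-monoˡ-≤[] : ∀ r {c x y} → 0# < c → x ≤[ r ] y → c * x ≤[ r ] c * y
    *-monoˡ-≤[] le 0<c h = *-monoˡ-≤ (proj₁ 0<c) h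
    *-monoˡ-≤[] lt 0<c h = ¬≤[]⇒ le λ k → ≤[]⇒¬ le h (*-cancelˡ-≤ 0<c k)

    +-positive : ∀ {x y} → 0# ≤ x → 0# < y → 0# < x + y
    +-positive h k = ≤-≤[]-trans lt h (≤[]-resp lt (+-identityˡ _) (+-comm _ _) (+-monoˡ-≤[] lt _ k))

    half-≤ : ∀ {x} → 0# ≤ x + x → 0# ≤ x
    half-≤ {x} h with total 0# x
    ... | inj₁ 0≤x = 0≤x
    ... | inj₂ x≤0 = ≤-trans h (≤[]-resp le refl (+-identityʳ x) (≤[]-resp le (+-comm _ _) (+-comm _ _) (+-monoˡ-≤ x x≤0)))

    nonNeg : ∀ {x y} → x ≤ y → 0# ≤ y - x
    nonNeg {x} {y} h = ≤[]-from le h (solve 2 (λ x y → y :- x := (y :- x) :- :con 0ℤ) refl x y)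

    infix 4 ∣_∣≲_

    ∣_∣≲_ : Carrier → Carrier → Set
    ∣ x ∣≲ X = - X ≤ x × x ≤ X

    ≲-resp : ∀ {x y X Y} → x ≈ y → X ≈ Y → ∣ x ∣≲ X → ∣ y ∣≲ Y
    ≲-resp e E (h , k) = ≤[]-resp le (-‿cong E) e h , ≤[]-resp le e E k

    ≲-weaken : ∀ {x X Y} → X ≤ Y → ∣ x ∣≲ X → ∣ x ∣≲ Y
    ≲-weaken {x} {X} {Y} X≤Y (h , k) = ≤-trans (≤[]-from le X≤Y (solve 2 (λ X Y → Y :- X := (:- X) :- (:- Y)) refl X Y)) h , ≤-trans k X≤Y

    ≲-self : ∀ {x} → 0# ≤ x → ∣ x ∣≲ x
    ≲-self {x} h = ≤-trans (≤[]-from le h (solve 1 (λ x → x :- :con 0ℤ := :con 0ℤ :- (:- x)) refl x)) h , ≤-refl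

    ≲-neg : ∀ {x X} → ∣ x ∣≲ X → ∣ - x ∣≲ X
    ≲-neg {x} {X} (h , k) = ≤[]-from le k (solve 2 (λ x X → X :- x := (:- x) :- (:- X)) refl x X)
                          , ≤[]-from le h (solve 2 (λ x X → x :- (:- X) := X :- (:- x)) refl x X)

    ≲-+ : ∀ {x y X Y} → ∣ x ∣≲ X → ∣ y ∣≲ Y → ∣ x + y ∣≲ X + Y
    ≲-+ {X = X} {Y} (h , k) (h′ , k′) =
      ≤[]-resp le (solve 2 (λ X Y → (:- X) :+ (:- Y) := :- (X :+ Y)) refl X Y) refl (+-mono-≤ h h′) , +-mono-≤ k k′

    -- `(X - x)(y + Y)` and `(x + X)(Y - y)` are nonnegative and add up to `2 (X Y - x y)`, so no
    -- distinction of signs arises.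
    *-≤-from-abs : ∀ {x y X Y} → ∣ x ∣≲ X → ∣ y ∣≲ Y → x * y ≤ X * Y
    *-≤-from-abs {x} {y} {X} {Y} (h , k) (h′ , k′) = ≤[]-from le
      (half-≤ (≤[]-resp le (+-identityˡ 0#)
        (solve 4 (λ x y X Y → (X :- x) :* (y :- (:- Y)) :+ (x :- (:- X)) :* (Y :- y)
                           := (X :* Y :- x :* y) :+ (X :* Y :- x :* y)) refl x y X Y)
        (+-mono-≤ (*-nonNegative (nonNeg k) (nonNeg h′)) (*-nonNegative (nonNeg h) (nonNeg k′)))))
      (solve 2 (λ a b → (b :- a) :- :con 0ℤ := b :- a) refl (x * y) (X * Y))

    ≲-* : ∀ {x y X Y} → ∣ x ∣≲ X → ∣ y ∣≲ Y → ∣ x * y ∣≲ X * Y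
    ≲-* {x} {y} {X} {Y} h k =
        ≤[]-from le (*-≤-from-abs h (≲-neg k)) (solve 4 (λ x y X Y → X :* Y :- x :* (:- y) := x :* y :- (:- (X :* Y))) refl x y X Y)
      , *-≤-from-abs h k

    ≲-exists : ∀ x → ∃ λ X → 0# ≤ X × ∣ x ∣≲ X
    ≲-exists x with total 0# x
    ... | inj₁ 0≤x = x , 0≤x , ≲-self 0≤x
    ... | inj₂ x≤0 = - x , 0≤-x , ≲-resp (Ring.-‿involutive x) refl (≲-neg (≲-self 0≤-x))
      where
      0≤-x : 0# ≤ - x
      0≤-x = ≤[]-from le x≤0 (solve 1 (λ x → :con 0ℤ :- x := (:- x) :- :con 0ℤ) refl x)

    -- For r = le one may take ε = 0.
    shrink : ∀ r C {δ} → 1# ≤ C → 0# ≤[ r ] δ → ∃ λ ε → 0# ≤[ r ] ε × ε ≤ 1# × C * ε ≤[ r ] δ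
    shrink le C 1≤C 0≤δ = 0# , ≤-refl , 0≤1 , ≤-trans (≤-reflexive (zeroʳ C)) 0≤δ
    shrink lt C {δ} 1≤C 0<δ = main cut (pos-inverse {C + C} (+-positive (proj₁ 0<C) 0<C))
      where
      0<C : 0# < C
      0<C = ≤[]-≤-trans lt 0<1 1≤C
      cut : ∃ λ δ′ → 0# < δ′ × δ′ ≤ 1# × δ′ ≤ δ
      cut with total δ 1#
      ... | inj₁ δ≤1 = δ , 0<δ , δ≤1 , ≤-refl
      ... | inj₂ 1≤δ = 1# , 0<1 , ≤-refl , 1≤δ
      main : (∃ λ δ′ → 0# < δ′ × δ′ ≤ 1# × δ′ ≤ δ) → (∃ λ c → (C + C) * c ≈ 1# × 0# < c) →
             ∃ λ ε → 0# < ε × ε ≤ 1# × C * ε < δ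
      -- `ε` is `min(δ, 1) / 2C`. The 2 makes `C ε < δ` strict, and `1 ≤ C` gives `ε ≤ C ε ≤ 1`.
      main (δ′ , 0<δ′ , δ′≤1 , δ′≤δ) (c , 2Cc≈1 , 0<c) =
        δ′ * c , 0<ε , ≤-trans ε≤Cε (≤-trans (proj₁ Cε<δ′) δ′≤1) , ≤[]-≤-trans lt Cε<δ′ δ′≤δ
        where
        0<ε : 0# < δ′ * c
        0<ε = ≤[]-resp lt (zeroʳ δ′) refl (*-monoˡ-≤[] lt 0<δ′ 0<c)
        ε≤Cε : δ′ * c ≤ C * (δ′ * c)
        ε≤Cε = ≤[]-resp le (*-identityʳ _) (*-comm _ C) (*-monoˡ-≤ (proj₁ 0<ε) 1≤C)
        2Cε≈δ′ : C * (δ′ * c) + C * (δ′ * c) ≈ δ′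
        2Cε≈δ′ = trans (solve 3 (λ C δ c → C :* (δ :* c) :+ C :* (δ :* c) := ((C :+ C) :* c) :* δ) refl C δ′ c)
                       (trans (*-congʳ 2Cc≈1) (*-identityˡ δ′))
        Cε<δ′ : C * (δ′ * c) < δ′
        Cε<δ′ = ≤[]-resp lt (+-identityˡ _) 2Cε≈δ′ (+-monoˡ-≤[] lt (C * (δ′ * c)) (≤[]-≤-trans lt 0<ε ε≤Cε))

    Convex : (Carrier → Set) → Set
    Convex P = ∀ {u x v} → P u → P v → u ≤ x → x ≤ v → P x

    -- For fixed b the map x ↦ x b is monotone or antitone.
    convex-* : ∀ {P u x v b} → Convex P → P (u * b) → P (v * b) → u ≤ x → x ≤ v → P (x * b)
    convex-* {P} {u} {x} {v} {b} conv pu pv u≤x x≤v with total 0# b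
    ... | inj₁ 0≤b = conv pu pv (≤[]-resp le (*-comm b u) (*-comm b x) (*-monoˡ-≤ 0≤b u≤x))
                                (≤[]-resp le (*-comm b x) (*-comm b v) (*-monoˡ-≤ 0≤b x≤v))
    ... | inj₂ b≤0 = conv pv pu (≤[]-resp le (*-comm b v) (*-comm b x) (*-monoˡ-≥ b≤0 x≤v))
                                (≤[]-resp le (*-comm b x) (*-comm b u) (*-monoˡ-≥ b≤0 u≤x))

    -- The product is monotone or antitone in each argument: vary `x` with the second factor at
    -- either end, then vary `y`. Thus four corners control a whole rectangle, whatever the signs.
    convex-corners : ∀ {P u x v u′ y v′} → Convex P → (∀ {a b} → a ≈ b → P a → P b) →
                     P (u * u′) → P (u * v′) → P (v * u′) → P (v * v′) →
                     u ≤ x → x ≤ v → u′ ≤ y → y ≤ v′ → P (x * y)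
    convex-corners {P} {u} {x} {v} {u′} {y} {v′} conv resp p₁ p₂ p₃ p₄ h k h′ k′ =
      resp (*-comm y x) (convex-* {P} conv
        (resp (*-comm x u′) (convex-* {P} conv p₁ p₃ h k))
        (resp (*-comm x v′) (convex-* {P} conv p₂ p₄ h k)) h′ k′)

    ·-nonNegative : ∀ n → 0# ≤ n · 1#
    ·-nonNegative zero    = ≤-refl
    ·-nonNegative (suc n) = ≤[]-resp le (+-identityˡ 0#) refl (+-mono-≤ 0≤1 (·-nonNegative n))

    ·-mono : ∀ {m n} → m ℕ.≤ n → m · 1# ≤ n · 1#
    ·-mono {n = n} z≤n = ·-nonNegative n
    ·-mono (s≤s h) = +-mono-≤ ≤-refl (·-mono h)

    ·-pos : ∀ {n} → 1 ℕ.≤ n → 0# < n · 1#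
    ·-pos {n} h = ≤[]-≤-trans lt 0<1 (≤-trans (≤-reflexive (sym (+-identityʳ 1#))) (·-mono h))

    ·-+ : ∀ m n → (m ℕ.+ n) · 1# ≈ m · 1# + n · 1#
    ·-+ = ×-homo-+ 1#

    ·-* : ∀ m n → (m ℕ.* n) · 1# ≈ (m · 1#) * (n · 1#)
    ·-* = ×1-homo-*

-- Correctness of the translation of a matrix.

module TranslationCorrectness where

  open IntervalTranslation
  open OrderedFields
  open import Data.Fin.Base using (Fin; zero; suc; toℕ)
  open import Data.Integer.Base as ℤ using (ℤ; +_; -[1+_]; 0ℤ; 1ℤ)
  open import Data.List.Base as List using (List; []; _∷_; length; _++_)
  open import Data.List.Properties using (length-++; length-++-≤ˡ; length-++-≤ʳ; length-replicate)
  open import Data.List.Relation.Unary.All as All using (All; []; _∷_)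
  import Data.List.Relation.Unary.All.Properties as All
  open import Data.Nat.Base as ℕ using (ℕ; zero; suc; z≤n; s≤s)
  import Data.Nat.Properties as ℕ
  open import Data.Nat.Tactic.RingSolver using (solve-∀)
  open import Data.Nat.Binary.Base as ℕᵇ using (ℕᵇ; 2[1+_]; 1+[2_])
  import Data.Nat.Binary.Properties as ℕᵇ
  open import Data.Product.Base using (∃; _×_; _,_; proj₁; proj₂)
  open import Data.Sum.Base using (inj₁; inj₂)
  open import Data.Unit.Base using (⊤; tt)
  open import Data.Vec.Base as Vec using (Vec; []; _∷_; lookup; _[_]≔_)
  open import Function.Base using (_∘_)
  import Relation.Binary.PropositionalEquality as ≡
  open import Relation.Binary.PropositionalEquality using (_≡_)
  open import Relation.Nullary.Decidable using (Dec; yes; no; _×-dec_; _⊎-dec_)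
  open import Relation.Nullary.Negation.Core using (¬_; contradiction)

  nodes≤length-term : ∀ {n} (t : Term n) → termNodes t ℕ.≤ length (encodeTerm t)
  nodes≤length-term (con c) = s≤s z≤n
  nodes≤length-term (var x) = s≤s z≤n
  nodes≤length-term (s ⊕ t) rewrite length-++ (encodeTerm s) {encodeTerm t} = s≤s (ℕ.+-mono-≤ (nodes≤length-term s) (nodes≤length-term t))
  nodes≤length-term (s ⊗ t) rewrite length-++ (encodeTerm s) {encodeTerm t} = s≤s (ℕ.+-mono-≤ (nodes≤length-term s) (nodes≤length-term t))

  nodes≤length : ∀ {n} (φ : Formula terms n) → nodes φ ℕ.≤ length (encode φ)
  nodes≤length (p ≺ q) rewrite length-++ (encodeTerm p) {encodeTerm q} = s≤s (ℕ.+-mono-≤ (nodes≤length-term p) (nodes≤length-term q))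
  nodes≤length (p ≼ q) rewrite length-++ (encodeTerm p) {encodeTerm q} = s≤s (ℕ.+-mono-≤ (nodes≤length-term p) (nodes≤length-term q))
  nodes≤length (φ ∧ ψ) rewrite length-++ (encode φ) {encode ψ} = ℕ.m≤n⇒m≤1+n (ℕ.+-mono-≤ (nodes≤length φ) (nodes≤length ψ))
  nodes≤length (φ ∨ ψ) rewrite length-++ (encode φ) {encode ψ} = ℕ.m≤n⇒m≤1+n (ℕ.+-mono-≤ (nodes≤length φ) (nodes≤length ψ))
  nodes≤length (exists φ) = z≤n
  nodes≤length (all φ)    = z≤n

  -- The summand 2 lets the induction close: the digit 2 takes `n` to `2n + 2`, which exactly
  -- doubles `2 + n`. The closing letter pays for the empty numeral.
  toℕ≤2^digits : ∀ b → 2 ℕ.+ ℕᵇ.toℕ b ℕ.≤ 2 ℕ.^ length (binaryDigits b)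
  toℕ≤2^digits ℕᵇ.zero  = ℕ.≤-refl
  toℕ≤2^digits 2[1+ b ] = ℕ.≤-trans (ℕ.≤-reflexive (double-suc (ℕᵇ.toℕ b))) (ℕ.*-monoʳ-≤ 2 (toℕ≤2^digits b))
    where
    double-suc : ∀ n → 2 ℕ.+ 2 ℕ.* (1 ℕ.+ n) ≡ 2 ℕ.* (2 ℕ.+ n)
    double-suc = solve-∀
  toℕ≤2^digits 1+[2 b ] = ℕ.≤-trans (ℕ.n≤1+n _) (ℕ.≤-trans (ℕ.≤-reflexive (suc-double (ℕᵇ.toℕ b))) (ℕ.*-monoʳ-≤ 2 (toℕ≤2^digits b)))
    where
    suc-double : ∀ n → 4 ℕ.+ 2 ℕ.* n ≡ 2 ℕ.* (2 ℕ.+ n)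
    suc-double = solve-∀

  n≤2^digits : ∀ n → n ℕ.≤ 2 ℕ.^ length (binaryDigits (ℕᵇ.fromℕ n))
  n≤2^digits n = ℕ.≤-trans (ℕ.≤-reflexive (≡.sym (ℕᵇ.toℕ-fromℕ n)))
    (ℕ.≤-trans (ℕ.m≤n+m _ 2) (toℕ≤2^digits (ℕᵇ.fromℕ n)))

  2^-≤-suc : ∀ ℓ → 2 ℕ.^ ℓ ℕ.≤ 2 ℕ.^ suc ℓ
  2^-≤-suc ℓ = ℕ.^-monoʳ-≤ 2 (ℕ.n≤1+n ℓ)

  ∣c∣≤2^length : ∀ c → ℤ.∣ c ∣ ℕ.≤ 2 ℕ.^ length (binary c)
  ∣c∣≤2^length (+ n)    = ℕ.≤-trans (n≤2^digits n) (2^-≤-suc (length (binaryDigits (ℕᵇ.fromℕ n))))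
  ∣c∣≤2^length -[1+ n ] = ℕ.≤-trans (n≤2^digits (suc n)) (2^-≤-suc (length (binaryDigits (ℕᵇ.fromℕ (suc n)))))

  module Evaluation (ℝ : RealNumbers) where
    open OrderedField ℝ
    open Semantics ℝ
    open import Algebra.Properties.Semiring.Mult semiring using (×-homo-1)
    open import Algebra.Properties.Semiring.Exp semiring using (^-homo-*)

    power-0 : ∀ {n} (ρ : Vec Carrier n) → power ρ (Vec.replicate n 0) ≈ 1#
    power-0 []      = refl
    power-0 (x ∷ ρ) = trans (*-identityˡ _) (power-0 ρ)

    power-unit : ∀ {n} (ρ : Vec Carrier n) i → power ρ (Vec.replicate n 0 [ i ]≔ 1) ≈ lookup ρ i
    power-unit (x ∷ ρ) zero    = trans (*-cong (*-identityʳ x) (power-0 ρ)) (*-identityʳ x)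
    power-unit (x ∷ ρ) (suc i) = trans (*-identityˡ _) (power-unit ρ i)

    power-+ : ∀ {n} (ρ : Vec Carrier n) α β → power ρ (Vec.zipWith ℕ._+_ α β) ≈ power ρ α * power ρ β
    power-+ []      []      []      = sym (*-identityˡ 1#)
    power-+ (x ∷ ρ) (a ∷ α) (b ∷ β) = trans (*-cong (^-homo-* x a b) (power-+ ρ α β))
      (solve 4 (λ p q r s → (p :* q) :* (r :* s) := (p :* r) :* (q :* s)) refl _ _ _ _)

    private
      1*x+0 : ∀ {x y} → x ≈ y → fromℤ 1ℤ * x + 0# ≈ y
      1*x+0 e = trans (+-identityʳ _) (trans (*-cong (×-homo-1 1#) e) (*-identityˡ _))

    eval-con : ∀ κ {n} c (ρ : Vec Carrier n) → eval κ (conₚ κ c) ρ ≈ fromℤ c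
    eval-con terms    c ρ = refl
    eval-con standard c ρ = trans (+-identityʳ _) (trans (*-congˡ (power-0 ρ)) (*-identityʳ _))

    eval-var : ∀ κ {n} i (ρ : Vec Carrier n) → eval κ (varₚ κ i) ρ ≈ lookup ρ i
    eval-var terms    i ρ = refl
    eval-var standard i ρ = 1*x+0 (power-unit ρ i)

    eval-scaled : ∀ κ {n} c i (ρ : Vec Carrier n) → eval κ (scaledₚ κ c i) ρ ≈ fromℤ c * lookup ρ i
    eval-scaled terms    c i ρ = refl
    eval-scaled standard c i ρ = trans (+-identityʳ _) (*-congˡ (power-unit ρ i))

    eval-sum : ∀ κ {n} i j (ρ : Vec Carrier n) → eval κ (sumₚ κ i j) ρ ≈ lookup ρ i + lookup ρ j
    eval-sum terms    i j ρ = refl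
    eval-sum standard i j ρ = +-cong (trans (*-cong (×-homo-1 1#) (power-unit ρ i)) (*-identityˡ _)) (1*x+0 (power-unit ρ j))

    eval-prod : ∀ κ {n} c i j (ρ : Vec Carrier n) → eval κ (prodₚ κ c i j) ρ ≈ fromℤ c * (lookup ρ i * lookup ρ j)
    eval-prod terms    c i j ρ = refl
    eval-prod standard c i j ρ = trans (+-identityʳ _) (*-congˡ (trans (power-+ ρ _ _) (*-cong (power-unit ρ i) (power-unit ρ j))))

    rel⁺ : ∀ κ {n} r (p q : Poly κ n) {ρ} → Holds (rel κ r p q) ρ → eval κ p ρ ≤[ r ] eval κ q ρ
    rel⁺ κ lt p q h = h
    rel⁺ κ le p q h = h

    rel⁻ : ∀ κ {n} r (p q : Poly κ n) {ρ} → eval κ p ρ ≤[ r ] eval κ q ρ → Holds (rel κ r p q) ρ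
    rel⁻ κ lt p q h = h
    rel⁻ κ le p q h = h

    fails⁺ : ∀ κ {n} r (p q : Poly κ n) {ρ x y} → eval κ p ρ ≈ x → eval κ q ρ ≈ y →
             ¬ Holds (rel κ r p q) ρ → y ≤[ dual r ] x
    fails⁺ κ r p q ex ey h = ≤[]-resp (dual r) ey ex (¬≤[]⇒ r (h ∘ rel⁻ κ r p q))

    fails⁻ : ∀ κ {n} r (p q : Poly κ n) {ρ x y} → eval κ p ρ ≈ x → eval κ q ρ ≈ y →
             y ≤[ dual r ] x → ¬ Holds (rel κ r p q) ρ
    fails⁻ κ r p q ex ey h k = ≤[]⇒¬ r (≤[]-resp (dual r) (sym ey) (sym ex) h) (rel⁺ κ r p q k)

    holds? : ∀ {κ n} {φ : Formula κ n} → QuantifierFree φ → ∀ ρ → Dec (Holds φ ρ)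
    holds? (p ≺ q) ρ = ≤[]-dec lt _ _
    holds? (p ≼ q) ρ = ≤[]-dec le _ _
    holds? (f ∧ g) ρ = holds? f ρ ×-dec holds? g ρ
    holds? (f ∨ g) ρ = holds? f ρ ⊎-dec holds? g ρ

    neg⁺ : ∀ {κ n} {φ : Formula κ n} → QuantifierFree φ → ∀ {ρ} → Holds (neg φ) ρ → ¬ Holds φ ρ
    neg⁺ (p ≺ q) h              = ≤[]⇒¬ lt h
    neg⁺ (p ≼ q) h              = ≤[]⇒¬ le h
    neg⁺ (f ∧ g) (inj₁ h) (k , _) = neg⁺ f h k
    neg⁺ (f ∧ g) (inj₂ h) (_ , k) = neg⁺ g h k
    neg⁺ (f ∨ g) (h , _) (inj₁ k) = neg⁺ f h k
    neg⁺ (f ∨ g) (_ , h) (inj₂ k) = neg⁺ g h k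

    neg⁻ : ∀ {κ n} {φ : Formula κ n} → QuantifierFree φ → ∀ {ρ} → ¬ Holds φ ρ → Holds (neg φ) ρ
    neg⁻ (p ≺ q) h = ¬≤[]⇒ lt h
    neg⁻ (p ≼ q) h = ¬≤[]⇒ le h
    neg⁻ (f ∨ g) h = neg⁻ f (h ∘ inj₁) , neg⁻ g (h ∘ inj₂)
    neg⁻ (f ∧ g) {ρ} h with holds? f ρ
    ... | yes k = inj₂ (neg⁻ g (λ l → h (k , l)))
    ... | no ¬k = inj₁ (neg⁻ f ¬k)

    Bounded : ∀ {n} → Vec Carrier n → Set
    Bounded ρ = ∀ x → ∣ lookup ρ x ∣≲ 1#

    2^ : ℕ → Carrier
    2^ ℓ = (2 ℕ.^ ℓ) · 1#

    2^-mono : ∀ {k ℓ} → k ℕ.≤ ℓ → 2^ k ≤ 2^ ℓ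
    2^-mono h = ·-mono (ℕ.^-monoʳ-≤ 2 h)

    con-bound : ∀ c → ∣ fromℤ c ∣≲ (ℤ.∣ c ∣ · 1#)
    con-bound (+ n)    = ≲-self (·-nonNegative n)
    con-bound -[1+ n ] = ≲-neg (≲-self (·-nonNegative (suc n)))

    -- Lengths add up under both operations. This bounds a product directly, and for a sum the
    -- letter of the operation pays for the factor 2. Hence a scale exponential in the length
    -- suffices although degrees may be large.
    term-bound : ∀ {n} (t : Term n) {ρ} → Bounded ρ → ∣ evalTerm t ρ ∣≲ 2^ (length (encodeTerm t))
    term-bound (con c) B = ≲-weaken (·-mono (ℕ.≤-trans (∣c∣≤2^length c) (2^-≤-suc (length (binary c))))) (con-bound c)
    term-bound (var x) B = ≲-weaken (≤-trans (≤-reflexive (sym (×-homo-1 1#))) (2^-mono {0} {length (encodeTerm (var x))} z≤n)) (B x)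
    term-bound (s ⊕ t) B rewrite length-++ (encodeTerm s) {encodeTerm t} =
      ≲-weaken (≤-trans (+-mono-≤ (2^-mono (ℕ.m≤m+n ∣s∣ ∣t∣)) (2^-mono (ℕ.m≤n+m ∣t∣ ∣s∣)))
                        (≤-reflexive (trans (sym (·-+ (2 ℕ.^ (∣s∣ ℕ.+ ∣t∣)) _))
                            (reflexive (≡.cong (λ k → (2 ℕ.^ (∣s∣ ℕ.+ ∣t∣) ℕ.+ k) · 1#) (≡.sym (ℕ.+-identityʳ _)))))))
               (≲-+ (term-bound s B) (term-bound t B))
      where
      ∣s∣ ∣t∣ : ℕ
      ∣s∣ = length (encodeTerm s)
      ∣t∣ = length (encodeTerm t)
    term-bound (s ⊗ t) B rewrite length-++ (encodeTerm s) {encodeTerm t} =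
      ≲-weaken (≤-trans (≤-reflexive (sym (trans (reflexive (≡.cong (_· 1#) (ℕ.^-distribˡ-+-* 2 ∣s∣ ∣t∣))) (·-* (2 ℕ.^ ∣s∣) _))))
                        (2^-mono (ℕ.n≤1+n (∣s∣ ℕ.+ ∣t∣))))
               (≲-* (term-bound s B) (term-bound t B))
      where
      ∣s∣ ∣t∣ : ℕ
      ∣s∣ = length (encodeTerm s)
      ∣t∣ = length (encodeTerm t)

    -- The error is `a f + e b + e f`. The last product is estimated by `ε * 1#`, so that the whole
    -- bound is linear in `ε`.
    near-* : ∀ r {a b A B e f ε δ} → ∣ a ∣≲ A → ∣ b ∣≲ B → ∣ e ∣≲ ε → ∣ f ∣≲ ε → ε ≤ 1# →
             ((A + B) + 1#) * ε ≤[ r ] δ →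
             (a * b - δ ≤[ r ] (a + e) * (b + f)) × ((a + e) * (b + f) ≤[ r ] a * b + δ)
    near-* r {a} {b} {A} {B} {e} {f} {ε} {δ} ha hb he hf ε≤1 Cε≤δ =
        ≤[]-≤-trans r (≤[]-from r Cε≤δ (solve 3 (λ z c d → d :- c := (z :- c) :- (z :- d)) refl (a * b) C δ))
          (≤[]-from le (proj₁ small) (solve 5 (λ a b e f c → (((a :* f) :+ (e :* b)) :+ (e :* f)) :- (:- c) :=
              ((a :+ e) :* (b :+ f)) :- (a :* b :- c)) refl a b e f C))
      , ≤-≤[]-trans r
          (≤[]-from le (proj₂ small) (solve 5 (λ a b e f c → c :- (((a :* f) :+ (e :* b)) :+ (e :* f)) := (a :* b :+ c) :-
              ((a :+ e) :* (b :+ f))) refl a b e f C))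
          (≤[]-from r Cε≤δ (solve 3 (λ z c d → d :- c := (z :+ d) :- (z :+ c)) refl (a * b) C δ))
      where
      C : Carrier
      C = ((A + B) + 1#) * ε
      small : ∣ (a * f + e * b) + e * f ∣≲ C
      small = ≲-resp refl (trans (solve 4 (λ A B ε o → ((A :* ε) :+ (ε :* B)) :+ ε :* o := ((A :+ B) :+ o) :* ε) refl A B ε 1#) refl)
        (≲-+ (≲-+ (≲-* ha hf) (≲-* he hb)) (≲-* he (≲-weaken ε≤1 hf)))

  module Correctness (ℝ : RealNumbers) (κ : Notation) {n v} (slot : ℕ → Fin v) (ι : Fin n → Fin v)
                     (M N : ℕ) (1≤M : 1 ℕ.≤ M) (M-large : ∀ {ℓ} → 1 ℕ.≤ ℓ → suc ℓ ℕ.≤ N → suc (2 ℕ.^ ℓ) ℕ.≤ M) where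
    open OrderedField ℝ
    open Semantics ℝ
    open Evaluation ℝ
    open Translation κ slot ι (+ M)

    private
      Mᴿ : Carrier
      Mᴿ = fromℤ (+ M)

      0<M : 0# < Mᴿ
      0<M = ·-pos 1≤M

      μ : Carrier
      μ = proj₁ (pos-inverse 0<M)

      Mμ≈1 : Mᴿ * μ ≈ 1#
      Mμ≈1 = proj₁ (proj₂ (pos-inverse 0<M))

      0<μ : 0# < μ
      0<μ = proj₂ (proj₂ (pos-inverse 0<M))

      M*μ* : ∀ x → Mᴿ * (μ * x) ≈ x
      M*μ* x = trans (sym (*-assoc _ _ _)) (trans (*-congʳ Mμ≈1) (*-identityˡ x))

      left-child : ∀ i e → end i (2 ℕ.+ e) ≡ end (suc i) e
      left-child i e = ≡.cong slot (≡.trans (≡.cong (i ℕ.+_) (≡.trans (ℕ.+-suc i (suc e)) (≡.cong suc (ℕ.+-suc i e))))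
          (ℕ.+-suc i (suc (i ℕ.+ e))))

    Extends : Vec Carrier v → Vec Carrier n → Set
    Extends ρ′ ρ = ∀ x → lookup ρ′ (ι x) ≡ lookup ρ x

    lo hi : Vec Carrier v → ℕ → Carrier
    lo ρ′ i = lookup ρ′ (end i 0)
    hi ρ′ i = lookup ρ′ (end i 1)

    -- For `r = le` an open interval, for `r = lt` a closed one, which may shrink to a point.
    Box : Comparison → Vec Carrier v → ℕ → Carrier → Set
    Box r ρ′ i x = (Mᴿ * lo ρ′ i ≤[ dual r ] x) × (x ≤[ dual r ] Mᴿ * hi ρ′ i)

    module _ {ρ′ : Vec Carrier v} {ρ : Vec Carrier n} (ext : Extends ρ′ ρ) where

      leaf-sound : ∀ r p i {x} → eval κ p ρ′ ≈ x → ¬ Holds (leaf r p i) ρ′ → Box r ρ′ i x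
      leaf-sound r p i eq h = fails⁺ κ r p _ eq (eval-scaled κ _ _ ρ′) (h ∘ inj₁)
                            , fails⁺ κ r _ p (eval-scaled κ _ _ ρ′) eq (h ∘ inj₂)

      glue-add-sound : ∀ r i j {x y} → Box r ρ′ (suc i) x → Box r ρ′ j y → ¬ Holds (glue r add i j) ρ′ → Box r ρ′ i (x + y)
      glue-add-sound r i j (l , h) (l′ , h′) f =
          ≤[]-≤-trans (dual r)
            (≤[]-resp (dual r) refl (distribˡ _ _ _)
              (*-monoˡ-≤[] (dual r) 0<M (fails⁺ κ r _ _
                  (trans (eval-sum κ _ _ ρ′) (+-congʳ (reflexive (≡.cong (lookup ρ′) (left-child i 0))))) (eval-var κ _ ρ′) (f ∘ inj₁))))
            (+-mono-≤ (≤[]⇒≤ (dual r) l) (≤[]⇒≤ (dual r) l′))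
        , ≤-≤[]-trans (dual r) (+-mono-≤ (≤[]⇒≤ (dual r) h) (≤[]⇒≤ (dual r) h′))
            (≤[]-resp (dual r) (distribˡ _ _ _) refl
              (*-monoˡ-≤[] (dual r) 0<M (fails⁺ κ r _ _ (eval-var κ _ ρ′)
                  (trans (eval-sum κ _ _ ρ′) (+-congʳ (reflexive (≡.cong (lookup ρ′) (left-child i 1))))) (f ∘ inj₂))))

      corner-sound : ∀ r i x y → ¬ Holds (corner r i x y) ρ′ → Box r ρ′ i ((Mᴿ * lookup ρ′ x) * (Mᴿ * lookup ρ′ y))
      corner-sound r i x y f =
          ≤[]-resp (dual r) refl M*prod (*-monoˡ-≤[] (dual r) 0<M (fails⁺ κ r _ _ (eval-prod κ _ x y ρ′) (eval-var κ _ ρ′) (f ∘ inj₁)))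
        , ≤[]-resp (dual r) M*prod refl (*-monoˡ-≤[] (dual r) 0<M (fails⁺ κ r _ _ (eval-var κ _ ρ′) (eval-prod κ _ x y ρ′) (f ∘ inj₂)))
        where
        M*prod : Mᴿ * (Mᴿ * (lookup ρ′ x * lookup ρ′ y)) ≈ (Mᴿ * lookup ρ′ x) * (Mᴿ * lookup ρ′ y)
        M*prod = solve 3 (λ m x y → m :* (m :* (x :* y)) := (m :* x) :* (m :* y)) refl Mᴿ (lookup ρ′ x) (lookup ρ′ y)

      -- The failing disjuncts put the four products of end points into the box of `i`. A box is
      -- convex, so it contains the product of any two enclosed values.
      glue-mul-sound : ∀ r i j {x y} → Box r ρ′ (suc i) x → Box r ρ′ j y → ¬ Holds (glue r mul i j) ρ′ → Box r ρ′ i (x * y)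
      glue-mul-sound r i j (l , h) (l′ , h′) f rewrite left-child i 0 | left-child i 1 =
        convex-corners {Box r ρ′ i}
          (λ (a , _) (_ , b) u≤x x≤v → ≤[]-≤-trans (dual r) a u≤x , ≤-≤[]-trans (dual r) x≤v b)
          (λ e (a , b) → ≤[]-resp (dual r) refl e a , ≤[]-resp (dual r) e refl b)
          (corner-sound r i _ _ (f ∘ inj₁ ∘ inj₁)) (corner-sound r i _ _ (f ∘ inj₁ ∘ inj₂))
          (corner-sound r i _ _ (f ∘ inj₂ ∘ inj₁)) (corner-sound r i _ _ (f ∘ inj₂ ∘ inj₂))
          (≤[]⇒≤ (dual r) l) (≤[]⇒≤ (dual r) h) (≤[]⇒≤ (dual r) l′) (≤[]⇒≤ (dual r) h′)

      -- A false disjunction refutes all its disjuncts at once, so enclosures spread from the leaves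
      -- to the root, for arbitrary values of the new variables.
      term-sound : ∀ r t i → ¬ Holds (translateTerm r t i) ρ′ → Box r ρ′ i (evalTerm t ρ)
      term-sound r (con c) i f = leaf-sound r _ i (eval-con κ c ρ′) f
      term-sound r (var x) i f = leaf-sound r _ i (trans (eval-var κ (ι x) ρ′) (reflexive (ext x))) f
      term-sound r (s ⊕ t) i f = glue-add-sound r i (suc i ℕ.+ termNodes s) (term-sound r s _ (f ∘ inj₁))
          (term-sound r t _ (f ∘ inj₂ ∘ inj₂)) (f ∘ inj₂ ∘ inj₁)
      term-sound r (s ⊗ t) i f = glue-mul-sound r i (suc i ℕ.+ termNodes s) (term-sound r s _ (f ∘ inj₁))
          (term-sound r t _ (f ∘ inj₂ ∘ inj₂)) (f ∘ inj₂ ∘ inj₁)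

      -- With `hi` of the box of `q` and `lo` of the box of `p` one has
      -- `q ≤ M hi ≤[ dual r ] M lo ≤ p`; the middle step is the failed comparison and carries the
      -- strictness.
      atom-sound : ∀ r p q i → ¬ Holds (translateNode r cmp p q i) ρ′ → ¬ evalTerm p ρ ≤[ r ] evalTerm q ρ
      atom-sound r p q i f = ≤[]⇒¬ r
        (≤-≤[]-trans (dual r) (≤[]⇒≤ (dual r) (proj₂ (term-sound r q _ (f ∘ inj₂ ∘ inj₂))))
          (≤[]-≤-trans (dual r)
            (*-monoˡ-≤[] (dual r) 0<M (fails⁺ κ r _ _ (trans (eval-var κ _ ρ′) (reflexive (≡.cong (lookup ρ′) (left-child i 0))))
                (eval-var κ _ ρ′) (f ∘ inj₂ ∘ inj₁)))
            (≤[]⇒≤ (dual r) (proj₁ (term-sound r p _ (f ∘ inj₁))))))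

      translateNode-quantifierFree : ∀ r p q i → QuantifierFree (translateNode r cmp p q i)
      translateNode-quantifierFree le p q i = QFF≤⇒quantifierFree (translateNode-QFF≤ cmp p q i)
      translateNode-quantifierFree lt p q i =
        ≡.subst QuantifierFree (neg-involutive _) (neg-quantifierFree (QFF≤⇒quantifierFree (neg-translateNode-QFF≤ cmp p q i)))

      -- Which disjunct is true depends on the new variables; decidability of the order turns the
      -- indirect argument into a disjunction.
      atom-holds : ∀ r p q i → evalTerm p ρ ≤[ r ] evalTerm q ρ → Holds (translateNode r cmp p q i) ρ′
      atom-holds r p q i h with holds? (translateNode-quantifierFree r p q i) ρ′
      ... | yes k = k
      ... | no ¬k = contradiction h (atom-sound r p q i ¬k)

      sound : ∀ {φ} → QuantifierFree φ → ∀ i → Holds φ ρ → Holds (translate φ i) ρ′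
      sound (p ≺ q) i h        = atom-holds lt p q i h
      sound (p ≼ q) i h        = atom-holds le p q i h
      sound (f ∧ g) i (h , k)  = sound f i h , sound g _ k
      sound (f ∨ g) i (inj₁ h) = inj₁ (sound f i h)
      sound (f ∨ g) i (inj₂ h) = inj₂ (sound g _ h)

    Agrees : Vec Carrier v → ℕ → List (Carrier × Carrier) → Set
    Agrees ρ′ i []             = ⊤
    Agrees ρ′ i ((l , h) ∷ xs) = (lo ρ′ i ≡ l × hi ρ′ i ≡ h) × Agrees ρ′ (suc i) xs

    Agrees-++ : ∀ {ρ′} i xs {ys k} → length xs ≡ k → Agrees ρ′ i (xs ++ ys) → Agrees ρ′ i xs × Agrees ρ′ (i ℕ.+ k) ys
    Agrees-++ {ρ′} i []       {ys} ≡.refl a       = tt , ≡.subst (λ j → Agrees ρ′ j ys) (≡.sym (ℕ.+-identityʳ i)) a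
    Agrees-++ {ρ′} i (x ∷ xs) {ys} ≡.refl (p , a) with Agrees-++ (suc i) xs {ys} ≡.refl a
    ... | b , c = (p , b) , ≡.subst (λ j → Agrees ρ′ j ys) (≡.sym (ℕ.+-suc i (length xs))) c

    InRange : Carrier × Carrier → Set
    InRange (l , h) = ∣ l ∣≲ 1# × ∣ h ∣≲ 1#

    box : Carrier → Carrier → Carrier × Carrier
    box x δ = μ * (x - δ) , μ * (x + δ)

    -- A value of at most `2^ ℓ` and a radius of at most 1 stay below `M`. This is the purpose of
    -- `M-large` and of radii bounded by 1.
    box-inRange : ∀ {x δ} ℓ → 1 ℕ.≤ ℓ → suc ℓ ℕ.≤ N → ∣ x ∣≲ 2^ ℓ → 0# ≤ δ → δ ≤ 1# → InRange (box x δ)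
    box-inRange {x} {δ} ℓ 1≤ℓ ℓ<N hx 0≤δ δ≤1 = scale (≲-+ hx (≲-neg hδ)) , scale (≲-+ hx hδ)
      where
      hδ : ∣ δ ∣≲ 1#
      hδ = ≲-weaken δ≤1 (≲-self 0≤δ)
      scale : ∀ {y} → ∣ y ∣≲ 2^ ℓ + 1# → ∣ μ * y ∣≲ 1#
      scale hy = ≲-resp refl (trans (*-comm μ Mᴿ) Mμ≈1) (≲-* (≲-self (proj₁ 0<μ))
        (≲-weaken (≤-trans (≤-reflexive (+-comm _ _)) (·-mono (M-large 1≤ℓ ℓ<N))) hy))

    module _ (ρ : Vec Carrier n) where

      -- The radius `δ` at the root is imposed by the parent; only the boxes `xs` of the proper
      -- subterms, in preorder, are chosen. Their range is claimed for bounded `ρ` only, because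
      -- `Σ₂≤` bounds no variable.
      TermBoxes : Comparison → Term n → Carrier → Set
      TermBoxes r t δ = ∃ λ xs → ℕ.suc (length xs) ≡ termNodes t ×
        (Bounded ρ → suc (length (encodeTerm t)) ℕ.≤ N → All InRange (box (evalTerm t ρ) δ ∷ xs)) ×
        (∀ i ρ′ → Extends ρ′ ρ → Agrees ρ′ i (box (evalTerm t ρ) δ ∷ xs) → ¬ Holds (translateTerm r t i) ρ′)

      leaf-complete : ∀ r p i ρ′ {x δ} → 0# ≤[ dual r ] δ → eval κ p ρ′ ≈ x → Agrees ρ′ i (box x δ ∷ []) → ¬ Holds (leaf r p i) ρ′
      leaf-complete r p i ρ′ {x} {δ} 0≤δ eq ((l≡ , h≡) , _) (inj₁ h) =
        fails⁻ κ r p _ eq (trans (eval-scaled κ _ _ ρ′) (trans (*-congˡ (reflexive l≡)) (M*μ* _)))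
          (≤[]-from (dual r) 0≤δ (solve 2 (λ x d → d :- :con 0ℤ := x :- (x :- d)) refl x δ)) h
      leaf-complete r p i ρ′ {x} {δ} 0≤δ eq ((l≡ , h≡) , _) (inj₂ h) =
        fails⁻ κ r _ p (trans (eval-scaled κ _ _ ρ′) (trans (*-congˡ (reflexive h≡)) (M*μ* _))) eq
          (≤[]-from (dual r) 0≤δ (solve 2 (λ x d → d :- :con 0ℤ := (x :+ d) :- x) refl x δ)) h

      GlueRefuted : Comparison → Kind → Carrier → Carrier → Carrier → Carrier → Carrier → Set
      GlueRefuted r o a b x ε δ = ∀ i j ρ′ →
        lo ρ′ i ≡ μ * (x - δ) → hi ρ′ i ≡ μ * (x + δ) →
        lo ρ′ (suc i) ≡ μ * (a - ε) → hi ρ′ (suc i) ≡ μ * (a + ε) →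
        lo ρ′ j ≡ μ * (b - ε) → hi ρ′ j ≡ μ * (b + ε) → ¬ Holds (glue r o i j) ρ′

      add-refuted : ∀ r a b {ε δ} → (1# + 1#) * ε ≤[ dual r ] δ → GlueRefuted r add a b (a + b) ε δ
      add-refuted r a b {ε} {δ} h i j ρ′ li hi′ la ha lb hb (inj₁ k) =
        fails⁻ κ r _ _ (trans (eval-sum κ _ _ ρ′)
            (trans (+-cong (reflexive (≡.trans (≡.cong (lookup ρ′) (left-child i 0)) la)) (reflexive lb)) (sym (distribˡ _ _ _))))
          (trans (eval-var κ _ ρ′) (reflexive li))
          (*-monoˡ-≤[] (dual r) 0<μ (≤[]-from (dual r) h
              (trans (solve 5 (λ a b e d o → d :- (o :+ o) :* e := ((a :- o :* e) :+ (b :- o :* e)) :- ((a :+ b) :- d)) refl a b ε δ 1#)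
             (+-congʳ (+-cong (+-congˡ (-‿cong (*-identityˡ ε))) (+-congˡ (-‿cong (*-identityˡ ε)))))))) k
      add-refuted r a b {ε} {δ} h i j ρ′ li hi′ la ha lb hb (inj₂ k) =
        fails⁻ κ r _ _ (trans (eval-var κ _ ρ′) (reflexive hi′))
          (trans (eval-sum κ _ _ ρ′) (trans (+-cong (reflexive (≡.trans (≡.cong (lookup ρ′) (left-child i 1)) ha)) (reflexive hb))
              (sym (distribˡ _ _ _))))
          (*-monoˡ-≤[] (dual r) 0<μ (≤[]-from (dual r) h
              (trans (solve 5 (λ a b e d o → d :- (o :+ o) :* e := ((a :+ b) :+ d) :- ((a :+ o :* e) :+ (b :+ o :* e))) refl a b ε δ 1#)
             (+-congˡ (-‿cong (+-cong (+-congˡ (*-identityˡ ε)) (+-congˡ (*-identityˡ ε)))))))) k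

      -- Every end point is the value changed by `ε` or `- ε`, both of absolute value at most `ε`,
      -- so `near-*` serves all four corners.
      mul-refuted : ∀ r a b {A B ε δ} → ∣ a ∣≲ A → ∣ b ∣≲ B → 0# ≤[ dual r ] ε → ε ≤ 1# → ((A + B) + 1#) * ε ≤[ dual r ] δ →
                    GlueRefuted r mul a b (a * b) ε δ
      mul-refuted r a b {ε = ε} {δ} hA hB 0≤ε ε≤1 h i j ρ′ li hi′ la ha lb hb =
        λ { (inj₁ (inj₁ k)) → corner-refuted (end i 2) (end j 0) la′ lb -ε -ε k
          ; (inj₁ (inj₂ k)) → corner-refuted (end i 2) (end j 1) la′ hb -ε +ε k
          ; (inj₂ (inj₁ k)) → corner-refuted (end i 3) (end j 0) ha′ lb +ε -ε k
          ; (inj₂ (inj₂ k)) → corner-refuted (end i 3) (end j 1) ha′ hb +ε +ε k }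
        where
        la′ = ≡.trans (≡.cong (lookup ρ′) (left-child i 0)) la
        ha′ = ≡.trans (≡.cong (lookup ρ′) (left-child i 1)) ha
        +ε : ∣ ε ∣≲ ε
        +ε = ≲-self (≤[]⇒≤ (dual r) 0≤ε)
        -ε : ∣ - ε ∣≲ ε
        -ε = ≲-neg +ε
        corner-refuted : ∀ x y {e f} → lookup ρ′ x ≡ μ * (a + e) → lookup ρ′ y ≡ μ * (b + f) → ∣ e ∣≲ ε → ∣ f ∣≲ ε →
                         ¬ Holds (corner r i x y) ρ′
        corner-refuted x y {e} {f} ex ey he hf = λ
          { (inj₁ k) → fails⁻ κ r _ _ value (trans (eval-var κ _ ρ′) (reflexive li)) (*-monoˡ-≤[] (dual r) 0<μ (proj₁ near)) k
          ; (inj₂ k) → fails⁻ κ r _ _ (trans (eval-var κ _ ρ′) (reflexive hi′)) value (*-monoˡ-≤[] (dual r) 0<μ (proj₂ near)) k }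
          where
          near : (a * b - δ ≤[ dual r ] (a + e) * (b + f)) × ((a + e) * (b + f) ≤[ dual r ] a * b + δ)
          near = near-* (dual r) hA hB he hf ε≤1 h
          value : eval κ (prodₚ κ (+ M) x y) ρ′ ≈ μ * ((a + e) * (b + f))
          value = trans (eval-prod κ _ x y ρ′) (trans (*-congˡ (*-cong (reflexive ex) (reflexive ey)))
            (trans (solve 4 (λ m u x y → m :* ((u :* x) :* (u :* y)) := m :* (u :* (u :* (x :* y)))) refl Mᴿ μ (a + e) (b + f)) (M*μ* _)))

      NodeBoxes : Comparison → Kind → Term n → Term n → Carrier → Carrier → Set
      NodeBoxes r o s t x δ = ∃ λ xs → length xs ≡ termNodes s ℕ.+ termNodes t ×
        (Bounded ρ → suc (length (encodeTerm s ++ encodeTerm t)) ℕ.≤ N → All InRange xs) ×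
        (∀ i ρ′ → Extends ρ′ ρ → Agrees ρ′ i (box x δ ∷ xs) → ¬ Holds (translateNode r o s t i) ρ′)

      node-complete : ∀ r o s t {x ε δ} → GlueRefuted r o (evalTerm s ρ) (evalTerm t ρ) x ε δ →
        TermBoxes r s ε → TermBoxes r t ε → NodeBoxes r o s t x δ
      node-complete r o s t refuted (xs , lx , rx , fx) (ys , ly , ry , fy) =
          b ∷ xs ++ c ∷ ys
        , ≡.trans (length-++ (b ∷ xs)) (≡.cong₂ ℕ._+_ lx ly)
        , (λ B le → All.++⁺ (rx B (ℕ.≤-trans (s≤s (length-++-≤ˡ (encodeTerm s))) le))
                            (ry B (ℕ.≤-trans (s≤s (length-++-≤ʳ _ {encodeTerm s})) le)))
        , λ i ρ′ ext ((l , h) , agrees) → refute i ρ′ ext l h (Agrees-++ (suc i) (b ∷ xs) lx agrees)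
        where
        b c : Carrier × Carrier
        b = box (evalTerm s ρ) _
        c = box (evalTerm t ρ) _
        refute : ∀ i ρ′ → Extends ρ′ ρ → lo ρ′ i ≡ _ → hi ρ′ i ≡ _ →
                 Agrees ρ′ (suc i) (b ∷ xs) × Agrees ρ′ (suc i ℕ.+ termNodes s) (c ∷ ys) → ¬ Holds (translateNode r o s t i) ρ′
        refute i ρ′ ext l h (agrees-s , agrees-t) (inj₁ k) = fx _ ρ′ ext agrees-s k
        refute i ρ′ ext l h (agrees-s , agrees-t) (inj₂ (inj₂ k)) = fy _ ρ′ ext agrees-t k
        refute i ρ′ ext l h (((l₁ , h₁) , _) , ((l₂ , h₂) , _)) (inj₂ (inj₁ k)) = refuted i _ ρ′ l h l₁ h₁ l₂ h₂ k

      -- Radii are chosen from the root to the leaves: by continuity of the operation, the tolerance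
      -- of a node yields one for its children. It may depend on `ρ`, as the new variables are
      -- chosen after the old ones.
      term-complete : ∀ r t {δ} → 0# ≤[ dual r ] δ → δ ≤ 1# → TermBoxes r t δ

      termNode-complete : ∀ r o s t {x δ} → 0# ≤[ dual r ] δ → δ ≤ 1# →
        (∃ λ ε → 0# ≤[ dual r ] ε × ε ≤ 1# × GlueRefuted r o (evalTerm s ρ) (evalTerm t ρ) x ε δ) →
        (Bounded ρ → ∣ x ∣≲ 2^ (suc (length (encodeTerm s ++ encodeTerm t)))) →
        ∃ λ xs → ℕ.suc (length xs) ≡ ℕ.suc (termNodes s ℕ.+ termNodes t) ×
          (Bounded ρ → suc (suc (length (encodeTerm s ++ encodeTerm t))) ℕ.≤ N → All InRange (box x δ ∷ xs)) ×
          (∀ i ρ′ → Extends ρ′ ρ → Agrees ρ′ i (box x δ ∷ xs) → ¬ Holds (translateNode r o s t i) ρ′)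
      termNode-complete r o s t 0≤δ δ≤1 (ε , 0≤ε , ε≤1 , refuted) bound
        with node-complete r o s t refuted (term-complete r s 0≤ε ε≤1) (term-complete r t 0≤ε ε≤1)
      ... | xs , lx , rx , fx =
          xs , ≡.cong suc lx
        , (λ B le → box-inRange _ (s≤s z≤n) le (bound B) (≤[]⇒≤ (dual r) 0≤δ) δ≤1 ∷ rx B (ℕ.≤-trans (ℕ.n≤1+n _) le))
        , fx

      term-complete r (con c) {δ} 0≤δ δ≤1 =
          [] , ≡.refl
        , (λ B le → box-inRange _ (s≤s z≤n) le (term-bound (con c) {ρ} B) (≤[]⇒≤ (dual r) 0≤δ) δ≤1 ∷ [])
        , λ i ρ′ ext → leaf-complete r _ i ρ′ 0≤δ (eval-con κ c ρ′)
      term-complete r (var x) {δ} 0≤δ δ≤1 =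
          [] , ≡.refl
        , (λ B le → box-inRange _ (s≤s z≤n) le (term-bound (var x) {ρ} B) (≤[]⇒≤ (dual r) 0≤δ) δ≤1 ∷ [])
        , λ i ρ′ ext → leaf-complete r _ i ρ′ 0≤δ (trans (eval-var κ (ι x) ρ′) (reflexive (ext x)))
      term-complete r (s ⊕ t) {δ} 0≤δ δ≤1 = termNode-complete r add s t 0≤δ δ≤1 radius (term-bound (s ⊕ t) {ρ})
        where
        radius : ∃ λ ε → 0# ≤[ dual r ] ε × ε ≤ 1# × GlueRefuted r add (evalTerm s ρ) (evalTerm t ρ) (evalTerm s ρ + evalTerm t ρ) ε δ
        radius with shrink (dual r) (1# + 1#) (≤[]-resp le (+-identityˡ 1#) refl (+-monoˡ-≤ 1# 0≤1)) 0≤δ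
        ... | ε , 0≤ε , ε≤1 , h = ε , 0≤ε , ε≤1 , add-refuted r _ _ h
      term-complete r (s ⊗ t) {δ} 0≤δ δ≤1 =
        termNode-complete r mul s t 0≤δ δ≤1 (radius (≲-exists (evalTerm s ρ)) (≲-exists (evalTerm t ρ))) (term-bound (s ⊗ t) {ρ})
        where
        radius : (∃ λ A → 0# ≤ A × ∣ evalTerm s ρ ∣≲ A) → (∃ λ B → 0# ≤ B × ∣ evalTerm t ρ ∣≲ B) →
                 ∃ λ ε → 0# ≤[ dual r ] ε × ε ≤ 1# × GlueRefuted r mul (evalTerm s ρ) (evalTerm t ρ) (evalTerm s ρ * evalTerm t ρ) ε δ
        radius (A , 0≤A , hA) (B , 0≤B , hB)
          with shrink (dual r) ((A + B) + 1#) (≤[]-resp le (+-identityˡ 1#) refl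
              (+-monoˡ-≤ 1# (≤[]-resp le (+-identityˡ 0#) refl (+-mono-≤ 0≤A 0≤B)))) 0≤δ
        ... | ε , 0≤ε , ε≤1 , h = ε , 0≤ε , ε≤1 , mul-refuted r _ _ hA hB 0≤ε ε≤1 h

      Boxes : Formula terms n → Set
      Boxes φ = ∃ λ xs → length xs ≡ nodes φ ×
        (Bounded ρ → length (encode φ) ℕ.≤ N → All InRange xs) ×
        (∀ i ρ′ → Extends ρ′ ρ → Agrees ρ′ i xs → ¬ Holds (translate φ i) ρ′)

      AtomBoxes : Comparison → Term n → Term n → Set
      AtomBoxes r p q = ∃ λ xs → length xs ≡ ℕ.suc (termNodes p ℕ.+ termNodes q) ×
        (Bounded ρ → suc (length (encodeTerm p ++ encodeTerm q)) ℕ.≤ N → All InRange xs) ×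
        (∀ i ρ′ → Extends ρ′ ρ → Agrees ρ′ i xs → ¬ Holds (translateNode r cmp p q i) ρ′)

      -- If `ε` is at most half the gap, then `b + ε` does not pass `a - ε`.
      cmp-refuted : ∀ r a b {ε} → (1# + 1#) * ε ≤[ dual r ] a - b → GlueRefuted r cmp a b 0# ε 0#
      cmp-refuted r a b {ε} h i j ρ′ _ _ la ha lb hb =
        fails⁻ κ r _ _ (trans (eval-var κ _ ρ′) (reflexive (≡.trans (≡.cong (lookup ρ′) (left-child i 0)) la)))
          (trans (eval-var κ _ ρ′) (reflexive hb))
          (*-monoˡ-≤[] (dual r) 0<μ (≤[]-from (dual r) h
            (trans (solve 4 (λ a b e o → (a :- b) :- (o :+ o) :* e := (a :- o :* e) :- (b :+ o :* e)) refl a b ε 1#)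
                   (+-cong (+-congˡ (-‿cong (*-identityˡ ε))) (-‿cong (+-congˡ (*-identityˡ ε)))))))

      -- The box of the comparison itself is not used by its glue.
      atom-complete : ∀ r p q → ¬ evalTerm p ρ ≤[ r ] evalTerm q ρ → AtomBoxes r p q
      atom-complete r p q f = choose (shrink (dual r) (1# + 1#) (≤[]-resp le (+-identityˡ 1#) refl (+-monoˡ-≤ 1# 0≤1)) gap)
        where
        x y : Carrier
        x = evalTerm p ρ
        y = evalTerm q ρ
        gap : 0# ≤[ dual r ] x - y
        gap = ≤[]-from (dual r) (¬≤[]⇒ r f) (solve 2 (λ x y → x :- y := (x :- y) :- :con 0ℤ) refl x y)
        ∣0∣≲1 : ∀ {z} → z ≈ 0# → ∣ z ∣≲ 1#
        ∣0∣≲1 e = ≲-resp (sym e) refl (≲-weaken 0≤1 (≲-self ≤-refl))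
        zero-box : InRange (box 0# 0#)
        zero-box = ∣0∣≲1 (trans (*-congˡ (-‿inverseʳ 0#)) (zeroʳ μ)) , ∣0∣≲1 (trans (*-congˡ (+-identityˡ 0#)) (zeroʳ μ))
        choose : (∃ λ ε → 0# ≤[ dual r ] ε × ε ≤ 1# × (1# + 1#) * ε ≤[ dual r ] x - y) → AtomBoxes r p q
        choose (ε , 0≤ε , ε≤1 , h) =
          finish (node-complete r cmp p q (cmp-refuted r x y h) (term-complete r p 0≤ε ε≤1) (term-complete r q 0≤ε ε≤1))
          where
          finish : NodeBoxes r cmp p q 0# 0# → AtomBoxes r p q
          finish (xs , lx , rx , fx) = box 0# 0# ∷ xs , ≡.cong suc lx , (λ B le → zero-box ∷ rx B le) , fx

      -- A false conjunction is refuted through one conjunct. The nodes of the other one still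
      -- occupy numbers, and their slots get zeros, which lie in `I`.
      padding : ℕ → List (Carrier × Carrier)
      padding k = List.replicate k (0# , 0#)

      padding-inRange : ∀ k → All InRange (padding k)
      padding-inRange k = All.replicate⁺ k (∣0∣≲1 , ∣0∣≲1)
        where
        ∣0∣≲1 : ∣ 0# ∣≲ 1#
        ∣0∣≲1 = ≲-weaken 0≤1 (≲-self ≤-refl)

      -- For a disjunction one choice of the new variables has to refute both sides. Concatenation
      -- provides it, since the two sides use disjoint ranges of nodes.
      complete : ∀ {φ} → QuantifierFree φ → ¬ Holds φ ρ → Boxes φ
      complete (p ≺ q) f = atom-complete lt p q f
      complete (p ≼ q) f = atom-complete le p q f
      complete (_∨_ {φ} {ψ} F G) f with complete F (f ∘ inj₁) | complete G (f ∘ inj₂)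
      ... | xs , lx , rx , fx | ys , ly , ry , fy =
          xs ++ ys , ≡.trans (length-++ xs) (≡.cong₂ ℕ._+_ lx ly)
        , (λ B le → All.++⁺ (rx B (ℕ.≤-trans (ℕ.m≤n⇒m≤1+n (length-++-≤ˡ (encode φ))) le))
            (ry B (ℕ.≤-trans (ℕ.m≤n⇒m≤1+n (length-++-≤ʳ (encode ψ) {encode φ})) le)))
        , λ i ρ′ ext agrees → λ { (inj₁ k) → fx i ρ′ ext (proj₁ (Agrees-++ i xs lx agrees)) k
                                ; (inj₂ k) → fy _ ρ′ ext (proj₂ (Agrees-++ i xs lx agrees)) k }
      complete (_∧_ {φ} {ψ} F G) f with holds? F ρ
      ... | no ¬h with complete F ¬h
      ...   | xs , lx , rx , fx =
          xs ++ padding (nodes ψ) , ≡.trans (length-++ xs) (≡.cong₂ ℕ._+_ lx (length-replicate (nodes ψ)))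
        , (λ B le → All.++⁺ (rx B (ℕ.≤-trans (ℕ.m≤n⇒m≤1+n (length-++-≤ˡ (encode φ))) le)) (padding-inRange (nodes ψ)))
        , λ i ρ′ ext agrees (k , _) → fx i ρ′ ext (proj₁ (Agrees-++ i xs lx agrees)) k
      complete (_∧_ {φ} {ψ} F G) f | yes h with complete G (λ k → f (h , k))
      ...   | ys , ly , ry , fy =
          padding (nodes φ) ++ ys , ≡.trans (length-++ (padding (nodes φ))) (≡.cong₂ ℕ._+_ (length-replicate (nodes φ)) ly)
        , (λ B le → All.++⁺ (padding-inRange (nodes φ)) (ry B (ℕ.≤-trans (ℕ.m≤n⇒m≤1+n (length-++-≤ʳ (encode ψ) {encode φ})) le)))
        , λ i ρ′ ext agrees (_ , k) → fy _ ρ′ ext (proj₂ (Agrees-++ i (padding (nodes φ)) (length-replicate (nodes φ)) agrees)) k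

-- Quantifier blocks and the equivalence of the sentences.

module SentenceCorrectness where

  open IntervalTranslation
  open OrderedFields
  open TranslationCorrectness
  open import Data.Bool.Base using (Bool; true; false)
  open import Data.Fin.Base using (Fin; zero; suc; toℕ; _↑ˡ_; _↑ʳ_; splitAt)
  open import Data.Fin.Properties using (splitAt⁻¹-↑ˡ; splitAt⁻¹-↑ʳ)
  open import Data.Integer.Base as ℤ using (+_; 1ℤ)
  open import Data.List.Base as List using (List; []; _∷_; length; map; allFin)
  open import Data.List.Relation.Unary.All as All using (All; []; _∷_)
  import Data.List.Relation.Unary.All.Properties as All
  open import Data.Nat.Base as ℕ using (ℕ; zero; suc; z≤n; s≤s)
  import Data.Nat.Properties as ℕ
  open import Data.Nat.Tactic.RingSolver using (solve-∀)
  open import Data.Product.Base using (∃; _×_; _,_; proj₁; proj₂)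
  open import Data.Sum.Base using (_⊎_; inj₁; inj₂)
  open import Data.Unit.Base using (tt)
  open import Data.Vec.Base as Vec using (Vec; []; _∷_; lookup; _++_)
  open import Data.Vec.Properties using (lookup-++ˡ; lookup-++ʳ; lookup∘tabulate; take++drop≡id)
  open import Function.Base using (_∘_)
  open import Function.Bundles using (_⇔_; mk⇔)
  import Relation.Binary.PropositionalEquality as ≡
  open import Relation.Binary.PropositionalEquality using (_≡_)
  open import Relation.Nullary.Decidable using (Dec; yes; no)
  open import Relation.Nullary.Negation.Core using (contradiction)

  bound-quantifierFree : ∀ {κ n} (is : List (Fin n)) → QuantifierFree (∣_∣≤_ {κ} is 1ℤ)
  bound-quantifierFree []       = _ ≼ _
  bound-quantifierFree (i ∷ is) = ((_ ≼ _) ∧ (_ ≼ _)) ∧ bound-quantifierFree is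

  module Sentences (ℝ : RealNumbers) where
    open OrderedField ℝ
    open Semantics ℝ
    open Evaluation ℝ

    existsBlock⁺ : ∀ {κ} m {φ : Formula κ m} → Holds (existsBlock m φ) [] → ∃ λ xs → Holds φ xs
    existsBlock⁺ zero    h = [] , h
    existsBlock⁺ (suc m) h with existsBlock⁺ m h
    ... | xs , x , k = x ∷ xs , k

    existsBlock⁻ : ∀ {κ} m {φ : Formula κ m} xs → Holds φ xs → Holds (existsBlock m φ) []
    existsBlock⁻ zero    []       h = h
    existsBlock⁻ (suc m) (x ∷ xs) h = existsBlock⁻ m xs (x , h)

    allBlock⁺ : ∀ {κ} n {m} {φ : Formula κ (n ℕ.+ m)} {xs} → Holds (allBlock n φ) xs → ∀ ys → Holds φ (ys ++ xs)
    allBlock⁺ zero    h []       = h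
    allBlock⁺ (suc n) h (y ∷ ys) = allBlock⁺ n h ys y

    allBlock⁻ : ∀ {κ} n {m} {φ : Formula κ (n ℕ.+ m)} {xs} → (∀ ys → Holds φ (ys ++ xs)) → Holds (allBlock n φ) xs
    allBlock⁻ zero    h = h []
    allBlock⁻ (suc n) h = allBlock⁻ n λ ys y → h (y ∷ ys)

    private
      fromℤ-1 : fromℤ 1ℤ ≈ 1#
      fromℤ-1 = +-identityʳ 1#

    bound⁺ : ∀ {κ n} (is : List (Fin n)) {ρ} → Holds (∣_∣≤_ {κ} is 1ℤ) ρ → All (λ i → ∣ lookup ρ i ∣≲ 1#) is
    bound⁺     []       h                      = []
    bound⁺ {κ} (i ∷ is) {ρ} ((h , k) , l) =
        ( ≤[]-resp le (trans (eval-con κ _ ρ) (-‿cong fromℤ-1)) (eval-var κ i ρ) h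
        , ≤[]-resp le (eval-var κ i ρ) (trans (eval-con κ _ ρ) fromℤ-1) k)
      ∷ bound⁺ {κ} is l

    bound⁻ : ∀ {κ n} (is : List (Fin n)) {ρ} → All (λ i → ∣ lookup ρ i ∣≲ 1#) is → Holds (∣_∣≤_ {κ} is 1ℤ) ρ
    bound⁻     []       []            = ≤-refl
    bound⁻ {κ} (i ∷ is) {ρ} ((h , k) ∷ l) =
        ( ≤[]-resp le (sym (trans (eval-con κ _ ρ) (-‿cong fromℤ-1))) (sym (eval-var κ i ρ)) h
        , ≤[]-resp le (sym (eval-var κ i ρ)) (sym (trans (eval-con κ _ ρ) fromℤ-1)) k)
      , bound⁻ {κ} is l

    module _ (κ : Notation) {m n} (ys : Vec Carrier n) (xs : Vec Carrier m) where

      boundʸ⁺ : Holds (∣_∣≤_ {κ} (map (_↑ˡ m) (allFin n)) 1ℤ) (ys ++ xs) → Bounded ys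
      boundʸ⁺ h y = ≡.subst (∣_∣≲ 1#) (lookup-++ˡ ys xs y) (All.tabulate⁻ (All.map⁻ (bound⁺ {κ} _ h)) y)

      boundʸ⁻ : Bounded ys → Holds (∣_∣≤_ {κ} (map (_↑ˡ m) (allFin n)) 1ℤ) (ys ++ xs)
      boundʸ⁻ B = bound⁻ {κ} _ (All.map⁺ (All.tabulate⁺ λ y → ≡.subst (∣_∣≲ 1#) (≡.sym (lookup-++ˡ ys xs y)) (B y)))

      boundˣ⁺ : Holds (∣_∣≤_ {κ} (map (n ↑ʳ_) (allFin m)) 1ℤ) (ys ++ xs) → Bounded xs
      boundˣ⁺ h x = ≡.subst (∣_∣≲ 1#) (lookup-++ʳ ys xs x) (All.tabulate⁻ (All.map⁻ (bound⁺ {κ} _ h)) x)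

      boundˣ⁻ : Bounded xs → Holds (∣_∣≤_ {κ} (map (n ↑ʳ_) (allFin m)) 1ℤ) (ys ++ xs)
      boundˣ⁻ B = bound⁻ {κ} _ (All.map⁺ (All.tabulate⁺ λ x → ≡.subst (∣_∣≲ 1#) (≡.sym (lookup-++ʳ ys xs x)) (B x)))

    Bounded-++ : ∀ {m n} (ys : Vec Carrier n) (xs : Vec Carrier m) → Bounded ys → Bounded xs → Bounded (ys ++ xs)
    Bounded-++ {m} {n} ys xs By Bx i with splitAt n i in eq
    ... | inj₁ y = ≡.subst (∣_∣≲ 1#) (≡.trans (≡.sym (lookup-++ˡ ys xs y)) (≡.cong (lookup (ys ++ xs)) (splitAt⁻¹-↑ˡ eq))) (By y)
    ... | inj₂ x = ≡.subst (∣_∣≲ 1#) (≡.trans (≡.sym (lookup-++ʳ ys xs x)) (≡.cong (lookup (ys ++ xs)) (splitAt⁻¹-↑ʳ eq))) (Bx x)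

    Range : Bool → ∀ {n} → Vec Carrier n → Set
    Range false ys = Data.Unit.Base.⊤
    Range true  ys = Bounded ys

    -- In the abbreviation for bounded quantifiers the bound on `X` lies within the scope of `∀ Y`;
    -- therefore `Range b xs` is obtained only along with some `ys` in range.
    quantify⁺ : ∀ {κ} b m n {Φ : Formula κ (n ℕ.+ m)} → Holds (quantify b m n Φ) [] →
      ∃ λ (xs : Vec Carrier m) → ∀ (ys : Vec Carrier n) → Range b ys → Range b xs × Holds Φ (ys ++ xs)
    quantify⁺ false m n h with existsBlock⁺ m h
    ... | xs , k = xs , λ ys _ → tt , allBlock⁺ n k ys
    quantify⁺ {κ} true m n {Φ} h with existsBlock⁺ m h
    ... | xs , k = xs , λ ys B → extract ys B (allBlock⁺ n k ys)
      where
      extract : ∀ ys → Bounded ys → Holds (∣_∣>_ {κ} (map (_↑ˡ m) (allFin n)) 1ℤ ∨ (∣ map (n ↑ʳ_) (allFin m) ∣≤ 1ℤ ∧ Φ)) (ys ++ xs) →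
                Bounded xs × Holds Φ (ys ++ xs)
      extract ys B (inj₁ h)       = contradiction (boundʸ⁻ κ ys xs B) (neg⁺ (bound-quantifierFree {κ} (map (_↑ˡ m) (allFin n))) h)
      extract ys B (inj₂ (h , k)) = boundˣ⁺ κ ys xs h , k

    quantify⁻ : ∀ {κ} b m n {Φ : Formula κ (n ℕ.+ m)} →
      (∃ λ (xs : Vec Carrier m) → ∀ (ys : Vec Carrier n) → Range b ys → Range b xs × Holds Φ (ys ++ xs)) → Holds (quantify b m n Φ) []
    quantify⁻ false m n (xs , h) = existsBlock⁻ m xs (allBlock⁻ n λ ys → proj₂ (h ys tt))
    quantify⁻ {κ} true m n {Φ} (xs , h) = existsBlock⁻ m xs (allBlock⁻ n matrix)
      where
      matrix : ∀ ys → Holds (∣_∣>_ {κ} (map (_↑ˡ m) (allFin n)) 1ℤ ∨ (∣ map (n ↑ʳ_) (allFin m) ∣≤ 1ℤ ∧ Φ)) (ys ++ xs)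
      matrix ys with holds? (bound-quantifierFree {κ} (map (_↑ˡ m) (allFin n))) (ys ++ xs)
      ... | no ¬B = inj₁ (neg⁻ (bound-quantifierFree {κ} (map (_↑ˡ m) (allFin n))) ¬B)
      ... | yes B with h ys (boundʸ⁺ κ ys xs B)
      ...   | Bx , k = inj₂ (boundˣ⁻ κ ys xs Bx , k)

    module Simplification (κ : Notation) (m n : ℕ) (M N : ℕ) (1≤M : 1 ℕ.≤ M)
                          (M-large : ∀ {ℓ} → 1 ℕ.≤ ℓ → suc ℓ ℕ.≤ N → suc (2 ℕ.^ ℓ) ℕ.≤ M) where

      -- `end i e` with `i ≤ N` and `e ≤ 3` has index at most `2N + 3`, so that `clamp` truncates no
      -- index that occurs. There are `suc k` new variables.
      k : ℕ
      k = 3 ℕ.+ (N ℕ.+ N)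

      open Correctness ℝ κ (λ i → slotᴺ k n i ↑ˡ m) (shift (suc k) n m) M N 1≤M M-large

      extends : ∀ (zs : Vec Carrier (suc k)) (ys : Vec Carrier n) (xs : Vec Carrier m) → Extends ((zs ++ ys) ++ xs) (ys ++ xs)
      extends zs ys xs i with splitAt n i in eq
      ... | inj₁ y = ≡.trans (lookup-++ˡ (zs ++ ys) xs (suc k ↑ʳ y)) (≡.trans (lookup-++ʳ zs ys y)
                       (≡.trans (≡.sym (lookup-++ˡ ys xs y)) (≡.cong (lookup (ys ++ xs)) (splitAt⁻¹-↑ˡ eq))))
      ... | inj₂ x = ≡.trans (lookup-++ʳ (zs ++ ys) xs x)
                       (≡.trans (≡.sym (lookup-++ʳ ys xs x)) (≡.cong (lookup (ys ++ xs)) (splitAt⁻¹-↑ʳ eq)))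

      flat : List (Carrier × Carrier) → ℕ → Carrier
      -- The default must lie in `I`: in the bounded classes the slots beyond the list range over
      -- `I` too.
      flat []             _             = 0#
      flat ((l , h) ∷ bs) zero          = l
      flat ((l , h) ∷ bs) (suc zero)    = h
      flat ((l , h) ∷ bs) (suc (suc i)) = flat bs i

      flat-bounded : ∀ {bs} → All InRange bs → ∀ i → ∣ flat bs i ∣≲ 1#
      flat-bounded []             i             = ≲-weaken 0≤1 (≲-self ≤-refl)
      flat-bounded ((l , h) ∷ bs) zero          = l
      flat-bounded ((l , h) ∷ bs) (suc zero)    = h
      flat-bounded (_ ∷ bs)       (suc (suc i)) = flat-bounded bs i

      witness : List (Carrier × Carrier) → Vec Carrier (suc k)
      witness bs = Vec.tabulate (flat bs ∘ toℕ)

      -- The induction runs through tails of the list while slots are counted from the beginning,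
      -- hence the offset `i` and the separate function `f`.
      agrees : ∀ {ρ′} {f : ℕ → Carrier} → (∀ i → i ℕ.≤ k → lookup ρ′ (slotᴺ k n i ↑ˡ m) ≡ f i) →
               ∀ i bs → i ℕ.+ length bs ℕ.≤ N → (∀ e → f (i ℕ.+ (i ℕ.+ e)) ≡ flat bs e) → Agrees ρ′ i bs
      agrees lk i []       _ _ = tt
      agrees {f = f} lk i (b ∷ bs) i+b≤N h =
          (≡.trans (lk _ (end≤ 0 z≤n)) (h 0) , ≡.trans (lk _ (end≤ 1 (s≤s z≤n))) (h 1))
        , agrees lk (suc i) bs (ℕ.≤-trans (ℕ.≤-reflexive (≡.sym (ℕ.+-suc i (length bs)))) i+b≤N)
            (λ e → ≡.trans (≡.cong f (shift-2 i e)) (h (2 ℕ.+ e)))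
        where
        shift-2 : ∀ i e → suc i ℕ.+ (suc i ℕ.+ e) ≡ i ℕ.+ (i ℕ.+ (2 ℕ.+ e))
        shift-2 = solve-∀
        i<N : suc i ℕ.≤ N
        i<N = ℕ.≤-trans (ℕ.≤-trans (s≤s (ℕ.m≤m+n i (length bs))) (ℕ.≤-reflexive (≡.sym (ℕ.+-suc i (length bs))))) i+b≤N
        end≤ : ∀ e → e ℕ.≤ 1 → i ℕ.+ (i ℕ.+ e) ℕ.≤ k
        end≤ e e≤1 = ℕ.m≤n⇒m≤o+n 3 (ℕ.+-mono-≤ (ℕ.<⇒≤ i<N) (ℕ.≤-trans (ℕ.+-monoʳ-≤ i e≤1) (ℕ.≤-trans (ℕ.≤-reflexive (ℕ.+-comm i 1)) i<N)))

      witness-agrees : ∀ bs ys xs → length bs ℕ.≤ N → Agrees ((witness bs ++ ys) ++ xs) 0 bs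
      witness-agrees bs ys xs b≤N = agrees {f = flat bs} look 0 bs b≤N (λ e → ≡.refl)
        where
        look : ∀ i → i ℕ.≤ k → lookup ((witness bs ++ ys) ++ xs) (slotᴺ k n i ↑ˡ m) ≡ flat bs i
        look i i≤k = ≡.trans (lookup-++ˡ (witness bs ++ ys) xs (slotᴺ k n i)) (≡.trans (lookup-++ˡ (witness bs) ys (clamp i))
          (≡.trans (lookup∘tabulate (flat bs ∘ toℕ) (clamp i)) (≡.cong (flat bs) (toℕ-clamp i≤k))))

      module _ (b : Bool) {Φ : Formula terms (n ℕ.+ m)} (qf : QuantifierFree Φ) (Φ≤N : length (encode Φ) ℕ.≤ N) where

        private
          Φ′ : Formula κ ((suc k ℕ.+ n) ℕ.+ m)
          Φ′ = simplified κ k m n (+ M) Φ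

        forward : ∀ {xs : Vec Carrier m} → (∀ ys → Range b ys → Range b xs × Holds Φ (ys ++ xs)) →
                  ∀ ws → Range b ws → Range b xs × Holds Φ′ (ws ++ xs)
        forward {xs} h ws Bw = ≡.subst (λ ws → Range b ws → Range b xs × Holds Φ′ (ws ++ xs)) (take++drop≡id (suc k) ws) split Bw
          where
          zs : Vec Carrier (suc k)
          zs = Vec.take (suc k) ws
          ys : Vec Carrier n
          ys = Vec.drop (suc k) ws
          range-drop : ∀ b {ys} → Range b (zs ++ ys) → Range b ys
          range-drop false      _ = tt
          range-drop true  {ys} B y = ≡.subst (∣_∣≲ 1#) (lookup-++ʳ zs ys y) (B (suc k ↑ʳ y))
          split : Range b (zs ++ ys) → Range b xs × Holds Φ′ ((zs ++ ys) ++ xs)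
          split B with h ys (range-drop b B)
          ... | Bx , φ = Bx , sound (extends zs ys xs) qf 0 φ

        backward : ∀ {xs : Vec Carrier m} → (∀ ws → Range b ws → Range b xs × Holds Φ′ (ws ++ xs)) →
                   ∀ ys → Range b ys → Range b xs × Holds Φ (ys ++ xs)
        backward {xs} h ys By = Bx , decide (holds? qf (ys ++ xs))
          where
          range-++ : ∀ b {bs} → All InRange bs ⊎ b ≡ false → Range b ys → Range b (witness bs ++ ys)
          range-++ false      _        _  = tt
          range-++ true  {bs} (inj₁ R) By = Bounded-++ (witness bs) ys
              (λ i → ≡.subst (∣_∣≲ 1#) (≡.sym (lookup∘tabulate (flat bs ∘ toℕ) i)) (flat-bounded R (toℕ i))) By
          Bx : Range b xs
          -- The all-zero witness yields the range of `xs`. It has to come first, since the refuting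
          -- boxes are known to be in range only for bounded `xs`.
          Bx = proj₁ (h (witness [] ++ ys) (range-++ b (inj₁ []) By))
          in-range : ∀ b {bs} → (Bounded (ys ++ xs) → length (encode Φ) ℕ.≤ N → All InRange bs) → Range b ys → Range b xs →
              All InRange bs ⊎ b ≡ false
          in-range false _ _  _  = inj₂ ≡.refl
          in-range true  R By Bx = inj₁ (R (Bounded-++ ys xs By Bx) Φ≤N)
          decide : Dec (Holds Φ (ys ++ xs)) → Holds Φ (ys ++ xs)
          decide (yes φ) = φ
          decide (no ¬φ) with complete (ys ++ xs) qf ¬φ
          ... | bs , lb , rb , fb = contradiction (proj₂ (h (witness bs ++ ys) (range-++ b (in-range b rb By Bx) By)))
            (fb 0 _ (extends (witness bs) ys xs) (witness-agrees bs ys xs (ℕ.≤-trans (ℕ.≤-reflexive lb) (ℕ.≤-trans (nodes≤length Φ) Φ≤N))))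

        simplified-⇔ : Holds (quantify b m n Φ) [] ⇔ Holds (quantify b m (suc k ℕ.+ n) Φ′) []
        simplified-⇔ = mk⇔
          (λ h → quantify⁻ b m (suc k ℕ.+ n) (proj₁ (quantify⁺ b m n h) , forward (proj₂ (quantify⁺ b m n h))))
          (λ h → quantify⁻ b m n (proj₁ (quantify⁺ b m (suc k ℕ.+ n) h) , backward (proj₂ (quantify⁺ b m (suc k ℕ.+ n) h))))

open IntervalTranslation
open TranslationCorrectness using (nodes≤length)
open SentenceCorrectness
open import Data.Bool.Base using (Bool; true; false)
open import Data.Fin.Base using (Fin; zero; suc; toℕ; _↑ˡ_; _↑ʳ_)
open import Data.Fin.Patterns
open import Data.Fin.Properties using (_≟_; toℕ<n; toℕ-↑ˡ)
open import Data.Integer.Base as ℤ using (ℤ; 1ℤ; 0ℤ)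
open import Data.List.Base as List using (List; []; _∷_; map; _++_; _ʳ++_; length; replicate; [_]; concatMap; drop; tabulate; allFin)
open import Data.List.Membership.Propositional renaming (_∈_ to _∈ᴸ_)
open import Data.List.Membership.Propositional.Properties using (∈-map⁺; ∈-++⁺ˡ; ∈-++⁺ʳ; ∈-concat⁺′)
open import Data.List.Properties using (ʳ++-ʳ++; length-ʳ++; ++-identityʳ; ++-ʳ++; length-replicate; length-++; length-++-≤ˡ; length-++-≤ʳ; ++-assoc; map-tabulate; tabulate-cong; length-map; length-tabulate)
open import Data.List.Relation.Unary.All as All using (All; []; _∷_)
import Data.List.Relation.Unary.All.Properties as All
open import Data.List.Relation.Unary.Any as Any using (here; there)
open import Data.List.Relation.Unary.Any.Properties using (lookup-index)
open import Data.Maybe.Base using (Maybe; just; nothing)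
open import Data.Nat.Base as ℕ using (ℕ; zero; suc; _+_; _*_; _≤_; s≤s; z≤n; _^_)
open import Data.Nat.Binary.Base as ℕᵇ using (ℕᵇ; 2[1+_]; 1+[2_])
import Data.Nat.Binary.Properties as ℕᵇ
open import Data.Nat.Properties as ℕ using (m≤n+m)
open import Data.Nat.Tactic.RingSolver using (solve-∀)
open import Data.Product.Base using (Σ; ∃; _×_; _,_; proj₁; proj₂)
open import Data.Sum.Base as Sum using (_⊎_; inj₁; inj₂; [_,_]′)
open import Data.Unit.Base using (⊤; tt)
open import Data.Vec.Base as Vec using (Vec; []; _∷_; lookup; _[_]≔_)
open import Data.Vec.Properties using (lookup-map; []≔-lookup; []≔-idempotent; []≔-commutes; lookup∘update; lookup∘update′; zipWith-identityˡ; zipWith-identityʳ)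
open import Function.Base using (_∘_; id)
open import Relation.Binary.PropositionalEquality using (_≡_; refl; sym; trans; cong; cong₂; subst; _≢_; subst₂)
open import Relation.Nullary.Decidable using (False; toWitnessFalse; True; toWitness)

-- Finite state sets, stack programs and their simulation by Turing machines.

record Finite (S : Set) : Set where
  field
    elements : List S
    complete : ∀ s → s ∈ᴸ elements

  code : S → Fin (List.length elements)
  code s = Any.index (complete s)

  decode : Fin (List.length elements) → S
  decode = List.lookup elements

  -- The machine has to recover a state from its number, not conversely, so an element may be listed
  -- several times.
  decode-code : ∀ s → decode (code s) ≡ s
  decode-code s = sym (lookup-index (complete s))

open Finite

instance
  ⊤-finite : Finite ⊤
  ⊤-finite .elements = tt ∷ []
  ⊤-finite .complete tt = here refl

  Bool-finite : Finite Bool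
  Bool-finite .elements = true ∷ false ∷ []
  Bool-finite .complete true = here refl
  Bool-finite .complete false = there (here refl)

  Maybe-finite : ∀ {S} → ⦃ Finite S ⦄ → Finite (Maybe S)
  Maybe-finite ⦃ f ⦄ .elements = nothing ∷ map just (elements f)
  Maybe-finite ⦃ f ⦄ .complete nothing = here refl
  Maybe-finite ⦃ f ⦄ .complete (just s) = there (∈-map⁺ just (complete f s))

⊎-finite : ∀ {S T} → Finite S → Finite T → Finite (S ⊎ T)
⊎-finite f g .elements = map inj₁ (elements f) ++ map inj₂ (elements g)
⊎-finite f g .complete (inj₁ s) = ∈-++⁺ˡ (∈-map⁺ inj₁ (complete f s))
⊎-finite f g .complete (inj₂ t) = ∈-++⁺ʳ _ (∈-map⁺ inj₂ (complete g t))

Σ-finite : ∀ {S} {T : S → Set} → Finite S → (∀ s → Finite (T s)) → Finite (Σ S T)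
Σ-finite f g .elements = List.concat (map (λ s → map (s ,_) (elements (g s))) (elements f))
Σ-finite f g .complete (s , t) =
  ∈-concat⁺′ (∈-map⁺ (s ,_) (complete (g s) t)) (∈-map⁺ _ (complete f s))

instance
  ×-finite : ∀ {S T} → ⦃ Finite S ⦄ → ⦃ Finite T ⦄ → Finite (S × T)
  ×-finite ⦃ f ⦄ ⦃ g ⦄ = Σ-finite f (λ _ → g)

-- Programs over finitely many stacks.  A stack is a tape whose head is on the
-- top of the stack, the rest of the stack being to the right of the head.
module StackPrograms (A : Set) (extra : ℕ) where

  Reg : Set
  Reg = Fin (suc extra)

  Store : Set
  Store = Vec (List A) (suc extra)

  data Instruction (X : Set) : Set where
    skip : X → Instruction X
    push : Reg → A → X → Instruction X
    pop  : Reg → (Maybe A → X) → Instruction X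

  mapᴵ : ∀ {X Y} → (X → Y) → Instruction X → Instruction Y
  mapᴵ f (skip x)     = skip (f x)
  mapᴵ f (push r a x) = push r a (f x)
  mapᴵ f (pop r k)    = pop r (f ∘ k)

  exec : ∀ {X} → Instruction X → Store → X × Store
  exec (skip x)     s = x , s
  exec (push r a x) s = x , s [ r ]≔ (a ∷ lookup s r)
  exec (pop r k)    s = k (List.head (lookup s r)) , s [ r ]≔ List.drop 1 (lookup s r)

  exec-map : ∀ {X Y} (f : X → Y) i {s x s′} → exec i s ≡ (x , s′) → exec (mapᴵ f i) s ≡ (f x , s′)
  exec-map f (skip x)     refl = refl
  exec-map f (push r a x) refl = refl
  exec-map f (pop r k)    refl = refl

  -- A flow chart whose exits are labelled by `X`. Through these labels finite information passes
  -- from one program to the next within the control state, without a register.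
  record Program (X : Set) : Set₁ where
    field
      State   : Set
      finite  : Finite State
      entry   : State
      command : State → Instruction (State ⊎ X)

  open Program

  -- The number bounds the time from above: `exit` leaves an arbitrary remainder.
  data Steps {X} (p : Program X) : State p → Store → ℕ → X → Store → Set where
    exit : ∀ {q s n x s′} → exec (command p q) s ≡ (inj₂ x , s′) →
           Steps p q s (suc n) x s′
    next : ∀ {q s q′ s′ n x s″} → exec (command p q) s ≡ (inj₁ q′ , s′) →
           Steps p q′ s′ n x s″ → Steps p q s (suc n) x s″

  Run : ∀ {X} → Program X → Store → ℕ → X → Store → Set
  Run p = Steps p (entry p)

  Steps-mono : ∀ {X} {p : Program X} {q s m n x s′} → m ≤ n → Steps p q s m x s′ → Steps p q s n x s′
  Steps-mono (s≤s m≤n) (exit eq)   = exit eq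
  Steps-mono (s≤s m≤n) (next eq r) = next eq (Steps-mono m≤n r)

  singleᴾ : ∀ {X} → Instruction X → Program X
  singleᴾ i .State     = ⊤
  singleᴾ i .finite    = ⊤-finite
  singleᴾ i .entry     = tt
  singleᴾ i .command _ = mapᴵ inj₂ i

  run-singleᴾ : ∀ {X} (i : Instruction X) {s} →
               Run (singleᴾ i) s 1 (proj₁ (exec i s)) (proj₂ (exec i s))
  run-singleᴾ i = exit (exec-map inj₂ i refl)

  -- An exit of `p` with result `x` is redirected to the entry of `f x`, which takes no extra step,
  -- so times simply add up. Finiteness of `X` keeps the state set finite.
  bindᴾ : ∀ {X Y} → ⦃ Finite X ⦄ → Program X → (X → Program Y) → Program Y
  bindᴾ p f .State                = State p ⊎ Σ _ (State ∘ f)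
  bindᴾ ⦃ fx ⦄ p f .finite        = ⊎-finite (finite p) (Σ-finite fx (finite ∘ f))
  bindᴾ p f .entry                = inj₁ (entry p)
  bindᴾ p f .command (inj₁ q)     =
    mapᴵ [ inj₁ ∘ inj₁ , (λ x → inj₁ (inj₂ (x , entry (f x)))) ]′ (command p q)
  bindᴾ p f .command (inj₂ (x , q)) = mapᴵ (Sum.map₁ (λ q′ → inj₂ (x , q′))) (command (f x) q)

  run-bindᴾ : ∀ {X Y} ⦃ fx : Finite X ⦄ {p : Program X} {f : X → Program Y} {s m x s′ n y s″} →
             Run p s m x s′ → Run (f x) s′ n y s″ → Run (bindᴾ p f) s (m + n) y s″
  run-bindᴾ {p = p} {f} {x = x} {n = n} {y} {s″} r₁ r₂ = first r₁
    where
    second : ∀ {q s n} → Steps (f x) q s n y s″ → Steps (bindᴾ p f) (inj₂ (x , q)) s n y s″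
    second (exit eq)   = exit (exec-map _ _ eq)
    second (next eq r) = next (exec-map _ _ eq) (second r)
    first : ∀ {q s m} → Steps p q s m x _ → Steps (bindᴾ p f) (inj₁ q) s (m + n) y s″
    first (exit {n = m} eq) = next (exec-map _ _ eq) (Steps-mono (m≤n+m n m) (second r₂))
    first (next eq r)       = next (exec-map _ _ eq) (first r)

  iterᴾ : ∀ {X Y} → ⦃ Finite X ⦄ → (X → Program (X ⊎ Y)) → X → Program Y
  iterᴾ f x .State                   = Σ _ (State ∘ f)
  iterᴾ ⦃ fx ⦄ f x .finite           = Σ-finite fx (finite ∘ f)
  iterᴾ f x .entry                   = x , entry (f x)
  iterᴾ f x .command (x′ , q) =
    mapᴵ [ (λ q′ → inj₁ (x′ , q′)) , Sum.map₁ (λ x″ → x″ , entry (f x″)) ]′ (command (f x′) q)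

  run-doneᴾ : ∀ {X Y} ⦃ fx : Finite X ⦄ {f : X → Program (X ⊎ Y)} {x s n y s′} →
             Run (f x) s n (inj₂ y) s′ → Run (iterᴾ f x) s n y s′
  run-doneᴾ {f = f} {x₀} {y = y} {s′} = go
    where
    go : ∀ {q s n} → Steps (f x₀) q s n (inj₂ y) s′ → Steps (iterᴾ f x₀) (x₀ , q) s n y s′
    go (exit eq)   = exit (exec-map _ _ eq)
    go (next eq r) = next (exec-map _ _ eq) (go r)

  run-againᴾ : ∀ {X Y} ⦃ fx : Finite X ⦄ {f : X → Program (X ⊎ Y)} {x s m x′ s′ n y s″} →
              Run (f x) s m (inj₁ x′) s′ → Run (iterᴾ f x′) s′ n y s″ → Run (iterᴾ f x) s (m + n) y s″
  run-againᴾ {f = f} {x₀} {x′ = x′} {s′} {n} {y} {s″} r₁ r₂ = go r₁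
    where
    -- The two programs have the same states and commands and differ in their entry only.
    restart : ∀ {q s n} → Steps (iterᴾ f x′) q s n y s″ → Steps (iterᴾ f x₀) q s n y s″
    restart (exit eq)   = exit eq
    restart (next eq r) = next eq (restart r)
    go : ∀ {q s m} → Steps (f x₀) q s m (inj₁ x′) s′ → Steps (iterᴾ f x₀) (x₀ , q) s (m + n) y s″
    go (exit {n = m} eq) = next (exec-map _ _ eq) (Steps-mono (m≤n+m n m) (restart r₂))
    go (next eq r)       = next (exec-map _ _ eq) (go r)

  infixl 1 _>>=_ _>>_

  -- Abstract, so that compound programs are never unfolded.
  abstract
    single : ∀ {X} → Instruction X → Program X
    single = singleᴾ

    run-single : ∀ {X} (i : Instruction X) {s} →
                 Run (single i) s 1 (proj₁ (exec i s)) (proj₂ (exec i s))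
    run-single = run-singleᴾ

    _>>=_ : ∀ {X Y} → ⦃ Finite X ⦄ → Program X → (X → Program Y) → Program Y
    _>>=_ = bindᴾ

    run-bind : ∀ {X Y} ⦃ fx : Finite X ⦄ {p : Program X} {f : X → Program Y} {s m x s′ n y s″} →
               Run p s m x s′ → Run (f x) s′ n y s″ → Run (p >>= f) s (m + n) y s″
    run-bind = run-bindᴾ

    iter : ∀ {X Y} → ⦃ Finite X ⦄ → (X → Program (X ⊎ Y)) → X → Program Y
    iter = iterᴾ

    run-done : ∀ {X Y} ⦃ fx : Finite X ⦄ {f : X → Program (X ⊎ Y)} {x s n y s′} →
               Run (f x) s n (inj₂ y) s′ → Run (iter f x) s n y s′
    run-done = run-doneᴾ

    run-again : ∀ {X Y} ⦃ fx : Finite X ⦄ {f : X → Program (X ⊎ Y)} {x s m x′ s′ n y s″} →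
                Run (f x) s m (inj₁ x′) s′ → Run (iter f x′) s′ n y s″ → Run (iter f x) s (m + n) y s″
    run-again = run-againᴾ

  _>>_ : ∀ {Y} → Program ⊤ → Program Y → Program Y
  p >> q = p >>= λ _ → q

  Symbolˢ : Set
  Symbolˢ = Maybe (A ⊎ Fin 0)

  stack : List Symbolˢ → List A
  stack (just (inj₁ a) ∷ ss) = a ∷ stack ss
  stack _                    = []

  content : Tape Symbolˢ → List A
  content (tape _ h rs) = stack (h ∷ rs)

  ControlState : ∀ {X} → Program X → Set
  ControlState p = Maybe (State p × Bool)

  goto : ∀ {X} (p : Program X) → State p ⊎ X → ControlState p
  goto p (inj₁ q) = just (q , false)
  goto p (inj₂ x) = nothing

  keep : ∀ {n} → Vec Symbolˢ n → Vec (Symbolˢ × Move) n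
  keep = Vec.map (_, stay)

  -- A push takes two steps; the flag marks the second one.
  act₁ : ∀ {X} (p : Program X) → Instruction (State p ⊎ X) → State p → Bool → Vec Symbolˢ (suc extra) →
         ControlState p × Vec (Symbolˢ × Move) (suc extra)
  act₁ p (skip x)     q b     hs = goto p x , keep hs
  -- An action writes before it moves. The old top is therefore written back while the head goes
  -- left, and the new letter follows in the next step.
  act₁ p (push r a x) q false hs = just (q , true) , keep hs [ r ]≔ (lookup hs r , left)
  act₁ p (push r a x) q true  hs = goto p x , keep hs [ r ]≔ (just (inj₁ a) , stay)
  act₁ p (pop r k)    q b     hs with lookup hs r
  ... | just (inj₁ a) = goto p (k (just a)) , keep hs [ r ]≔ (nothing , right)
  ... | nothing       = goto p (k nothing) , keep hs

  transition : ∀ {X} (p : Program X) → ControlState p → Vec Symbolˢ (suc extra) →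
               Maybe (ControlState p × Vec (Symbolˢ × Move) (suc extra))
  transition p nothing        hs = nothing
  transition p (just (q , b)) hs = just (act₁ p (command p q) q b hs)

  control : ∀ {X} (p : Program X) → Finite (ControlState p)
  control p = Maybe-finite ⦃ ×-finite ⦃ finite p ⦄ ⦄

  encodeAction : ∀ {X} (p : Program X) {B : Set} → Maybe (ControlState p × B) →
                 Maybe (Fin (List.length (elements (control p))) × B)
  encodeAction p nothing        = nothing
  encodeAction p (just (q , b)) = just (code (control p) q , b)

  machine : ∀ {X} → Program X → Machine A
  machine p .Machine.states      = List.length (elements (control p))
  machine p .Machine.auxiliaries = 0
  machine p .Machine.extraTapes  = extra
  machine p .Machine.start       = code (control p) (just (entry p , false))
  machine p .Machine.δ q hs      = encodeAction p (transition p (decode (control p) q) hs)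

  module _ {X} (p : Program X) where
    open Machine (machine p)

    private
      Tapes : Set
      Tapes = Vec (Tape Symbol) tapes

    contents : ∀ {n} → Vec (Tape Symbol) n → Vec (List A) n
    contents = Vec.map content

    zipWith-keep : ∀ {n} (ts : Vec (Tape Symbol) n) → Vec.zipWith act (keep (Vec.map Tape.head ts)) ts ≡ ts
    zipWith-keep []              = refl
    zipWith-keep (tape _ _ _ ∷ ts) = cong (_ ∷_) (zipWith-keep ts)

    zipWith-update : ∀ {n} (ts : Vec (Tape Symbol) n) r x →
                     Vec.zipWith act (keep (Vec.map Tape.head ts) [ r ]≔ x) ts ≡ ts [ r ]≔ act x (lookup ts r)
    zipWith-update (t ∷ ts)            zero    x = cong (_ ∷_) (zipWith-keep ts)
    zipWith-update (tape _ _ _ ∷ ts) (suc r) x = cong (_ ∷_) (zipWith-update ts r x)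

    contents-update : ∀ {n} (ts : Vec (Tape Symbol) n) r t →
                      contents (ts [ r ]≔ t) ≡ contents ts [ r ]≔ content t
    contents-update (_ ∷ ts) zero    t = refl
    contents-update (_ ∷ ts) (suc r) t = cong (_ ∷_) (contents-update ts r t)

    content-left : ∀ t a → content (act (just (inj₁ a) , stay) (act (Tape.head t , left) t)) ≡ a ∷ content t
    content-left (tape []       h rs) a = refl
    content-left (tape (l ∷ ls) h rs) a = refl

    content-right : ∀ t s → content (act (s , right) t) ≡ stack (Tape.after t)
    content-right (tape ls h [])       s = refl
    content-right (tape ls h (r ∷ rs)) s = refl

    Config : ControlState p → Tapes → Configuration
    Config q ts = code (control p) q , ts

    step-Config : ∀ q b ts {c a} → act₁ p (command p q) q b (Vec.map Tape.head ts) ≡ (c , a) →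
                  step (Config (just (q , b)) ts) ≡ just (Config c (Vec.zipWith act a ts))
    step-Config q b ts eq rewrite decode-code (control p) (just (q , b)) | eq = refl

    step-halt : ∀ ts → step (Config nothing ts) ≡ nothing
    step-halt ts rewrite decode-code (control p) nothing = refl

    ↓-mono : ∀ {c d m n} → m ≤ n → c ↓⟨ m ⟩ d → c ↓⟨ n ⟩ d
    ↓-mono m≤n      (halted eq)    = halted eq
    ↓-mono (s≤s m≤n) (stepped eq r) = stepped eq (↓-mono m≤n r)

    -- Stated with a continuation, so that commands of one and of two machine steps compose alike;
    -- the 2 is the price of a push.
    simulate-command : ∀ q ts {x s′} → exec (command p q) (contents ts) ≡ (x , s′) →
      ∃ λ ts′ → contents ts′ ≡ s′ ×
        (∀ {n d} → Config (goto p x) ts′ ↓⟨ n ⟩ d → Config (just (q , false)) ts ↓⟨ 2 + n ⟩ d)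
    simulate-command q ts eq with command p q in ceq
    simulate-command q ts refl | skip x = ts , refl , λ r → ↓-mono (m≤n+m _ 1)
      (stepped (trans (step-Config q false ts (cong (λ i → act₁ p i q false (Vec.map Tape.head ts)) ceq))
                      (cong (just ∘ Config _) (zipWith-keep ts))) r)
    simulate-command q ts refl | push r a x =
        ts₂ , eq₂
      , λ run → stepped (trans (step-Config q false ts (cong (λ i → act₁ p i q false (Vec.map Tape.head ts)) ceq))
                               (cong (just ∘ Config _) (trans (zipWith-update ts r _)
                                   (cong (λ h → ts [ r ]≔ act (h , left) (lookup ts r)) (lookup-map r Tape.head ts)))))
               (stepped (trans (step-Config q true ts₁ (cong (λ i → act₁ p i q true (Vec.map Tape.head ts₁)) ceq))
                               (cong (just ∘ Config _) (zipWith-update ts₁ r _))) run)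
      where
      ts₁ ts₂ : Tapes
      ts₁ = ts [ r ]≔ act (Tape.head (lookup ts r) , left) (lookup ts r)
      ts₂ = ts₁ [ r ]≔ act (just (inj₁ a) , stay) (lookup ts₁ r)
      eq₂ : contents ts₂ ≡ contents ts [ r ]≔ (a ∷ lookup (contents ts) r)
      eq₂ rewrite lookup∘update r ts (act (Tape.head (lookup ts r) , left) (lookup ts r))
        | []≔-idempotent {x = act (Tape.head (lookup ts r) , left) (lookup ts r)} {y = act (just (inj₁ a) , stay)
            (act (Tape.head (lookup ts r) , left) (lookup ts r))} ts r
        | contents-update ts r (act (just (inj₁ a) , stay) (act (Tape.head (lookup ts r) , left) (lookup ts r)))
        | content-left (lookup ts r) a | lookup-map r content ts = refl
    simulate-command q ts refl | pop r k with lookup ts r in teq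
    ... | tape ls (just (inj₁ a)) rs =
        ts [ r ]≔ act (nothing , right) (lookup ts r) , eq₁
      , λ {n} {d} run → ↓-mono (m≤n+m _ 1)
          (stepped (trans (step-Config q false ts (trans (cong (λ i → act₁ p i q false (Vec.map Tape.head ts)) ceq) aeq))
                          (cong (just ∘ Config _) (zipWith-update ts r _)))
                   (subst (λ x → Config (goto p (k x)) (ts [ r ]≔ act (nothing , right) (lookup ts r)) ↓⟨ n ⟩ d) heq run))
      where
      lk : lookup (contents ts) r ≡ a ∷ stack rs
      lk = trans (lookup-map r content ts) (cong content teq)
      heq : List.head (lookup (contents ts) r) ≡ just a
      heq = cong List.head lk
      eq₁ : contents (ts [ r ]≔ act (nothing , right) (lookup ts r)) ≡ contents ts [ r ]≔ List.drop 1 (lookup (contents ts) r)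
      eq₁ rewrite contents-update ts r (act (nothing , right) (lookup ts r)) | lk | teq
        | content-right (tape ls (just (inj₁ a)) rs) nothing = refl
      aeq : act₁ p (pop r k) q false (Vec.map Tape.head ts) ≡ (goto p (k (just a)) , keep (Vec.map Tape.head ts) [ r ]≔ (nothing , right))
      aeq rewrite lookup-map r Tape.head ts | teq = refl
    ... | tape ls nothing rs =
        ts , eq₁
      , λ {n} {d} run → ↓-mono (m≤n+m _ 1)
          (stepped (trans (step-Config q false ts (trans (cong (λ i → act₁ p i q false (Vec.map Tape.head ts)) ceq) aeq))
                          (cong (just ∘ Config _) (zipWith-keep ts)))
                   (subst (λ x → Config (goto p (k x)) ts ↓⟨ n ⟩ d) heq run))
      where
      lk : lookup (contents ts) r ≡ []
      lk = trans (lookup-map r content ts) (cong content teq)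
      heq : List.head (lookup (contents ts) r) ≡ nothing
      heq = cong List.head lk
      eq₁ : contents ts ≡ contents ts [ r ]≔ List.drop 1 (lookup (contents ts) r)
      eq₁ = sym (trans (cong (contents ts [ r ]≔_) (trans (cong (List.drop 1) lk) (sym lk))) ([]≔-lookup (contents ts) r))
      aeq : act₁ p (pop r k) q false (Vec.map Tape.head ts) ≡ (goto p (k nothing) , keep (Vec.map Tape.head ts))
      aeq rewrite lookup-map r Tape.head ts | teq = refl

    simulate : ∀ {q s n x s′} → Steps p q s n x s′ → ∀ ts → contents ts ≡ s →
               ∃ λ ts′ → contents ts′ ≡ s′ × Config (just (q , false)) ts ↓⟨ n * 2 ⟩ Config nothing ts′
    simulate (exit {q} eq) ts refl with simulate-command q ts eq
    ... | ts′ , ceq , cont = ts′ , ceq , cont (halted (step-halt ts′))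
    simulate (next {q} eq r) ts refl with simulate-command q ts eq
    ... | ts₁ , ceq , cont with simulate r ts₁ ceq
    ... | ts₂ , ceq₂ , run = ts₂ , ceq₂ , cont run

    word≡stack : ∀ ss → word ss ≡ stack ss
    word≡stack []                   = refl
    word≡stack (just (inj₁ a) ∷ ss) = cong (a ∷_) (word≡stack ss)
    word≡stack (nothing ∷ ss)       = refl

    content-load : ∀ w → content (load (map (λ a → just (inj₁ a)) w)) ≡ w
    content-load []      = refl
    content-load (a ∷ w) = cong (a ∷_) (stack-map w)
      where
      stack-map : ∀ w → stack (map (λ a → just (inj₁ a)) w) ≡ w
      stack-map []      = refl
      stack-map (a ∷ w) = cong (a ∷_) (stack-map w)

    contents-replicate : ∀ n → contents (Vec.replicate n (load [])) ≡ Vec.replicate n []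
    contents-replicate zero    = refl
    contents-replicate (suc n) = cong ([] ∷_) (contents-replicate n)

    machine-computes : ∀ {w n x v ss} → Run p (w ∷ Vec.replicate extra []) n x (v ∷ ss) →
                       Computes v from w within (n * 2)
    machine-computes {w} r
      with simulate r _ (cong₂ _∷_ (content-load w) (contents-replicate extra))
    ... | (tape ls h rs ∷ ts) , refl , run = _ , run , word≡stack (h ∷ rs)

-- Registers, and programs that move and copy words.

instance
  Letter-finite : Finite Letter
  Letter-finite .Finite.elements =
    ⟨∃⟩ ∷ ⟨∀⟩ ∷ ⟨<⟩ ∷ ⟨≤⟩ ∷ ⟨∧⟩ ∷ ⟨∨⟩ ∷ ⟨con⟩ ∷ ⟨var⟩ ∷ ⟨+⟩ ∷ ⟨×⟩ ∷ ⟨monomial⟩ ∷ ⟨pos⟩ ∷ ⟨neg⟩ ∷ ⟨1⟩ ∷ ⟨2⟩ ∷ ⟨end⟩ ∷ []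
  Letter-finite .Finite.complete ⟨∃⟩ = here refl
  Letter-finite .Finite.complete ⟨∀⟩ = there (here refl)
  Letter-finite .Finite.complete ⟨<⟩ = there (there (here refl))
  Letter-finite .Finite.complete ⟨≤⟩ = there (there (there (here refl)))
  Letter-finite .Finite.complete ⟨∧⟩ = there (there (there (there (here refl))))
  Letter-finite .Finite.complete ⟨∨⟩ = there (there (there (there (there (here refl)))))
  Letter-finite .Finite.complete ⟨con⟩ = there (there (there (there (there (there (here refl))))))
  Letter-finite .Finite.complete ⟨var⟩ = there (there (there (there (there (there (there (here refl)))))))
  Letter-finite .Finite.complete ⟨+⟩ = there (there (there (there (there (there (there (there (here refl))))))))
  Letter-finite .Finite.complete ⟨×⟩ = there (there (there (there (there (there (there (there (there (here refl)))))))))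
  Letter-finite .Finite.complete ⟨monomial⟩ = there (there (there (there (there (there (there (there (there (there (here refl))))))))))
  Letter-finite .Finite.complete ⟨pos⟩ = there (there (there (there (there (there (there (there (there (there (there (here refl)))))))))))
  Letter-finite .Finite.complete ⟨neg⟩ = there
      (there (there (there (there (there (there (there (there (there (there (there (here refl))))))))))))
  Letter-finite .Finite.complete ⟨1⟩ = there
      (there (there (there (there (there (there (there (there (there (there (there (there (here refl)))))))))))))
  Letter-finite .Finite.complete ⟨2⟩ = there
      (there (there (there (there (there (there (there (there (there (there (there (there (there (here refl))))))))))))))
  Letter-finite .Finite.complete ⟨end⟩ = there
      (there (there (there (there (there (there (there (there (there (there (there (there (there (there (here refl)))))))))))))))

open StackPrograms Letter 11

-- `rIn` is the first tape; `rOut` holds the output in reverse, `rTmp` is scratch. `rCtr` counts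
-- nodes, `rPar` holds the number of an inner node being closed, `rStk` the inner nodes still
-- waiting, `rLeaf` the digits of a leaf, `rA` and `rB` the variables to be written. In the end `rK`
-- holds the number of new variables, `rM` the digits of the scale, `rV` the number of all variables
-- of the matrix.
rIn rOut rTmp rCtr rPar rStk rLeaf rA rB rK rM rV : Reg
rIn   = 0F
rOut  = 1F
rTmp  = 2F
rCtr  = 3F
rPar  = 4F
rStk  = 5F
rLeaf = 6F
rA    = 7F
rB    = 8F
rK    = 9F
rM    = suc 9F
rV    = suc (suc 9F)

-- The output register comes last, so that a partial application describes
-- the store up to the output.
mk : (i t c p s l a b k m v o : List Letter) → Store
mk i t c p s l a b k m v o = i ∷ o ∷ t ∷ c ∷ p ∷ s ∷ l ∷ a ∷ b ∷ k ∷ m ∷ v ∷ []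

ones : ℕ → List Letter
ones n = replicate n ⟨1⟩

ones-+ : ∀ a b → ones (a + b) ≡ ones a ++ ones b
ones-+ zero    b = refl
ones-+ (suc a) b = cong (⟨1⟩ ∷_) (ones-+ a b)

ones-ʳ++ : ∀ a b → ones a ʳ++ ones b ≡ ones (a + b)
ones-ʳ++ zero    b = refl
ones-ʳ++ (suc a) b = trans (ones-ʳ++ a (suc b)) (cong ones (ℕ.+-suc a b))

ones-ʳ++-∷ : ∀ a xs → ones a ʳ++ (⟨1⟩ ∷ xs) ≡ ⟨1⟩ ∷ (ones a ʳ++ xs)
ones-ʳ++-∷ zero    xs = refl
ones-ʳ++-∷ (suc a) xs = ones-ʳ++-∷ a (⟨1⟩ ∷ xs)

ones-ʳ++-++ : ∀ a xs → ones a ʳ++ xs ≡ ones a ++ xs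
ones-ʳ++-++ zero    xs = refl
ones-ʳ++-++ (suc a) xs = trans (ones-ʳ++-∷ a xs) (cong (⟨1⟩ ∷_) (ones-ʳ++-++ a xs))

ret : ∀ {X} → X → Program X
ret x = single (skip x)

put : Reg → Letter → Program ⊤
put r a = single (push r a tt)

get : Reg → Program (Maybe Letter)
get r = single (pop r id)

run-ret : ∀ {X} {x : X} {s} → Run (ret x) s 1 x s
run-ret = run-single _

run-put : ∀ {r a s} → Run (put r a) s 1 tt (s [ r ]≔ (a ∷ lookup s r))
run-put = run-single _

run-get : ∀ {r s} → Run (get r) s 1 (List.head (lookup s r)) (s [ r ]≔ List.drop 1 (lookup s r))
run-get = run-single _

Run-mono : ∀ {X} {p : Program X} {s m n x s′} → m ≤ n → Run p s m x s′ → Run p s n x s′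
Run-mono = Steps-mono

Run-start : ∀ {X} {p : Program X} {s s₁ n x s′} → s ≡ s₁ → Run p s n x s′ → Run p s₁ n x s′
Run-start refl r = r

Run-end : ∀ {X} {p : Program X} {s n x s′ s₁} → s′ ≡ s₁ → Run p s n x s′ → Run p s n x s₁
Run-end refl r = r

moveStep : Reg → Maybe Letter → Program (⊤ ⊎ ⊤)
moveStep t nothing  = ret (inj₂ tt)
moveStep t (just a) = put t a >> ret (inj₁ tt)

move : Reg → Reg → Program ⊤
move r t = iter (λ _ → get r >>= moveStep t) tt

clearStep : Maybe Letter → Program (⊤ ⊎ ⊤)
clearStep nothing  = ret (inj₂ tt)
clearStep (just _) = ret (inj₁ tt)

clear : Reg → Program ⊤
clear r = iter (λ _ → get r >>= clearStep) tt

spillStep : Reg → Maybe Letter → Program (⊤ ⊎ ⊤)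
spillStep t nothing  = ret (inj₂ tt)
spillStep t (just a) = put t a >> (put rTmp a >> ret (inj₁ tt))

-- The word is spilled onto `t` and `rTmp` and then restored from `rTmp`. It arrives in `t`
-- reversed, as the reversed output demands; for unary numbers this makes no difference.
dup : Reg → Reg → Program ⊤
dup r t = iter (λ _ → get r >>= spillStep t) tt >> move rTmp r

module _ {r t : Reg} (s : Store) (r≢t : r ≢ t) where
  private
    -- With registers as variables, updates do not compute. All stores are kept in this normal form,
    -- and the equations below restore it after each instruction.
    store : List Letter → List Letter → Store
    store x y = (s [ r ]≔ x) [ t ]≔ y

    at-r : ∀ {x y} → lookup (store x y) r ≡ x
    at-r {x} {y} = trans (lookup∘update′ r≢t (s [ r ]≔ x) y) (lookup∘update r s x)

    at-t : ∀ {x y} → lookup (store x y) t ≡ y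
    at-t {x} {y} = lookup∘update t (s [ r ]≔ x) y

    set-r : ∀ {x y x′} → store x y [ r ]≔ x′ ≡ store x′ y
    set-r {x} {y} {x′} = trans ([]≔-commutes (s [ r ]≔ x) t r (λ e → r≢t (sym e))) (cong (_[ t ]≔ y) ([]≔-idempotent s r))

    set-t : ∀ {x y y′} → store x y [ t ]≔ y′ ≡ store x y′
    set-t {x} = []≔-idempotent (s [ r ]≔ x) t

  run-move′ : ∀ x y → Run (move r t) (store x y) (2 + 3 * length x) tt (store [] (x ʳ++ y))
  run-move′ [] y = run-done (run-bind
    (subst (λ z → Run (get r) (store [] y) 1 (List.head z) (store [] y [ r ]≔ List.drop 1 z)) at-r run-get)
    (Run-end set-r run-ret))
  run-move′ (a ∷ x) y = Run-mono (ℕ.≤-reflexive (time (length x))) (run-again (run-bind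
    (subst (λ z → Run (get r) (store (a ∷ x) y) 1 (List.head z) (store (a ∷ x) y [ r ]≔ List.drop 1 z)) at-r run-get)
    (Run-start (sym set-r)
      (run-bind (Run-end (cong (λ z → store x y [ t ]≔ (a ∷ z)) at-t) run-put)
                (Run-end set-t run-ret))))
    (run-move′ x (a ∷ y)))
    where
    time : ∀ n → 3 + (2 + 3 * n) ≡ 2 + 3 * (1 + n)
    time = solve-∀

run-move : ∀ r t {r≢t : False (r ≟ t)} s → Run (move r t) s (2 + 3 * length (lookup s r)) tt
    ((s [ r ]≔ []) [ t ]≔ (lookup s r ʳ++ lookup s t))
run-move r t {r≢t} s = Run-start (trans (cong (_[ t ]≔ lookup s t) ([]≔-lookup s r)) ([]≔-lookup s t))
  (run-move′ s (toWitnessFalse r≢t) (lookup s r) (lookup s t))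

run-clear : ∀ r s x → lookup s r ≡ x → Run (clear r) s (2 + 2 * length x) tt (s [ r ]≔ [])
run-clear r s [] eq = run-done (run-bind
  (subst (λ z → Run (get r) s 1 (List.head z) (s [ r ]≔ List.drop 1 z)) eq run-get) run-ret)
run-clear r s (a ∷ x) eq = Run-mono (ℕ.≤-reflexive (time (length x))) (run-again (run-bind
  (subst (λ z → Run (get r) s 1 (List.head z) (s [ r ]≔ List.drop 1 z)) eq run-get) run-ret)
  (Run-end ([]≔-idempotent s r) (run-clear r (s [ r ]≔ x) x (lookup∘update r s x))))
  where
  time : ∀ n → 2 + (2 + 2 * n) ≡ 2 + 2 * (1 + n)
  time = solve-∀

module _ {r t : Reg} (s : Store) (r≢t : r ≢ t) (r≢tmp : r ≢ rTmp) (t≢tmp : t ≢ rTmp) where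
  private
    store : List Letter → List Letter → List Letter → Store
    store x y z = ((s [ r ]≔ x) [ t ]≔ y) [ rTmp ]≔ z

    at-r : ∀ {x y z} → lookup (store x y z) r ≡ x
    at-r {x} {y} {z} = trans (lookup∘update′ r≢tmp ((s [ r ]≔ x) [ t ]≔ y) z)
        (trans (lookup∘update′ r≢t (s [ r ]≔ x) y) (lookup∘update r s x))

    at-t : ∀ {x y z} → lookup (store x y z) t ≡ y
    at-t {x} {y} {z} = trans (lookup∘update′ t≢tmp ((s [ r ]≔ x) [ t ]≔ y) z) (lookup∘update t (s [ r ]≔ x) y)

    at-tmp : ∀ {x y z} → lookup (store x y z) rTmp ≡ z
    at-tmp {x} {y} {z} = lookup∘update rTmp ((s [ r ]≔ x) [ t ]≔ y) z

    set-r : ∀ {x y z x′} → store x y z [ r ]≔ x′ ≡ store x′ y z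
    set-r {x} {y} {z} {x′} = trans ([]≔-commutes ((s [ r ]≔ x) [ t ]≔ y) rTmp r (λ e → r≢tmp (sym e)))
      (cong (_[ rTmp ]≔ z) (trans ([]≔-commutes (s [ r ]≔ x) t r (λ e → r≢t (sym e))) (cong (_[ t ]≔ y) ([]≔-idempotent s r))))

    set-t : ∀ {x y z y′} → store x y z [ t ]≔ y′ ≡ store x y′ z
    set-t {x} {y} {z} {y′} = trans ([]≔-commutes ((s [ r ]≔ x) [ t ]≔ y) rTmp t (λ e → t≢tmp (sym e)))
      (cong (_[ rTmp ]≔ z) ([]≔-idempotent (s [ r ]≔ x) t))

    set-tmp : ∀ {x y z z′} → store x y z [ rTmp ]≔ z′ ≡ store x y z′
    set-tmp {x} {y} = []≔-idempotent ((s [ r ]≔ x) [ t ]≔ y) rTmp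

  run-spill : ∀ x y z → Run (iter (λ _ → get r >>= spillStep t) tt) (store x y z) (2 + 4 * length x) tt (store [] (x ʳ++ y) (x ʳ++ z))
  run-spill [] y z = run-done (run-bind
    (subst (λ w → Run (get r) (store [] y z) 1 (List.head w) (store [] y z [ r ]≔ List.drop 1 w)) at-r run-get)
    (Run-end set-r run-ret))
  run-spill (a ∷ x) y z = Run-mono (ℕ.≤-reflexive (time (length x))) (run-again (run-bind
    (subst (λ w → Run (get r) (store (a ∷ x) y z) 1 (List.head w) (store (a ∷ x) y z [ r ]≔ List.drop 1 w)) at-r run-get)
    (Run-start (sym set-r)
      (run-bind (Run-end (cong (λ w → store x y z [ t ]≔ (a ∷ w)) at-t) run-put)
        (Run-start (sym set-t)
          (run-bind (Run-end (cong (λ w → store x (a ∷ y) z [ rTmp ]≔ (a ∷ w)) at-tmp) run-put)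
            (Run-end set-tmp run-ret))))))
    (run-spill x (a ∷ y) (a ∷ z)))
    where
    time : ∀ n → 4 + (2 + 4 * n) ≡ 2 + 4 * (1 + n)
    time = solve-∀

  run-dup′ : lookup s rTmp ≡ [] → Run (dup r t) s (4 + 7 * length (lookup s r)) tt (s [ t ]≔ (lookup s r ʳ++ lookup s t))
  run-dup′ tmp≡[] = Run-mono (ℕ.≤-reflexive (time (length x))) (run-bind
    (Run-start before (run-spill x y []))
    (Run-end after moved))
    where
    time : ∀ n → (2 + 4 * n) + (2 + 3 * n) ≡ 4 + 7 * n
    time = solve-∀
    x y : List Letter
    x = lookup s r
    y = lookup s t
    before : store x y [] ≡ s
    before = trans (cong (λ z → ((s [ r ]≔ x) [ t ]≔ y) [ rTmp ]≔ z) (sym tmp≡[]))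
      (trans (cong (λ z → z [ rTmp ]≔ lookup s rTmp) (trans (cong (_[ t ]≔ y) ([]≔-lookup s r)) ([]≔-lookup s t))) ([]≔-lookup s rTmp))
    S : Store
    S = store [] (x ʳ++ y) (x ʳ++ [])
    moved : Run (move rTmp r) S (2 + 3 * length x) tt ((S [ rTmp ]≔ []) [ r ]≔ (lookup S rTmp ʳ++ lookup S r))
    moved = subst (λ n → Run (move rTmp r) S (2 + 3 * n) tt ((S [ rTmp ]≔ []) [ r ]≔ (lookup S rTmp ʳ++ lookup S r)))
      (trans (cong length at-tmp) (trans (length-ʳ++ x) (ℕ.+-identityʳ _)))
      (Run-start (trans (cong (_[ r ]≔ lookup S r) ([]≔-lookup S rTmp)) ([]≔-lookup S r))
        (run-move′ {rTmp} {r} S (λ e → r≢tmp (sym e)) (lookup S rTmp) (lookup S r)))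
    after : (S [ rTmp ]≔ []) [ r ]≔ (lookup S rTmp ʳ++ lookup S r) ≡ s [ t ]≔ (x ʳ++ y)
    after = trans (cong₂ (λ z w → z [ r ]≔ w) set-tmp (trans (cong₂ _ʳ++_ at-tmp at-r) (trans (ʳ++-ʳ++ x) (++-identityʳ x))))
      (trans set-r
      (trans (cong (λ z → (z [ t ]≔ (x ʳ++ y)) [ rTmp ]≔ []) ([]≔-lookup s r))
      (trans (cong ((s [ t ]≔ (x ʳ++ y)) [ rTmp ]≔_) (trans (sym tmp≡[]) (sym (lookup∘update′ (λ e → t≢tmp (sym e)) s (x ʳ++ y)))))
             ([]≔-lookup (s [ t ]≔ (x ʳ++ y)) rTmp))))

run-dup : ∀ r t {r≢t : False (r ≟ t)} {r≢tmp : False (r ≟ rTmp)} {t≢tmp : False (t ≟ rTmp)} s → lookup s rTmp ≡ [] →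
          Run (dup r t) s (4 + 7 * length (lookup s r)) tt (s [ t ]≔ (lookup s r ʳ++ lookup s t))
run-dup r t {p} {q} {w} s = run-dup′ s (toWitnessFalse p) (toWitnessFalse q) (toWitnessFalse w)

-- Abstract, since c * u would reduce as soon as c is a numeral and could then
-- not be unified.
abstract
  cost : ℕ → ℕ → ℕ
  cost u c = c * u

  cost-def : ∀ u c → cost u c ≡ c * u
  cost-def u c = refl

  cost-+ : ∀ u c d → cost u c + cost u d ≡ cost u (c + d)
  cost-+ u c d = sym (ℕ.*-distribʳ-+ u c d)

  cost-mono : ∀ u {c d} → c ≤ d → cost u c ≤ cost u d
  cost-mono u = ℕ.*-monoˡ-≤ u

  cost-constant : ∀ {v} c → c ≤ cost (suc v) c
  cost-constant {v} c = ℕ.m≤m*n c (suc v)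

  cost-linear : ∀ {v n} a b → b ≤ a → n ≤ v → b + a * n ≤ cost (suc v) a
  cost-linear {v} {n} a b b≤a n≤v = ℕ.≤-trans (ℕ.+-mono-≤ b≤a (ℕ.*-monoʳ-≤ a n≤v)) (ℕ.≤-reflexive (sym (ℕ.*-suc a v)))

putOnes : ℕ → Reg → Program ⊤
putOnes zero    t = ret tt
putOnes (suc n) t = put t ⟨1⟩ >> putOnes n t

-- Loads the number c + (c + e) into t, where c is the content of r.
load : ℕ → Reg → Reg → Program ⊤
load e r t = putOnes e t >> (dup r t >> dup r t)

run-putOnes : ∀ n t s x → lookup s t ≡ ones x → Run (putOnes n t) s (suc n) tt (s [ t ]≔ ones (n + x))
run-putOnes zero    t s x eq =
  Run-end (trans (sym ([]≔-lookup s t)) (cong (s [ t ]≔_) eq)) run-ret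
run-putOnes (suc n) t s x eq = run-bind run-put
  (Run-end (trans ([]≔-idempotent s t) (cong (λ k → s [ t ]≔ ones k) (ℕ.+-suc n x)))
    (run-putOnes n t s₁ (suc x) (trans (lookup∘update t s _) (cong (⟨1⟩ ∷_) eq))))
  where
  s₁ : Store
  s₁ = s [ t ]≔ (⟨1⟩ ∷ lookup s t)

run-load : ∀ e r t {r≢t : False (r ≟ t)} {r≢tmp : False (r ≟ rTmp)} {t≢tmp : False (t ≟ rTmp)} {s c} →
           lookup s rTmp ≡ [] → lookup s r ≡ ones c → lookup s t ≡ [] →
           Run (load e r t) s (suc e + ((4 + 7 * c) + (4 + 7 * c))) tt (s [ t ]≔ ones (c + (c + e)))
run-load e r t {p} {q} {w} {s} {c} tmp≡ r≡ t≡ =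
  run-bind (Run-end (cong (λ k → s [ t ]≔ ones k) (ℕ.+-identityʳ e)) (run-putOnes e t s 0 t≡))
           (run-bind (once e) (once (c + e)))
  where
  once : ∀ x → Run (dup r t) (s [ t ]≔ ones x) (4 + 7 * c) tt (s [ t ]≔ ones (c + x))
  once x = Run-end (trans ([]≔-idempotent s t) (cong (s [ t ]≔_) (trans (cong₂ _ʳ++_ at-r (lookup∘update t s _)) (ones-ʳ++ c x))))
      (subst (λ n → Run (dup r t) (s [ t ]≔ ones x) (4 + 7 * n) tt
          ((s [ t ]≔ ones x) [ t ]≔ (lookup (s [ t ]≔ ones x) r ʳ++ lookup (s [ t ]≔ ones x) t)))
        (trans (cong length at-r) (length-replicate c))
        (run-dup r t {p} {q} {w} (s [ t ]≔ ones x) (trans (lookup∘update′ (λ e → toWitnessFalse w (sym e)) s _) tmp≡)))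
    where
    at-r : lookup (s [ t ]≔ ones x) r ≡ ones c
    at-r = trans (lookup∘update′ (toWitnessFalse p) s _) r≡

-- Programs that write polynomials in either notation.

putAll : List Letter → Program ⊤
putAll []       = ret tt
putAll (l ∷ ls) = put rOut l >> putAll ls

-- The exponents of a monomial.  Scanning the variables, hit r outputs a 1 at
-- the variable whose number is in r; the flag tells that this has happened.

hitStep : Maybe Letter → Program Bool
hitStep nothing  = put rOut ⟨1⟩ >> ret true
hitStep (just _) = ret false

hit : Bool → Reg → Program Bool
hit true  r = ret true
hit false r = get r >>= hitStep

exponentStep : Bool × Bool → Maybe Letter → Program (Bool × Bool ⊎ ⊤)
exponentStep _       nothing  = ret (inj₂ tt)
exponentStep (f , g) (just _) =
  -- Both registers may hit before the exponent is closed, so the scan writes the sum of two unit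
  -- vectors even if they coincide.
  put rTmp ⟨1⟩ >> (hit f rA >>= λ f′ → hit g rB >>= λ g′ → put rOut ⟨end⟩ >> ret (inj₁ (f′ , g′)))

exponents : Bool → Bool → Program ⊤
exponents f g = iter (λ fg → get rV >>= exponentStep fg) (f , g) >> move rTmp rV

-- In `Pending w x x′ f α` the register holds `x` now and `x′` after the remaining `w` variables,
-- `f` is its flag, and `α` is its contribution to their exponents. A register that stands for no
-- variable starts as `spent`.
data Pending : ∀ w → List Letter → List Letter → Bool → Vec ℕ w → Set where
  spent : ∀ {w x} → Pending w x x true (Vec.replicate w 0)
  at    : ∀ {w} (i : Fin w) → Pending w (ones (toℕ i)) [] false (Vec.replicate w 0 [ i ]≔ 1)

monomial : Bool → Bool → Program ⊤ → Program ⊤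
monomial f g coefficientᴾ = put rOut ⟨monomial⟩ >> (exponents f g >> coefficientᴾ)

scaleᴾ leafᴾ : Program ⊤
scaleᴾ = put rOut ⟨pos⟩ >> (dup rM rOut >> put rOut ⟨end⟩)
leafᴾ  = dup rLeaf rOut >> put rOut ⟨end⟩

-- The arguments are the variables whose numbers are in A and B, the scale M
-- and the constant in the leaf register.
emitVar emitScaled emitSum emitProd emitLeaf : Notation → Program ⊤
emitVar terms    = put rOut ⟨var⟩ >> (move rA rOut >> put rOut ⟨end⟩)
emitVar standard = monomial false true (putAll (binary 1ℤ)) >> put rOut ⟨end⟩

emitScaled terms    = put rOut ⟨×⟩ >> ((put rOut ⟨con⟩ >> scaleᴾ) >> emitVar terms)
emitScaled standard = monomial false true scaleᴾ >> put rOut ⟨end⟩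

emitSum terms    = put rOut ⟨+⟩ >> (emitVar terms >> (put rOut ⟨var⟩ >> (move rB rOut >> put rOut ⟨end⟩)))
emitSum standard = (monomial false true (putAll (binary 1ℤ)) >> monomial true false (putAll (binary 1ℤ))) >> put rOut ⟨end⟩

emitProd terms    = put rOut ⟨×⟩ >> ((put rOut ⟨con⟩ >> scaleᴾ) >>
                      (put rOut ⟨×⟩ >> (emitVar terms >> (put rOut ⟨var⟩ >> (move rB rOut >> put rOut ⟨end⟩)))))
emitProd standard = monomial false false scaleᴾ >> put rOut ⟨end⟩

emitLeaf terms    = put rOut ⟨con⟩ >> leafᴾ
emitLeaf standard = monomial true true leafᴾ >> put rOut ⟨end⟩

emitConst : Notation → ℤ → Program ⊤
emitConst terms    c = put rOut ⟨con⟩ >> putAll (binary c)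
emitConst standard c = monomial true true (putAll (binary c)) >> put rOut ⟨end⟩

module Emission (v : ℕ) where

  -- The unit of time, longer than any number that is copied.
  u : ℕ
  u = suc v

  Context : Set
  Context = List Letter → Store

  infixl 1 _⨾_ _⨾ᴱ_

  _⨾_ : ∀ {X} {P : Program ⊤} {Q : Program X} {s s′ s″ c d x} →
        Run P s (cost u c) tt s′ → Run Q s′ (cost u d) x s″ → Run (P >> Q) s (cost u (c + d)) x s″
  _⨾_ {c = c} {d} r₁ r₂ = Run-mono (ℕ.≤-reflexive (cost-+ u c d)) (run-bind r₁ r₂)

  constant : ∀ c {X} {P : Program X} {s s′ x} → Run P s c x s′ → Run P s (cost u c) x s′
  constant c = Run-mono (cost-constant c)

  linear : ∀ a b n {X} {P : Program X} {s s′ x} → {b≤a : True (b ℕ.≤? a)} → n ≤ v → Run P s (b + a * n) x s′ → Run P s (cost u a) x s′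
  linear a b n {b≤a = b≤a} n≤v = Run-mono (cost-linear a b (toWitness b≤a) n≤v)

  relax : ∀ {c} d {X} {P : Program X} {s s′ x} → {c≤d : True (c ℕ.≤? d)} → Run P s (cost u c) x s′ → Run P s (cost u d) x s′
  relax d {c≤d = c≤d} = Run-mono (cost-mono u (toWitness c≤d))

  -- The output is stored in reverse.
  record Emits (P : Program ⊤) (f g : Context) (c : ℕ) (w : List Letter) : Set where
    constructor emits
    field
      run : ∀ o → Run P (f o) (cost u c) tt (g (w ʳ++ o))

  open Emits public

  _⨾ᴱ_ : ∀ {P Q f g h c d w w′} → Emits P f g c w → Emits Q g h d w′ → Emits (P >> Q) f h (c + d) (w ++ w′)
  _⨾ᴱ_ {P} {Q} {f} {g} {h} {c} {d} {w} e₁ e₂ = emits λ o →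
    Run-end (cong (λ z → h z) (sym (++-ʳ++ w))) (run e₁ o ⨾ run e₂ (w ʳ++ o))

  relaxᴱ : ∀ {c} d {P f g w} → {c≤d : True (c ℕ.≤? d)} → Emits P f g c w → Emits P f g d w
  relaxᴱ d {c≤d = c≤d} e = emits λ o → relax d {c≤d = c≤d} (run e o)

  silent : ∀ {P f c} g → (∀ o → Run P (f o) (cost u c) tt (g o)) → Emits P f g c []
  silent g r = emits r

  reword : ∀ {P f g c w w′} → w ≡ w′ → Emits P f g c w → Emits P f g c w′
  reword refl e = e

  module _ {i t c p s l a b k m n : List Letter} where

    emits-put : ∀ x → Emits (put rOut x) (mk i t c p s l a b k m n) (mk i t c p s l a b k m n) 1 [ x ]
    emits-put x = emits λ o → constant 1 run-put

    emits-putAll : ∀ xs → Emits (putAll xs) (mk i t c p s l a b k m n) (mk i t c p s l a b k m n) (suc (length xs)) xs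
    emits-putAll []       = emits λ o → constant 1 run-ret
    emits-putAll (x ∷ xs) = emits-put x ⨾ᴱ emits-putAll xs

    emits-A : length a ≤ v → Emits (move rA rOut) (mk i t c p s l a b k m n) (mk i t c p s l [] b k m n) 3 a
    emits-A a≤v = emits λ o → linear 3 2 (length a) a≤v (run-move rA rOut _)

    emits-B : length b ≤ v → Emits (move rB rOut) (mk i t c p s l a b k m n) (mk i t c p s l a [] k m n) 3 b
    emits-B b≤v = emits λ o → linear 3 2 (length b) b≤v (run-move rB rOut _)

  module _ {i c p s l a b k m n : List Letter} where

    emits-leaf : length l ≤ v → Emits leafᴾ (mk i [] c p s l a b k m n) (mk i [] c p s l a b k m n) 8 (l ++ [ ⟨end⟩ ])
    emits-leaf l≤v = emits (λ o → linear 7 4 (length l) l≤v (run-dup rLeaf rOut (mk i [] c p s l a b k m n o) refl)) ⨾ᴱ emits-put ⟨end⟩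

    emits-scale : length m ≤ v → Emits scaleᴾ (mk i [] c p s l a b k m n) (mk i [] c p s l a b k m n) 9 (⟨pos⟩ ∷ m ++ [ ⟨end⟩ ])
    emits-scale m≤v = emits-put ⟨pos⟩ ⨾ᴱ (emits (λ o → linear 7 4 (length m) m≤v (run-dup rM rOut (mk i [] c p s l a b k m n o) refl))
        ⨾ᴱ emits-put ⟨end⟩)

  ones≤v : ∀ {n} → n ≤ v → length (ones n) ≤ v
  ones≤v {n} n≤v = ℕ.≤-trans (ℕ.≤-reflexive (length-replicate n)) n≤v

  load-cost : ∀ e c → e ≤ 3 → c ≤ v → suc e + ((4 + 7 * c) + (4 + 7 * c)) ≤ cost u 18
  load-cost e c e≤3 c≤v = ℕ.≤-trans (ℕ.+-mono-≤ {y = 4} (s≤s e≤3) (ℕ.≤-refl {(4 + 7 * c) + (4 + 7 * c)}))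
    (ℕ.≤-trans (ℕ.≤-trans (ℕ.≤-reflexive (arith c)) (ℕ.+-monoʳ-≤ 12 (ℕ.*-monoˡ-≤ c (toWitness {a? = 14 ℕ.≤? 18} tt))))
        (cost-linear 18 12 (toWitness {a? = 12 ℕ.≤? 18} tt) c≤v))
    where
    arith : ∀ c → 4 + ((4 + 7 * c) + (4 + 7 * c)) ≡ 12 + 14 * c
    arith = solve-∀


run-hit : ∀ r s {r≢out : False (r ≟ rOut)} {w x y f α} → Pending (suc w) x y f α → lookup s r ≡ x →
  ∃ λ x′ → ∃ λ f′ → Pending w x′ y f′ (Vec.tail α) ×
    Run (hit f r) s 3 f′ ((s [ r ]≔ x′) [ rOut ]≔ (ones (Vec.head α) ʳ++ lookup s rOut))
run-hit r s (spent {x = x}) eq = x , true , spent ,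
  Run-end (trans (sym ([]≔-lookup s rOut)) (cong (_[ rOut ]≔ lookup s rOut) (trans (sym ([]≔-lookup s r)) (cong (s [ r ]≔_) eq))))
    (Run-mono (s≤s z≤n) run-ret)
run-hit r s {r≢out} (at zero) eq = [] , true , spent ,
  run-bind (subst (λ z → Run (get r) s 1 (List.head z) (s [ r ]≔ List.drop 1 z)) eq run-get)
    (Run-end (cong (λ z → (s [ r ]≔ []) [ rOut ]≔ (⟨1⟩ ∷ z)) (lookup∘update′ (λ e → toWitnessFalse r≢out (sym e)) s []))
        (run-bind run-put run-ret))
run-hit r s {r≢out} (at (suc i)) eq = ones (toℕ i) , false , at i ,
  Run-mono (s≤s (s≤s z≤n)) (run-bind (subst (λ z → Run (get r) s 1 (List.head z) (s [ r ]≔ List.drop 1 z)) eq run-get)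
    (Run-end (trans (sym ([]≔-lookup (s [ r ]≔ ones (toℕ i)) rOut))
             (cong ((s [ r ]≔ ones (toℕ i)) [ rOut ]≔_) (lookup∘update′ (λ e → toWitnessFalse r≢out (sym e)) s _)))
      run-ret))

unary-+ : ∀ a b o → ⟨end⟩ ∷ (ones b ʳ++ (ones a ʳ++ o)) ≡ unary (a + b) ʳ++ o
unary-+ a b o = trans (cong (⟨end⟩ ∷_) (sym (trans (cong (_ʳ++ o) (ones-+ a b)) (++-ʳ++ (ones a)))))
                      (sym (++-ʳ++ (ones (a + b))))

run-exponents : ∀ {i t c p s l k m} w {x x′ y y′ f g} {α β : Vec ℕ w} → Pending w x x′ f α → Pending w y y′ g β → ∀ o →
  Run (iter (λ fg → get rV >>= exponentStep fg) (f , g)) (mk i t c p s l x y k m (ones w) o) (2 + 10 * w) tt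
      (mk i (ones w ʳ++ t) c p s l x′ y′ k m [] (concatMap unary (Vec.toList (Vec.zipWith _+_ α β)) ʳ++ o))
run-exponents {i} {t} {c} {p} {s} {l} {k} {m} zero {α = []} {[]} P Q o =
  subst₂ (λ x y → Run (iter (λ fg → get rV >>= exponentStep fg) _) _ 2 tt (mk i t c p s l x y k m [] o)) (empty P) (empty Q)
    (run-done (run-bind run-get run-ret))
  where
  empty : ∀ {x y f α} → Pending 0 x y f α → x ≡ y
  empty spent = refl
run-exponents {i} {t} {c} {p} {s} {l} {k} {m} (suc w) {x} {x′} {y} {y′} {f} {g} {a ∷ α} {b ∷ β} P Q o
  with run-hit rA (mk i (⟨1⟩ ∷ t) c p s l x y k m (ones w) o) P refl
... | x₁ , f₁ , P₁ , h₁ with run-hit rB (mk i (⟨1⟩ ∷ t) c p s l x₁ y k m (ones w) (ones a ʳ++ o)) Q refl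
... | y₁ , g₁ , Q₁ , h₂ = Run-mono (ℕ.≤-reflexive (time w)) (run-again
    (run-bind run-get (run-bind run-put (run-bind h₁ (run-bind h₂ (run-bind run-put run-ret)))))
    (subst₂ (λ z z′ → Run (iter (λ fg → get rV >>= exponentStep fg) (f₁ , g₁)) (mk i (⟨1⟩ ∷ t) c p s l x₁ y₁ k m (ones w) z) (2 + 10 * w) tt
                        (mk i (ones w ʳ++ (⟨1⟩ ∷ t)) c p s l x′ y′ k m [] z′))
      (sym (unary-+ a b o)) (sym (++-ʳ++ (unary (a + b))))
      (run-exponents w P₁ Q₁ (unary (a + b) ʳ++ o))))
  where
  time : ∀ w → 10 + (2 + 10 * w) ≡ 2 + 10 * (1 + w)
  time = solve-∀

module _ (v : ℕ) where
  open Emission v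

  emits-exponents : ∀ {i c p s l k m x x′ y y′ f g} {α β : Vec ℕ v} → Pending v x x′ f α → Pending v y y′ g β →
    Emits (exponents f g) (mk i [] c p s l x y k m (ones v)) (mk i [] c p s l x′ y′ k m (ones v)) 13
      (concatMap unary (Vec.toList (Vec.zipWith _+_ α β)))
  emits-exponents {i} {c} {p} {s} {l} {k} {m} {x} {x′} {y} {y′} {f} {g} {α} {β} P Q = emits λ o → linear 10 2 v ℕ.≤-refl
      (run-exponents v P Q o) ⨾
    Run-end (cong (λ z → mk i [] c p s l x′ y′ k m z (word o)) restored)
        (linear 3 2 _ (ℕ.≤-trans (ℕ.≤-reflexive (cong length onesʳ)) (ones≤v ℕ.≤-refl))
            (run-move rTmp rV (mk i (ones v ʳ++ []) c p s l x′ y′ k m [] (word o))))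
    where
    word : List Letter → List Letter
    word o = concatMap unary (Vec.toList (Vec.zipWith _+_ α β)) ʳ++ o
    onesʳ : ones v ʳ++ [] ≡ ones v
    onesʳ = trans (ones-ʳ++ v 0) (cong ones (ℕ.+-identityʳ v))
    restored : (ones v ʳ++ []) ʳ++ [] ≡ ones v
    restored = trans (cong (_ʳ++ []) onesʳ) onesʳ

  emits-monomial : ∀ {i c p s l k m x x′ y y′ f g C w d} {α β : Vec ℕ v} → Pending v x x′ f α → Pending v y y′ g β →
    Emits C (mk i [] c p s l x′ y′ k m (ones v)) (mk i [] c p s l x′ y′ k m (ones v)) d w →
    Emits (monomial f g C) (mk i [] c p s l x y k m (ones v)) (mk i [] c p s l x′ y′ k m (ones v)) (14 + d)
      (⟨monomial⟩ ∷ concatMap unary (Vec.toList (Vec.zipWith _+_ α β)) ++ w)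
  emits-monomial P Q C = emits-put ⟨monomial⟩ ⨾ᴱ (emits-exponents P Q ⨾ᴱ C)

  private
    unit : Fin v → Vec ℕ v
    unit x = Vec.replicate v 0 [ x ]≔ 1

    single-word : ∀ {γ δ : Vec ℕ v} c → γ ≡ δ →
      (⟨monomial⟩ ∷ concatMap unary (Vec.toList γ) ++ binary c) ++ [ ⟨end⟩ ] ≡ encodeMonomials [ (δ , c) ]
    single-word {γ} c refl = cong (_++ [ ⟨end⟩ ]) (sym (++-identityʳ (⟨monomial⟩ ∷ concatMap unary (Vec.toList γ) ++ binary c)))

    unit+0 : ∀ x → Vec.zipWith _+_ (unit x) (Vec.replicate v 0) ≡ unit x
    unit+0 x = zipWith-identityʳ ℕ.+-identityʳ (unit x)

    0+unit : ∀ x → Vec.zipWith _+_ (Vec.replicate v 0) (unit x) ≡ unit x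
    0+unit x = zipWith-identityˡ ℕ.+-identityˡ (unit x)

    0+0 : Vec.zipWith _+_ (Vec.replicate v 0) (Vec.replicate v 0) ≡ Vec.replicate v 0
    0+0 = zipWith-identityˡ ℕ.+-identityˡ (Vec.replicate v 0)

    toℕ≤v : ∀ (x : Fin v) → length (ones (toℕ x)) ≤ v
    toℕ≤v x = ones≤v (ℕ.<⇒≤ (toℕ<n x))

  module _ {i c p s l k m : List Letter} where

    private
      st : List Letter → List Letter → Context
      st a b = mk i [] c p s l a b k m (ones v)

    emits-var : ∀ κ (x : Fin v) {b} → Emits (emitVar κ) (st (ones (toℕ x)) b) (st [] b) 20 (encodePoly κ (varₚ κ x))
    emits-var terms    x = relaxᴱ 20 (emits-put ⟨var⟩ ⨾ᴱ (emits-A (toℕ≤v x) ⨾ᴱ emits-put ⟨end⟩))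
    emits-var standard x = relaxᴱ 20 (reword (single-word 1ℤ (unit+0 x))
      (emits-monomial (at x) spent (emits-putAll (binary 1ℤ)) ⨾ᴱ emits-put ⟨end⟩))

    emits-const : ∀ κ z {_ : True (length (binary z) ℕ.≤? 4)} → Emits (emitConst κ z) (st [] []) (st [] []) 20 (encodePoly κ (conₚ κ {v} z))
    emits-const terms    z {h} = emits λ o → Run-mono
        (cost-mono u (ℕ.+-monoʳ-≤ 2 (ℕ.≤-trans (toWitness h) (toWitness {a? = 4 ℕ.≤? 18} tt))))
            (run (emits-put ⟨con⟩ ⨾ᴱ emits-putAll (binary z)) o)
    emits-const standard z {h} = emits λ o → Run-mono (cost-mono u (bound _ (toWitness h))) (run (reword (single-word z 0+0)
      (emits-monomial spent spent (emits-putAll (binary z)) ⨾ᴱ emits-put ⟨end⟩)) o)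
      where
      bound : ∀ n → n ≤ 4 → (14 + suc n) + 1 ≤ 20
      bound n n≤4 = ℕ.+-monoˡ-≤ 1 (ℕ.+-monoʳ-≤ 14 (s≤s n≤4))

    emits-constLeaf : ∀ κ z → binary z ≡ l ++ [ ⟨end⟩ ] → length l ≤ v → Emits (emitLeaf κ) (st [] []) (st [] []) 30
        (encodePoly κ (conₚ κ {v} z))
    emits-constLeaf terms    z eq l≤v = relaxᴱ 30 (reword (cong (⟨con⟩ ∷_) (sym eq)) (emits-put ⟨con⟩ ⨾ᴱ emits-leaf l≤v))
    emits-constLeaf standard z eq l≤v = relaxᴱ 30 (reword
      (trans (cong (λ w → (⟨monomial⟩ ∷ concatMap unary
          (Vec.toList (Vec.zipWith _+_ (Vec.replicate v 0) (Vec.replicate v 0))) ++ w) ++ [ ⟨end⟩ ]) (sym eq)) (single-word z 0+0))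
      (emits-monomial spent spent (emits-leaf l≤v) ⨾ᴱ emits-put ⟨end⟩))

    emits-sum : ∀ κ (x y : Fin v) → Emits (emitSum κ) (st (ones (toℕ x)) (ones (toℕ y))) (st [] []) 40 (encodePoly κ (sumₚ κ x y))
    emits-sum terms    x y = relaxᴱ 40 (emits-put ⟨+⟩ ⨾ᴱ (emits-var terms x ⨾ᴱ (emits-put ⟨var⟩ ⨾ᴱ (emits-B (toℕ≤v y) ⨾ᴱ emits-put ⟨end⟩))))
    emits-sum standard x y = relaxᴱ 40 (reword
      (cong (_++ [ ⟨end⟩ ]) (cong₂ _++_ (cong word (unit+0 x)) (trans (cong word (0+unit y)) (sym (++-identityʳ _)))))
      ((emits-monomial (at x) spent (emits-putAll (binary 1ℤ)) ⨾ᴱ emits-monomial spent (at y) (emits-putAll (binary 1ℤ)))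
          ⨾ᴱ emits-put ⟨end⟩))
      where
      word : Vec ℕ v → List Letter
      word γ = ⟨monomial⟩ ∷ concatMap unary (Vec.toList γ) ++ binary 1ℤ

    module _ (M : ℤ) (binary-M : ⟨pos⟩ ∷ m ++ [ ⟨end⟩ ] ≡ binary M) (m≤v : length m ≤ v) where

      private
        emits-scale′ : ∀ {a b} → Emits scaleᴾ (st a b) (st a b) 9 (binary M)
        emits-scale′ = reword binary-M (emits-scale m≤v)

      emits-scaled : ∀ κ (x : Fin v) {b} → Emits (emitScaled κ) (st (ones (toℕ x)) b) (st [] b) 40 (encodePoly κ (scaledₚ κ M x))
      emits-scaled terms    x = relaxᴱ 40 (emits-put ⟨×⟩ ⨾ᴱ ((emits-put ⟨con⟩ ⨾ᴱ emits-scale′) ⨾ᴱ emits-var terms x))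
      emits-scaled standard x = relaxᴱ 40 (reword (single-word M (unit+0 x)) (emits-monomial (at x) spent emits-scale′ ⨾ᴱ emits-put ⟨end⟩))

      emits-prod : ∀ κ (x y : Fin v) → Emits (emitProd κ) (st (ones (toℕ x)) (ones (toℕ y))) (st [] []) 40 (encodePoly κ (prodₚ κ M x y))
      emits-prod terms    x y = relaxᴱ 40 (emits-put ⟨×⟩ ⨾ᴱ ((emits-put ⟨con⟩ ⨾ᴱ emits-scale′) ⨾ᴱ
        (emits-put ⟨×⟩ ⨾ᴱ (emits-var terms x ⨾ᴱ (emits-put ⟨var⟩ ⨾ᴱ (emits-B (toℕ≤v y) ⨾ᴱ emits-put ⟨end⟩))))))
      emits-prod standard x y = relaxᴱ 40 (reword (single-word {Vec.zipWith _+_ (unit x) (unit y)} M refl)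
          (emits-monomial (at x) (at y) emits-scale′ ⨾ᴱ emits-put ⟨end⟩))

-- The pass that translates the matrix.

instance
  Comparison-finite : Finite Comparison
  Comparison-finite .Finite.elements = lt ∷ le ∷ []
  Comparison-finite .Finite.complete lt = here refl
  Comparison-finite .Finite.complete le = there (here refl)

relLetter : Comparison → Letter
relLetter lt = ⟨<⟩
relLetter le = ⟨≤⟩

kindLetter : Comparison → Kind → Letter
kindLetter r add = ⟨+⟩
kindLetter r mul = ⟨×⟩
kindLetter r cmp = relLetter r

letterKind : Letter → Kind
letterKind ⟨+⟩ = add
letterKind ⟨×⟩ = mul
letterKind _   = cmp

letterKind-kindLetter : ∀ r o → letterKind (kindLetter r o) ≡ o
letterKind-kindLetter r  add = refl
letterKind-kindLetter r  mul = refl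
letterKind-kindLetter lt cmp = refl
letterKind-kindLetter le cmp = refl

-- The letters of a leaf that come before its `⟨end⟩`; one loop thus reads unary variables and
-- binary constants.
data Digit : Letter → Set where
  pos# : Digit ⟨pos⟩
  neg# : Digit ⟨neg⟩
  one# : Digit ⟨1⟩
  two# : Digit ⟨2⟩

ones-digits : ∀ n → All Digit (ones n)
ones-digits zero    = []
ones-digits (suc n) = one# ∷ ones-digits n

binaryDigits-digits : ∀ b → ∃ λ w → All Digit w × binaryDigits b ≡ w ++ [ ⟨end⟩ ]
binaryDigits-digits ℕᵇ.zero = [] , [] , refl
binaryDigits-digits 2[1+ b ] with binaryDigits-digits b
... | w , d , eq = ⟨2⟩ ∷ w , two# ∷ d , cong (⟨2⟩ ∷_) eq
binaryDigits-digits 1+[2 b ] with binaryDigits-digits b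
... | w , d , eq = ⟨1⟩ ∷ w , one# ∷ d , cong (⟨1⟩ ∷_) eq

binary-digits : ∀ c → ∃ λ w → All Digit w × binary c ≡ w ++ [ ⟨end⟩ ]
binary-digits (ℤ.+ n) with binaryDigits-digits (ℕᵇ.fromℕ n)
... | w , d , eq = ⟨pos⟩ ∷ w , pos# ∷ d , cong (⟨pos⟩ ∷_) eq
binary-digits ℤ.-[1+ n ] with binaryDigits-digits (ℕᵇ.fromℕ (suc n))
... | w , d , eq = ⟨neg⟩ ∷ w , neg# ∷ d , cong (⟨neg⟩ ∷_) eq

readStep : Maybe Letter → Program (⊤ ⊎ ⊤)
readStep nothing      = ret (inj₂ tt)
readStep (just ⟨end⟩) = ret (inj₂ tt)
readStep (just a)     = put rTmp a >> ret (inj₁ tt)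

readLeaf : Program ⊤
readLeaf = iter (λ _ → get rIn >>= readStep) tt >> move rTmp rLeaf

run-readStep : ∀ {a s} → Digit a → Run (readStep (just a)) s 2 (inj₁ tt) (proj₂ (exec (push rTmp a tt) s))
run-readStep pos# = run-bind run-put run-ret
run-readStep neg# = run-bind run-put run-ret
run-readStep one# = run-bind run-put run-ret
run-readStep two# = run-bind run-put run-ret

run-read : ∀ {i t c p s l a b k m n o} w → All Digit w →
  Run (iter (λ _ → get rIn >>= readStep) tt) (mk (w ++ ⟨end⟩ ∷ i) t c p s l a b k m n o) (2 + 3 * length w) tt
      (mk i (w ʳ++ t) c p s l a b k m n o)
run-read []      []       = run-done (run-bind run-get run-ret)
run-read (a ∷ w) (d ∷ ds) = Run-mono (ℕ.≤-reflexive (time (length w)))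
  (run-again (run-bind run-get (run-readStep d)) (run-read w ds))
  where
  time : ∀ n → 3 + (2 + 3 * n) ≡ 2 + 3 * (1 + n)
  time = solve-∀

toParStep : Maybe Letter → Program (⊤ ⊎ ⊤)
toParStep nothing      = ret (inj₂ tt)
toParStep (just ⟨end⟩) = ret (inj₂ tt)
toParStep (just a)     = put rPar a >> ret (inj₁ tt)

toPar : Program ⊤
toPar = iter (λ _ → get rStk >>= toParStep) tt

run-toPar : ∀ {i t c p s l a b k m n o} j →
  Run toPar (mk i t c p (ones j ++ ⟨end⟩ ∷ s) l a b k m n o) (2 + 3 * j) tt (mk i t c (ones j ʳ++ p) s l a b k m n o)
run-toPar zero    = run-done (run-bind run-get run-ret)
run-toPar (suc j) = Run-mono (ℕ.≤-reflexive (time j))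
  (run-again (run-bind run-get (run-bind run-put run-ret)) (run-toPar j))
  where
  time : ∀ n → 3 + (2 + 3 * n) ≡ 2 + 3 * (1 + n)
  time = solve-∀

emitAtom : Comparison → Program ⊤ → Program ⊤ → Program ⊤
emitAtom r P Q = put rOut (relLetter r) >> (P >> Q)

emitOr : Program ⊤ → Program ⊤ → Program ⊤
emitOr P Q = put rOut ⟨∨⟩ >> (P >> Q)

module _ (κ : Notation) where

  emitBox : Comparison → Program ⊤ → Program ⊤
  emitBox r P = emitOr (emitAtom r P (load 0 rCtr rA >> emitScaled κ)) (emitAtom r (load 1 rCtr rA >> emitScaled κ) P)

  emitEnd : ℕ → Reg → Program ⊤
  emitEnd e r = load e r rA >> emitVar κ

  emitEnds : ℕ → ℕ → Program ⊤ → Program ⊤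
  emitEnds e f P = load e rPar rA >> (load f rCtr rB >> P)

  emitCorner : Comparison → ℕ → ℕ → Program ⊤
  emitCorner r e f = emitOr (emitAtom r (emitEnds e f (emitProd κ)) (emitEnd 0 rPar))
                            (emitAtom r (emitEnd 1 rPar) (emitEnds e f (emitProd κ)))

  emitGlue : Comparison → Kind → Program ⊤
  emitGlue r add = emitOr (emitAtom r (emitEnds 2 0 (emitSum κ)) (emitEnd 0 rPar))
                          (emitAtom r (emitEnd 1 rPar) (emitEnds 3 1 (emitSum κ)))
  emitGlue r mul = emitOr (emitOr (emitCorner r 2 0) (emitCorner r 2 1)) (emitOr (emitCorner r 3 0) (emitCorner r 3 1))
  emitGlue r cmp = emitAtom r (emitEnd 2 rPar) (emitEnd 1 rCtr)

  emitOldVar : Program ⊤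
  emitOldVar = dup rLeaf rA >> (dup rK rA >> emitVar κ)

  -- Each inner node waits on the stack for its right child, at which its glue
  -- can be written.
  openNode : Letter → Program ⊤
  openNode l = put rOut ⟨∨⟩ >> (put rStk ⟨end⟩ >> (dup rCtr rStk >> (put rStk l >> put rCtr ⟨1⟩)))

  closeStep : Comparison → Maybe Letter → Program ⊤
  closeStep r nothing  = ret tt
  -- `rPar` receives the number of the waiting node, and `rCtr` already holds that of its right
  -- child, the next node to be read. The glue needs just these two.
  closeStep r (just l) = toPar >> (put rOut ⟨∨⟩ >> (emitGlue r (letterKind l) >> clear rPar))

  -- In preorder, every leaf of an atom but the last is followed by the right child of exactly one
  -- node, the innermost one still waiting. So each leaf pops once, and the last one finds the stack
  -- empty.
  leafNode : Comparison → Program ⊤ → Program ⊤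
  leafNode r P = readLeaf >> (emitBox r P >> (clear rLeaf >> (put rCtr ⟨1⟩ >> (get rStk >>= closeStep r))))

  dispatch : Comparison → Maybe Letter → Program (Comparison ⊎ ⊤)
  dispatch r (just ⟨∧⟩)   = put rOut ⟨∧⟩ >> ret (inj₁ r)
  dispatch r (just ⟨∨⟩)   = put rOut ⟨∨⟩ >> ret (inj₁ r)
  dispatch r (just ⟨<⟩)   = openNode ⟨<⟩ >> ret (inj₁ lt)
  dispatch r (just ⟨≤⟩)   = openNode ⟨≤⟩ >> ret (inj₁ le)
  dispatch r (just ⟨+⟩)   = openNode ⟨+⟩ >> ret (inj₁ r)
  dispatch r (just ⟨×⟩)   = openNode ⟨×⟩ >> ret (inj₁ r)
  dispatch r (just ⟨var⟩) = leafNode r emitOldVar >> ret (inj₁ r)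
  dispatch r (just ⟨con⟩) = leafNode r (emitLeaf κ) >> ret (inj₁ r)
  dispatch r _            = ret (inj₂ tt)

  -- The loop remembers the comparison of the current atom.
  loop : Comparison → Program ⊤
  loop = iter (λ r → get rIn >>= dispatch r)

  module Translating (m n N : ℕ) (M : ℤ) (binary-M : binary M ≡ ⟨pos⟩ ∷ ones N ++ [ ⟨end⟩ ]) where

    k v : ℕ
    k = 3 + (N + N)
    v = (suc k + n) + m

    slot : ℕ → Fin v
    slot i = slotᴺ k n i ↑ˡ m

    open Translation κ slot (shift (suc k) n m) M
    open Emission v

    private
      binary-M′ : ⟨pos⟩ ∷ ones N ++ [ ⟨end⟩ ] ≡ binary M
      binary-M′ = sym binary-M

    N≤v : N ≤ v
    N≤v = ℕ.≤-trans (ℕ.m≤m+n N N) (ℕ.≤-trans (ℕ.m≤n+m (N + N) 4) (ℕ.≤-trans (ℕ.m≤m+n (suc k) n) (ℕ.m≤m+n (suc k + n) m)))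

    k≤v : suc k ≤ v
    k≤v = ℕ.≤-trans (ℕ.m≤m+n (suc k) n) (ℕ.m≤m+n (suc k + n) m)

    toℕ-end : ∀ {i e} → i ≤ N → e ≤ 3 → toℕ (end i e) ≡ i + (i + e)
    toℕ-end {i} {e} i≤N e≤3 = trans (toℕ-↑ˡ (slotᴺ k n (i + (i + e))) m)
      (trans (toℕ-↑ˡ (clamp (i + (i + e))) n) (toℕ-clamp (ℕ.≤-trans
        (ℕ.+-mono-≤ i≤N (ℕ.+-mono-≤ i≤N e≤3)) (ℕ.≤-reflexive (arith N)))))
      where
      arith : ∀ N → N + (N + 3) ≡ 3 + (N + N)
      arith = solve-∀

    st : (i c p s l a b : List Letter) → Context
    st i c p s l a b = mk i [] c p s l a b (ones (suc k)) (ones N) (ones v)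

    module _ {I s l : List Letter} where

      emits-load-par : ∀ {c b i e} → i ≤ N → e ≤ 3 →
        Emits (load e rPar rA) (st I c (ones i) s l [] b) (st I c (ones i) s l (ones (toℕ (end i e))) b) 18 []
      emits-load-par {c} {b} {i} {e} i≤N e≤3 rewrite toℕ-end i≤N e≤3 =
        emits λ o → Run-mono (load-cost e i e≤3 (ℕ.≤-trans i≤N N≤v)) (run-load e rPar rA refl refl refl)

      emits-load-ctr : ∀ {p b i e} → i ≤ N → e ≤ 3 →
        Emits (load e rCtr rA) (st I (ones i) p s l [] b) (st I (ones i) p s l (ones (toℕ (end i e))) b) 18 []
      emits-load-ctr {p} {b} {i} {e} i≤N e≤3 rewrite toℕ-end i≤N e≤3 =
        emits λ o → Run-mono (load-cost e i e≤3 (ℕ.≤-trans i≤N N≤v)) (run-load e rCtr rA refl refl refl)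

      emits-load-ctr-B : ∀ {p a i e} → i ≤ N → e ≤ 3 →
        Emits (load e rCtr rB) (st I (ones i) p s l a []) (st I (ones i) p s l a (ones (toℕ (end i e)))) 18 []
      emits-load-ctr-B {p} {a} {i} {e} i≤N e≤3 rewrite toℕ-end i≤N e≤3 =
        emits λ o → Run-mono (load-cost e i e≤3 (ℕ.≤-trans i≤N N≤v)) (run-load e rCtr rB refl refl refl)

    encode-rel : ∀ r (p q : Poly κ v) → relLetter r ∷ encodePoly κ p ++ encodePoly κ q ≡ encode (rel κ r p q)
    encode-rel lt p q = refl
    encode-rel le p q = refl

    emits-atom : ∀ r (p q : Poly κ v) {P Q c d} {i t c′ p′ s l a b k m n} →
      Emits P (mk i t c′ p′ s l a b k m n) (mk i t c′ p′ s l a b k m n) c (encodePoly κ p) →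
      Emits Q (mk i t c′ p′ s l a b k m n) (mk i t c′ p′ s l a b k m n) d (encodePoly κ q) →
      Emits (emitAtom r P Q) (mk i t c′ p′ s l a b k m n) (mk i t c′ p′ s l a b k m n) (1 + (c + d)) (encode (rel κ r p q))
    emits-atom r p q P Q = reword (encode-rel r p q) (emits-put (relLetter r) ⨾ᴱ (P ⨾ᴱ Q))

    emits-or : ∀ {P Q c d w w′} {i t c′ p′ s l a b k m n} →
      Emits P (mk i t c′ p′ s l a b k m n) (mk i t c′ p′ s l a b k m n) c w →
      Emits Q (mk i t c′ p′ s l a b k m n) (mk i t c′ p′ s l a b k m n) d w′ →
      Emits (emitOr P Q) (mk i t c′ p′ s l a b k m n) (mk i t c′ p′ s l a b k m n) (1 + (c + d)) (⟨∨⟩ ∷ w ++ w′)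
    emits-or P Q = emits-put ⟨∨⟩ ⨾ᴱ (P ⨾ᴱ Q)

    module _ {I s l : List Letter} where

      emits-box : ∀ r p {P i} → i ≤ N → Emits P (st I (ones i) [] s l [] []) (st I (ones i) [] s l [] []) 40 (encodePoly κ p) →
        Emits (emitBox r P) (st I (ones i) [] s l [] []) (st I (ones i) [] s l [] []) 199 (encode (leaf r p i))
      emits-box r p {i = i} i≤N P = emits-or
        (emits-atom r p (scaledₚ κ M (end i 0)) P (emits-load-ctr i≤N z≤n ⨾ᴱ emits-scaled v M binary-M′ N≤v′ κ (end i 0)))
        (emits-atom r (scaledₚ κ M (end i 1)) p (emits-load-ctr i≤N (s≤s z≤n) ⨾ᴱ emits-scaled v M binary-M′ N≤v′ κ (end i 1)) P)
        where
        N≤v′ : length (ones N) ≤ v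
        N≤v′ = ones≤v N≤v

      module _ {i j : ℕ} (i≤N : i ≤ N) (j≤N : j ≤ N) where

        private
          f : Context
          f = st I (ones j) (ones i) s l [] []

          emits-end : ∀ e {e≤3 : e ≤ 3} → Emits (emitEnd e rPar) f f 38 (encodePoly κ (varₚ κ (end i e)))
          emits-end e {e≤3} = emits-load-par i≤N e≤3 ⨾ᴱ emits-var v κ (end i e)

          emits-sums : ∀ d e → d ≤ 3 → e ≤ 3 → Emits (emitEnds d e (emitSum κ)) f f 76 (encodePoly κ (sumₚ κ (end i d) (end j e)))
          emits-sums d e d≤3 e≤3 = emits-load-par i≤N d≤3 ⨾ᴱ (emits-load-ctr-B j≤N e≤3 ⨾ᴱ emits-sum v κ (end i d) (end j e))

          emits-prods : ∀ d e → d ≤ 3 → e ≤ 3 → Emits (emitEnds d e (emitProd κ)) f f 76 (encodePoly κ (prodₚ κ M (end i d) (end j e)))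
          emits-prods d e d≤3 e≤3 = emits-load-par i≤N d≤3 ⨾ᴱ
              (emits-load-ctr-B j≤N e≤3 ⨾ᴱ emits-prod v M binary-M′ (ones≤v N≤v) κ (end i d) (end j e))

          emits-corner : ∀ r d e → d ≤ 3 → e ≤ 3 → Emits (emitCorner r d e) f f 231 (encode (corner r i (end i d) (end j e)))
          emits-corner r d e d≤3 e≤3 = emits-or
            (emits-atom r (prodₚ κ M (end i d) (end j e)) (varₚ κ (end i 0)) (emits-prods d e d≤3 e≤3) (emits-end 0 {z≤n}))
            (emits-atom r (varₚ κ (end i 1)) (prodₚ κ M (end i d) (end j e)) (emits-end 1 {s≤s z≤n}) (emits-prods d e d≤3 e≤3))

          0≤3 : 0 ≤ 3
          0≤3 = z≤n
          1≤3 : 1 ≤ 3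
          1≤3 = s≤s z≤n
          2≤3 : 2 ≤ 3
          2≤3 = s≤s (s≤s z≤n)
          3≤3 : 3 ≤ 3
          3≤3 = s≤s (s≤s (s≤s z≤n))

        emits-glue : ∀ r o → Emits (emitGlue r o) f f 1000 (encode (glue r o i j))
        emits-glue r add = relaxᴱ 1000 (emits-or
          (emits-atom r (sumₚ κ (end i 2) (end j 0)) (varₚ κ (end i 0)) (emits-sums 2 0 2≤3 0≤3) (emits-end 0 {z≤n}))
          (emits-atom r (varₚ κ (end i 1)) (sumₚ κ (end i 3) (end j 1)) (emits-end 1 {s≤s z≤n}) (emits-sums 3 1 3≤3 1≤3)))
        emits-glue r mul = relaxᴱ 1000 (emits-or
          (emits-or (emits-corner r 2 0 2≤3 0≤3) (emits-corner r 2 1 2≤3 1≤3))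
          (emits-or (emits-corner r 3 0 3≤3 0≤3) (emits-corner r 3 1 3≤3 1≤3)))
        emits-glue r cmp = relaxᴱ 1000 (emits-atom r (varₚ κ (end i 2)) (varₚ κ (end j 1)) (emits-end 2 {2≤3})
          (emits-load-ctr j≤N 1≤3 ⨾ᴱ emits-var v κ (end j 1)))

    infixl 1 _⨾=_

    _⨾=_ : ∀ {X Y} ⦃ fx : Finite X ⦄ {P : Program X} {Q : X → Program Y} {s s′ s″ c d x y} →
           Run P s (cost u c) x s′ → Run (Q x) s′ (cost u d) y s″ → Run (P >>= Q) s (cost u (c + d)) y s″
    _⨾=_ {c = c} {d} r₁ r₂ = Run-mono (ℕ.≤-reflexive (cost-+ u c d)) (run-bind r₁ r₂)

    Pendings : Set
    Pendings = List (Kind × ℕ)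

    stackLetters : Comparison → Pendings → List Letter
    stackLetters r []            = []
    stackLetters r ((o , i) ∷ S) = kindLetter r o ∷ ones i ++ ⟨end⟩ ∷ stackLetters r S

    node : Comparison → List Letter → ℕ → Pendings → Context
    node r I c S = st I (ones c) [] (stackLetters r S) [] [] []

    glueWord : Comparison → Pendings → ℕ → List Letter
    glueWord r []            j = []
    glueWord r ((o , i) ∷ S) j = ⟨∨⟩ ∷ encode (glue r o i j)

    -- Glue is written only for the entry on top, so no invariant about deeper entries is carried
    -- along; each entry is known to fit when it is pushed.
    TopFits : Pendings → Set
    TopFits []            = ⊤
    TopFits ((o , i) ∷ S) = i ≤ N

    emits-close : ∀ r S {I j} → TopFits S → j ≤ N →
      Emits (get rStk >>= closeStep r) (node r I j S) (node r I j (drop 1 S)) 1100 (glueWord r S j)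
    emits-close r []            fits j≤N = emits λ o → relax 1100 (constant 1 run-get ⨾= constant 1 run-ret)
    emits-close r ((o , i) ∷ S) {I} {j} i≤N j≤N = emits λ out → relax 1100 (constant 1 run-get ⨾= run pop-glue out)
      where
      s : List Letter
      s = stackLetters r S
      to-par : ∀ out → Run toPar (st I (ones j) [] (ones i ++ ⟨end⟩ ∷ s) [] [] [] out) (cost u 3) tt (st I (ones j) (ones i) s [] [] [] out)
      to-par out = linear 3 2 i (ℕ.≤-trans i≤N N≤v)
        (Run-end (cong (λ z → st I (ones j) z s [] [] [] out) (trans (ones-ʳ++ i 0) (cong ones (ℕ.+-identityʳ i)))) (run-toPar i))
      pop-glue : Emits (closeStep r (just (kindLetter r o))) (st I (ones j) [] (ones i ++ ⟨end⟩ ∷ s) [] [] [])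
          (st I (ones j) [] s [] [] []) 1006 (⟨∨⟩ ∷ encode (glue r o i j))
      pop-glue rewrite letterKind-kindLetter r o = reword (cong (⟨∨⟩ ∷_) (++-identityʳ (encode (glue r o i j))))
        (silent (st I (ones j) (ones i) s [] [] []) to-par ⨾ᴱ
            (emits-put ⟨∨⟩ ⨾ᴱ (emits-glue i≤N j≤N r o ⨾ᴱ silent (st I (ones j) [] s [] [] [])
                (λ out → linear 2 2 (length (ones i)) (ones≤v (ℕ.≤-trans i≤N N≤v))
                    (run-clear rPar (st I (ones j) (ones i) s [] [] [] out) (ones i) refl)))))

    emits-read : ∀ w {I c s} → All Digit w → length w ≤ v → Emits readLeaf (st (w ++ ⟨end⟩ ∷ I) c [] s [] [] []) (st I c [] s w [] []) 6 []
    emits-read w {I} {c} {s} d w≤v = silent (st I c [] s w [] []) λ o → linear 3 2 (length w) w≤v (run-read w d) ⨾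
      Run-end (cong (λ z → st I c [] s z [] [] o) (trans (ʳ++-ʳ++ w) (++-identityʳ w)))
        (linear 3 2 (length (w ʳ++ [])) (ℕ.≤-trans (ℕ.≤-reflexive (trans (length-ʳ++ w) (ℕ.+-identityʳ _))) w≤v)
            (run-move rTmp rLeaf (before o)))
      where
      before : List Letter → Store
      before o = mk I (w ʳ++ []) c [] s [] [] [] (ones (suc k)) (ones N) (ones v) o

    emits-leafNode : ∀ r S p {P I c w} → suc c ≤ N → TopFits S → All Digit w → length w ≤ v →
      Emits P (st I (ones c) [] (stackLetters r S) w [] []) (st I (ones c) [] (stackLetters r S) w [] []) 40 (encodePoly κ p) →
      Emits (leafNode r P) (node r (w ++ ⟨end⟩ ∷ I) c S)
        (node r I (suc c) (drop 1 S)) 1400 (encode (leaf r p c) ++ glueWord r S (suc c))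
    emits-leafNode r S p {P} {I} {c} {w} c<N fits d w≤v P-emits = relaxᴱ 1400
      (emits-read w d w≤v ⨾ᴱ (emits-box r p (ℕ.<⇒≤ c<N) P-emits ⨾ᴱ
        (silent (node r I c S) (λ o → linear 2 2 (length w) w≤v (run-clear rLeaf (st I (ones c) [] (stackLetters r S) w [] [] o) w refl)) ⨾ᴱ
        (silent (node r I (suc c) S) (λ o → constant 1 run-put) ⨾ᴱ emits-close r S fits c<N))))

    emits-oldVar : ∀ x {I c s} → Emits (emitOldVar) (st I c [] s (ones (toℕ x)) [] []) (st I c [] s (ones (toℕ x)) [] []) 40
                     (encodePoly κ (varₚ κ (shift (suc k) n m x)))
    emits-oldVar x {I} {c} {s} = relaxᴱ 40
      (silent before (λ o → linear 7 4 (length (ones (toℕ x))) (ones≤v x≤v) (run-dup rLeaf rA (st I c [] s (ones (toℕ x)) [] [] o) refl)) ⨾ᴱ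
      (silent (st I c [] s (ones (toℕ x)) (ones (toℕ (shift (suc k) n m x))) [])
          (λ o → Run-end (cong (λ z → st I c [] s (ones (toℕ x)) z [] o) total)
               (linear 7 4 (length (ones (suc k))) (ones≤v k≤v) (run-dup rK rA (before o) refl)))
      ⨾ᴱ emits-var v κ (shift (suc k) n m x)))
      where
      x≤v : toℕ x ≤ v
      x≤v = ℕ.≤-trans (ℕ.<⇒≤ (toℕ<n x)) (ℕ.+-monoˡ-≤ m (ℕ.m≤n+m n (suc k)))
      before : List Letter → Store
      before o = st I c [] s (ones (toℕ x)) (ones (toℕ x) ʳ++ []) [] o
      total : ones (suc k) ʳ++ (ones (toℕ x) ʳ++ []) ≡ ones (toℕ (shift (suc k) n m x))
      total = trans (cong (ones (suc k) ʳ++_) (trans (ones-ʳ++ (toℕ x) 0) (cong ones (ℕ.+-identityʳ (toℕ x)))))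
        (trans (ones-ʳ++ (suc k) (toℕ x)) (cong ones (sym (toℕ-shift (suc k) n m x))))

    emits-open : ∀ l {I c s} → c ≤ N → Emits (openNode l) (st I (ones c) [] s [] [] [])
        (st I (ones (suc c)) [] (l ∷ ones c ++ ⟨end⟩ ∷ s) [] [] []) 20 [ ⟨∨⟩ ]
    emits-open l {I} {c} {s} c≤N = relaxᴱ 20 (emits-put ⟨∨⟩ ⨾ᴱ (silent before (λ o → constant 1 run-put) ⨾ᴱ
      (silent (st I (ones c) [] (ones c ++ ⟨end⟩ ∷ s) [] [] [])
          (λ o → Run-end (cong (λ z → st I (ones c) [] z [] [] [] o) (ones-ʳ++-++ c (⟨end⟩ ∷ s)))
        (linear 7 4 (length (ones c)) (ones≤v (ℕ.≤-trans c≤N N≤v)) (run-dup rCtr rStk (before o) refl))) ⨾ᴱ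
      (silent (st I (ones c) [] (l ∷ ones c ++ ⟨end⟩ ∷ s) [] [] []) (λ o → constant 1 run-put) ⨾ᴱ silent
          (st I (ones (suc c)) [] (l ∷ ones c ++ ⟨end⟩ ∷ s) [] [] []) (λ o → constant 1 run-put)))))
      where
      before : List Letter → Store
      before o = st I (ones c) [] (⟨end⟩ ∷ s) [] [] [] o

    -- Units of time per input letter. The dearest item is a leaf with 1402 units, digits included;
    -- an inner node takes 22 and a connective 3 before its operands are read.
    T : ℕ
    T = 1500

    private
      continue : ∀ {r r′ s s′ s″ q c y} d → c ≤ d →
        Run (get rIn >>= dispatch r) s (cost u c) (inj₁ r′) s′ → Run (loop r′) s′ q y s″ → Run (loop r) s (cost u d + q) y s″
      continue {q = q} d c≤d r₁ r₂ = run-again (Run-mono (cost-mono u c≤d) r₁) r₂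

      step : ∀ {P r r′ l I I′ c s c′ s′ d w} → dispatch r (just l) ≡ (P >> ret (inj₁ r′)) →
        Emits P (st I c [] s [] [] []) (st I′ c′ [] s′ [] [] []) d w → ∀ o →
        Run (get rIn >>= dispatch r) (st (l ∷ I) c [] s [] [] [] o) (cost u (1 + (d + 1))) (inj₁ r′) (st I′ c′ [] s′ [] [] [] (w ʳ++ o))
      step {P} {r} {r′} {l} {I} {I′} {c} {s} {c′} {s′} {d} {w} eq e o = constant 1 run-get ⨾=
        subst (λ D → Run D (st I c [] s [] [] [] o) (cost u (d + 1)) (inj₁ r′) (st I′ c′ [] s′ [] [] [] (w ʳ++ o))) (sym eq)
          (run e o ⨾ constant 1 run-ret)

    leaf-run : ∀ r S l w p {P I c out q y s″} → dispatch r (just l) ≡ (leafNode r P >> ret (inj₁ r)) → All Digit w →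
      (∀ {s} → Emits P (st I (ones c) [] s w [] []) (st I (ones c) [] s w [] []) 40 (encodePoly κ p)) →
      suc c ≤ N → TopFits S → length (w ++ [ ⟨end⟩ ]) ≤ v →
      Run (loop r) (node r I (suc c) (drop 1 S) (glueWord r S (suc c) ʳ++ (encode (leaf r p c) ʳ++ out))) q y s″ →
      Run (loop r) (node r (l ∷ (w ++ [ ⟨end⟩ ]) ++ I) c S out) (cost u (T * suc (length (w ++ [ ⟨end⟩ ]))) + q) y s″
    leaf-run r S l w p {P} {I} {c} {out} {q} {y} {s″} eq d P-emits c<N fits w≤v rest =
      Run-start (cong (λ z → node r (l ∷ z) c S out) (sym (++-assoc w [ ⟨end⟩ ] I)))
        (continue (T * suc (length (w ++ [ ⟨end⟩ ]))) bound
          (step eq (emits-leafNode r S p c<N fits d w≤v′ P-emits) out)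
          (Run-start (cong (λ z → node r I (suc c) (drop 1 S) z) (sym (++-ʳ++ (encode (leaf r p c))))) rest))
      where
      w≤v′ : length w ≤ v
      w≤v′ = ℕ.≤-trans (length-++-≤ˡ w) w≤v
      bound : 1402 ≤ T * suc (length (w ++ [ ⟨end⟩ ]))
      bound = ℕ.≤-trans (toWitness {a? = 1402 ℕ.≤? 1500} tt) (ℕ.m≤m*n T (suc (length (w ++ [ ⟨end⟩ ]))))

    -- The entry on top of `S` waits for the end of `t`, so the run over `t` includes writing its
    -- glue: for a left child that of the parent, for a right child that of an outer node, if any.
    -- The remaining run is an argument, which lets the two children be chained.
    term-run : ∀ r t S {I c out q y s″} → c + termNodes t ≤ N → TopFits S → length (encodeTerm t) ≤ v →
      Run (loop r) (node r I (c + termNodes t) (drop 1 S)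
                      (glueWord r S (c + termNodes t) ʳ++ (encode (translateTerm r t c) ʳ++ out))) q y s″ →
      Run (loop r) (node r (encodeTerm t ++ I) c S out) (cost u (T * length (encodeTerm t)) + q) y s″

    node-run : ∀ r₀ r o s t S {I c out q y s″} →
      dispatch r₀ (just (kindLetter r o)) ≡ (openNode (kindLetter r o) >> ret (inj₁ r)) →
      c + suc (termNodes s + termNodes t) ≤ N → TopFits S → length (encodeTerm s ++ encodeTerm t) ≤ v →
      Run (loop r) (node r I (c + suc (termNodes s + termNodes t)) (drop 1 S)
                      (glueWord r S (c + suc (termNodes s + termNodes t)) ʳ++ (encode (translateNode r o s t c) ʳ++ out))) q y s″ →
      Run (loop r₀) (node r (kindLetter r o ∷ (encodeTerm s ++ encodeTerm t) ++ I) c S out)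
                    (cost u (T * suc (length (encodeTerm s ++ encodeTerm t))) + q) y s″
    node-run r₀ r o s t S {I} {c} {out} {q} {y} {s″} eq c≤N fits len≤v rest =
      Run-start (cong (λ z → node r (kindLetter r o ∷ z) c S out) (sym (++-assoc (encodeTerm s) (encodeTerm t) I)))
        (Run-mono (ℕ.≤-reflexive time)
          (continue T (toWitness {a? = 22 ℕ.≤? 1500} tt) (step eq (emits-open (kindLetter r o) (ℕ.≤-trans (ℕ.m≤m+n c _) c≤N)) out)
            (term-run r s ((o , c) ∷ S) s≤N (ℕ.≤-trans (ℕ.m≤m+n c _) c≤N) s≤v
              (term-run r t S (ℕ.≤-trans (ℕ.≤-reflexive (sym assoc)) c≤N) fits t≤v
                (Run-start (cong (λ z → node r I z (drop 1 S) (glueWord r S z ʳ++ word)) assoc)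
                  (Run-start (cong (λ z → node r I (c + suc (termNodes s + termNodes t)) (drop 1 S)
                                       (glueWord r S (c + suc (termNodes s + termNodes t)) ʳ++ z)) word≡) rest))))))
      where
      j : ℕ
      j = suc c + termNodes s
      assoc : c + suc (termNodes s + termNodes t) ≡ j + termNodes t
      assoc = arith c (termNodes s) (termNodes t)
        where
        arith : ∀ a b d → a + (1 + (b + d)) ≡ ((1 + a) + b) + d
        arith = solve-∀
      s≤N : j ≤ N
      s≤N = ℕ.≤-trans (ℕ.m≤m+n j (termNodes t)) (ℕ.≤-trans (ℕ.≤-reflexive (sym assoc)) c≤N)
      s≤v : length (encodeTerm s) ≤ v
      s≤v = ℕ.≤-trans (length-++-≤ˡ (encodeTerm s)) len≤v
      t≤v : length (encodeTerm t) ≤ v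
      t≤v = ℕ.≤-trans (length-++-≤ʳ _ {encodeTerm s}) len≤v
      word : List Letter
      word = encode (translateTerm r t j) ʳ++ ((⟨∨⟩ ∷ encode (glue r o c j)) ʳ++ (encode (translateTerm r s (suc c)) ʳ++ (⟨∨⟩ ∷ out)))
      word≡ : encode (translateNode r o s t c) ʳ++ out ≡ word
      word≡ = trans (++-ʳ++ (encode (translateTerm r s (suc c)))) (++-ʳ++ (encode (glue r o c j)))
      time : cost u T + (cost u (T * length (encodeTerm s)) + (cost u (T * length (encodeTerm t)) + q))
           ≡ cost u (T * suc (length (encodeTerm s ++ encodeTerm t))) + q
      time = trans (trans (cong (cost u T +_) (sym (ℕ.+-assoc (cost u (T * length (encodeTerm s))) _ q)))
                          (sym (ℕ.+-assoc (cost u T) _ q)))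
                   (cong (_+ q) (trans (cong (cost u T +_) (cost-+ u (T * length (encodeTerm s)) (T * length (encodeTerm t))))
                     (trans (cost-+ u T _) (cong (cost u)
                       (trans (cong (T +_) (sym (ℕ.*-distribˡ-+ T (length (encodeTerm s)) (length (encodeTerm t)))))
                         (trans (sym (ℕ.*-suc T (length (encodeTerm s) + length (encodeTerm t))))
                             (cong (λ z → T * suc z) (sym (length-++ (encodeTerm s))))))))))

    term-run r (con z) S {I} {c} {out} {q} {y} {s″} c≤N fits len≤v rest with binary-digits z
    ... | w , d , eq = subst (λ b → Run (loop r) (node r (⟨con⟩ ∷ b ++ I) c S out) (cost u (T * suc (length b)) + q) y s″)
      (sym eq) (leaf-run r S ⟨con⟩ w (conₚ κ z) refl d (relaxᴱ 40 (emits-constLeaf v κ z eq w≤v))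
          (ℕ.≤-trans (ℕ.≤-reflexive (ℕ.+-comm 1 c)) c≤N) fits wend≤v
        (Run-start (cong (λ j → node r I j (drop 1 S) (glueWord r S j ʳ++ (encode (leaf r (conₚ κ z) c) ʳ++ out))) (ℕ.+-comm c 1)) rest))
      where
      wend≤v : length (w ++ [ ⟨end⟩ ]) ≤ v
      wend≤v = ℕ.≤-trans (ℕ.≤-trans (ℕ.≤-reflexive (cong length (sym eq))) (ℕ.n≤1+n _)) len≤v
      w≤v : length w ≤ v
      w≤v = ℕ.≤-trans (length-++-≤ˡ w) wend≤v
    term-run r (var x) S {I} {c} {out} {q} {y} {s″} c≤N fits len≤v rest =
      leaf-run r S ⟨var⟩ (ones (toℕ x)) (varₚ κ (shift (suc k) n m x)) refl (ones-digits (toℕ x)) (emits-oldVar x)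
        (ℕ.≤-trans (ℕ.≤-reflexive (ℕ.+-comm 1 c)) c≤N) fits (ℕ.≤-trans (ℕ.n≤1+n _) len≤v)
        (Run-start (cong (λ j → node r I j (drop 1 S) (glueWord r S j ʳ++ (encode (leaf r (varₚ κ (shift (suc k) n m x)) c) ʳ++ out)))
            (ℕ.+-comm c 1)) rest)
    term-run r (s ⊕ t) S c≤N fits len≤v rest = node-run r r add s t S refl c≤N fits (ℕ.≤-trans (ℕ.n≤1+n _) len≤v) rest
    term-run r (s ⊗ t) S c≤N fits len≤v rest = node-run r r mul s t S refl c≤N fits (ℕ.≤-trans (ℕ.n≤1+n _) len≤v) rest

    -- The continuation is given for every `r′`, because the comparison remembered afterwards is
    -- that of the last atom and each later atom sets it anew.
    formula-run : ∀ r {φ} → QuantifierFree φ → ∀ {I c out q y s″} → c + nodes φ ≤ N → length (encode φ) ≤ v →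
      (∀ r′ → Run (loop r′) (st I (ones (c + nodes φ)) [] [] [] [] [] (encode (translate φ c) ʳ++ out)) q y s″) →
      Run (loop r) (st (encode φ ++ I) (ones c) [] [] [] [] [] out) (cost u (T * length (encode φ)) + q) y s″

    connective-run : ∀ r l {φ ψ} → QuantifierFree φ → QuantifierFree ψ → dispatch r (just l) ≡ (put rOut l >> ret (inj₁ r)) →
      ∀ {I c out q y s″} → c + (nodes φ + nodes ψ) ≤ N → length (encode φ ++ encode ψ) ≤ v →
      (∀ r′ → Run (loop r′) (st I (ones (c + (nodes φ + nodes ψ))) [] [] [] [] []
                ((l ∷ encode (translate φ c) ++ encode (translate ψ (c + nodes φ))) ʳ++ out)) q y s″) →
      Run (loop r) (st (l ∷ (encode φ ++ encode ψ) ++ I) (ones c) [] [] [] [] [] out)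
          (cost u (T * suc (length (encode φ ++ encode ψ))) + q) y s″
    connective-run r l {φ} {ψ} f g eq {I} {c} {out} {q} {y} {s″} c≤N len≤v rest =
      Run-start (cong (λ z → st (l ∷ z) (ones c) [] [] [] [] [] out) (sym (++-assoc (encode φ) (encode ψ) I)))
        (Run-mono (ℕ.≤-reflexive time)
          (continue T (toWitness {a? = 3 ℕ.≤? 1500} tt) (step eq (emits-put l) out)
            (formula-run r f (ℕ.≤-trans (ℕ.+-monoʳ-≤ c (ℕ.m≤m+n (nodes φ) (nodes ψ))) c≤N)
              (ℕ.≤-trans (length-++-≤ˡ (encode φ)) len≤v) λ r′ →
              formula-run r′ g (ℕ.≤-trans (ℕ.≤-reflexive (ℕ.+-assoc c (nodes φ) (nodes ψ))) c≤N)
                (ℕ.≤-trans (length-++-≤ʳ _ {encode φ}) len≤v) λ r″ →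
                Run-start (cong (λ z → st I (ones z) [] [] [] [] []
                    (encode (translate ψ (c + nodes φ)) ʳ++ (encode (translate φ c) ʳ++ (l ∷ out))))
                        (sym (ℕ.+-assoc c (nodes φ) (nodes ψ))))
                  (Run-start (cong (λ z → st I (ones (c + (nodes φ + nodes ψ))) [] [] [] [] [] z) (++-ʳ++ (encode (translate φ c))))
                      (rest r″)))))
      where
      time : cost u T + (cost u (T * length (encode φ)) + (cost u (T * length (encode ψ)) + q))
           ≡ cost u (T * suc (length (encode φ ++ encode ψ))) + q
      time = trans (trans (cong (cost u T +_) (sym (ℕ.+-assoc (cost u (T * length (encode φ))) _ q)))
                          (sym (ℕ.+-assoc (cost u T) _ q)))
                   (cong (_+ q) (trans (cong (cost u T +_) (cost-+ u (T * length (encode φ)) (T * length (encode ψ))))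
                     (trans (cost-+ u T _) (cong (cost u)
                       (trans (cong (T +_) (sym (ℕ.*-distribˡ-+ T (length (encode φ)) (length (encode ψ)))))
                         (trans (sym (ℕ.*-suc T (length (encode φ) + length (encode ψ))))
                             (cong (λ z → T * suc z) (sym (length-++ (encode φ))))))))))

    formula-run r (p ≺ q) c≤N len≤v rest = node-run r lt cmp p q [] refl c≤N tt (ℕ.≤-trans (ℕ.n≤1+n _) len≤v) (rest lt)
    formula-run r (p ≼ q) c≤N len≤v rest = node-run r le cmp p q [] refl c≤N tt (ℕ.≤-trans (ℕ.n≤1+n _) len≤v) (rest le)
    formula-run r (f ∧ g) c≤N len≤v rest = connective-run r ⟨∧⟩ f g refl c≤N (ℕ.≤-trans (ℕ.n≤1+n _) len≤v) rest
    formula-run r (f ∨ g) c≤N len≤v rest = connective-run r ⟨∨⟩ f g refl c≤N (ℕ.≤-trans (ℕ.n≤1+n _) len≤v) rest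

    matrix-run : ∀ {Φ} → QuantifierFree Φ → nodes Φ ≤ N → length (encode Φ) ≤ v → ∀ o →
      Run (loop le) (st (encode Φ) [] [] [] [] [] [] o) (cost u (T * length (encode Φ) + 2)) tt
                    (st [] (ones (nodes Φ)) [] [] [] [] [] (encode (translate Φ 0) ʳ++ o))
    matrix-run {Φ} qf Φ≤N Φ≤v o =
      Run-start (cong (λ z → st z [] [] [] [] [] [] o) (++-identityʳ (encode Φ)))
        (Run-mono (ℕ.≤-reflexive (cost-+ u (T * length (encode Φ)) 2))
          (formula-run le qf Φ≤N Φ≤v λ r′ → run-done (constant 1 run-get ⨾= constant 1 run-ret)))

-- The bounds on the quantified variables.

Ys Xs : ∀ m n → List (Fin (n + m))
Ys m n = map (_↑ˡ m) (allFin n)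
Xs m n = map (n ↑ʳ_) (allFin m)

matrix : ∀ {κ} → Bool → ∀ m n → Formula κ (n + m) → Formula κ (n + m)
matrix false m n Φ = Φ
matrix true  m n Φ = ∣ Ys m n ∣> 1ℤ ∨ (∣ Xs m n ∣≤ 1ℤ ∧ Φ)

-- `lt` selects the negated bound, whose atoms are strict. The two have the same right-nested form
-- with other connectives and relations, so one loop copies both.
bound : ∀ {κ n} → Comparison → List (Fin n) → Formula κ n
bound lt xs = ∣ xs ∣> 1ℤ
bound le xs = ∣ xs ∣≤ 1ℤ

tabulate-+ : ∀ {A : Set} a b (f : Fin (a + b) → A) → tabulate (λ i → f (i ↑ˡ b)) ++ tabulate (λ i → f (a ↑ʳ i)) ≡ tabulate f
tabulate-+ zero    b f = refl
tabulate-+ (suc a) b f = cong (f zero ∷_) (tabulate-+ a b (f ∘ suc))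

passStep : Maybe Letter → Program ⊤
passStep nothing  = ret tt
passStep (just l) = put rOut l

pass : Program ⊤
pass = get rIn >>= passStep

module _ (κ : Notation) where

  emitCounter : Program ⊤
  emitCounter = dup rCtr rA >> emitVar κ

  newBound : Program ⊤
  newBound = put rOut ⟨∨⟩ >> emitOr (emitAtom lt emitCounter (emitConst κ (ℤ.- 1ℤ))) (emitAtom lt (emitConst κ 1ℤ) emitCounter)

  newBoundsStep : Maybe Letter → Program (⊤ ⊎ ⊤)
  newBoundsStep nothing  = ret (inj₂ tt)
  newBoundsStep (just _) = newBound >> (put rCtr ⟨1⟩ >> ret (inj₁ tt))

  -- The bound is a right-nested disjunction and the new variables come first, so their entries can
  -- be written in front of the copied ones. The counter serves as the variable number and is
  -- cleared for the numbering of nodes.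
  newBounds : Program ⊤
  newBounds = dup rK rPar >> (iter (λ _ → get rPar >>= newBoundsStep) tt >> clear rCtr)

  copyLeafStep : Maybe Letter → Program ⊤
  copyLeafStep (just ⟨var⟩) = readLeaf >> (emitOldVar κ >> clear rLeaf)
  copyLeafStep (just ⟨con⟩) = readLeaf >> (emitLeaf κ >> clear rLeaf)
  copyLeafStep _            = ret tt

  copyLeaf : Program ⊤
  copyLeaf = get rIn >>= copyLeafStep

  copyAtom : Program ⊤
  copyAtom = pass >> (copyLeaf >> copyLeaf)

  -- In Polish notation an entry of the bound begins with a connective and the closing comparison of
  -- `0` with `0` with a relation; the first letter tells where the bound ends.
  copyEntry copyLast : Letter → Program (⊤ ⊎ ⊤)
  copyEntry l = (put rOut l >> (pass >> (copyAtom >> copyAtom))) >> ret (inj₁ tt)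
  copyLast  l = (put rOut l >> (copyLeaf >> copyLeaf)) >> ret (inj₂ tt)

  copyStep : Maybe Letter → Program (⊤ ⊎ ⊤)
  copyStep nothing    = ret (inj₂ tt)
  copyStep (just ⟨<⟩) = copyLast ⟨<⟩
  copyStep (just ⟨≤⟩) = copyLast ⟨≤⟩
  copyStep (just l)   = copyEntry l

  copyBounds : Program ⊤
  copyBounds = iter (λ _ → get rIn >>= copyStep) tt

  bounds : Bool → Program ⊤
  bounds false = ret tt
  bounds true  = pass >> (newBounds >> (copyBounds >> (pass >> copyBounds)))

  module _ (m n N : ℕ) (M : ℤ) (binary-M : binary M ≡ ⟨pos⟩ ∷ ones N ++ [ ⟨end⟩ ]) where
    open Translating κ m n N M binary-M
    open Emission v

    private
      S : List Letter → Context
      S I = st I [] [] [] [] [] []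

    emits-pass : ∀ l {I} → Emits pass (S (l ∷ I)) (S I) 2 [ l ]
    emits-pass l = emits λ o → constant 1 run-get ⨾= constant 1 run-put

    emits-copyLeaf : ∀ l w p {I P} → copyLeafStep (just l) ≡ (readLeaf >> (P >> clear rLeaf)) → All Digit w → length w ≤ v →
      Emits P (st I [] [] [] w [] []) (st I [] [] [] w [] []) 40 (encodePoly κ p) →
      Emits copyLeaf (S (l ∷ (w ++ [ ⟨end⟩ ]) ++ I)) (S I) 60 (encodePoly κ {v} p)
    emits-copyLeaf l w p {I} {P} eq d w≤v P-emits = emits λ o →
      Run-start (cong (λ z → S (l ∷ z) o) (sym (++-assoc w [ ⟨end⟩ ] I)))
        (relax 60 (constant 1 run-get ⨾=
          subst (λ Q → Run Q (S (w ++ ⟨end⟩ ∷ I) o) (cost u 48) tt (S I (encodePoly κ p ʳ++ o))) (sym eq)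
            (run (reword (++-identityʳ (encodePoly κ p)) (emits-read w d w≤v ⨾ᴱ (P-emits ⨾ᴱ
              silent (S I) (λ o → linear 2 2 (length w) w≤v (run-clear rLeaf (st I [] [] [] w [] [] o) w refl))))) o)))

    emits-copyVar : ∀ x {I} → Emits copyLeaf (S (encodeTerm (var x) ++ I)) (S I) 60 (encodePoly κ (varₚ κ (shift (suc k) n m x)))
    emits-copyVar x = emits-copyLeaf ⟨var⟩ (ones (toℕ x)) (varₚ κ (shift (suc k) n m x)) refl (ones-digits (toℕ x)) (ones≤v x≤v)
        (emits-oldVar x)
      where
      x≤v : toℕ x ≤ v
      x≤v = ℕ.≤-trans (ℕ.<⇒≤ (toℕ<n x)) (ℕ.+-monoˡ-≤ m (ℕ.m≤n+m n (suc k)))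

    emits-copyCon : ∀ z {_ : True (length (binary z) ℕ.≤? 4)} {I} → Emits copyLeaf (S (encodeTerm {n + m} (con z) ++ I)) (S I) 60
        (encodePoly κ (conₚ κ {v} z))
    emits-copyCon z {h} {I} with binary-digits z
    ... | w , d , eq = subst (λ b → Emits copyLeaf (S (⟨con⟩ ∷ b ++ I)) (S I) 60 (encodePoly κ (conₚ κ {v} z))) (sym eq)
      (emits-copyLeaf ⟨con⟩ w (conₚ κ z) refl d w≤v (relaxᴱ 40 (emits-constLeaf v κ z eq w≤v)))
      where
      w≤v : length w ≤ v
      w≤v = ℕ.≤-trans (ℕ.m≤m+n (length w) 1) (ℕ.≤-trans (ℕ.≤-reflexive (trans (sym (length-++ w)) (cong length (sym eq))))
        (ℕ.≤-trans (toWitness h) (ℕ.≤-trans (ℕ.m≤m+n 4 (N + N)) k≤v)))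

    module _ {C R : Letter} {e₁ e₂ e₃ e₄ w₁ w₂ w₃ w₄ : List Letter} (eq : copyStep (just C) ≡ copyEntry C)
      (E₁ : ∀ {I} → Emits copyLeaf (S (e₁ ++ I)) (S I) 60 w₁) (E₂ : ∀ {I} → Emits copyLeaf (S (e₂ ++ I)) (S I) 60 w₂)
      (E₃ : ∀ {I} → Emits copyLeaf (S (e₃ ++ I)) (S I) 60 w₃) (E₄ : ∀ {I} → Emits copyLeaf (S (e₄ ++ I)) (S I) 60 w₄) where

      run-copyEntry : ∀ I o → Run (get rIn >>= copyStep) (S (C ∷ (C ∷ (R ∷ e₁ ++ e₂) ++ (R ∷ e₃ ++ e₄)) ++ I) o) (cost u 250) (inj₁ tt)
                                  (S I ((C ∷ (C ∷ (R ∷ w₁ ++ w₂) ++ (R ∷ w₃ ++ w₄))) ʳ++ o))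
      run-copyEntry I o =
        Run-start (cong (λ z → S (C ∷ C ∷ R ∷ z) o) (sym reassoc))
          (relax 250 (constant 1 run-get ⨾=
            subst (λ P → Run P (S input o) (cost u 248) (inj₁ tt) (S I ((C ∷ (C ∷ (R ∷ w₁ ++ w₂) ++ (R ∷ w₃ ++ w₄))) ʳ++ o))) (sym eq)
              (run (emits-put C ⨾ᴱ (emits-pass C ⨾ᴱ ((emits-pass R ⨾ᴱ (E₁ ⨾ᴱ E₂)) ⨾ᴱ (emits-pass R ⨾ᴱ (E₃ ⨾ᴱ E₄))))) o
                  ⨾ constant 1 run-ret)))
        where
        input : List Letter
        input = C ∷ R ∷ e₁ ++ (e₂ ++ (R ∷ e₃ ++ (e₄ ++ I)))
        reassoc : ((e₁ ++ e₂) ++ (R ∷ e₃ ++ e₄)) ++ I ≡ e₁ ++ (e₂ ++ (R ∷ e₃ ++ (e₄ ++ I)))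
        reassoc = trans (++-assoc (e₁ ++ e₂) (R ∷ e₃ ++ e₄) I) (trans (++-assoc e₁ e₂ _)
          (cong (λ z → e₁ ++ (e₂ ++ (R ∷ z))) (++-assoc e₃ e₄ I)))

    run-copyLast : ∀ R I o → copyStep (just R) ≡ copyLast R →
      Run (get rIn >>= copyStep) (S (R ∷ (encodeTerm {n + m} (con 0ℤ) ++ encodeTerm {n + m} (con 0ℤ)) ++ I) o) (cost u 250) (inj₂ tt)
          (S I ((R ∷ encodePoly κ (conₚ κ {v} 0ℤ) ++ encodePoly κ (conₚ κ {v} 0ℤ)) ʳ++ o))
    run-copyLast R I o eq = relax 250 (constant 1 run-get ⨾=
      subst (λ P → Run P (S ((encodeTerm {n + m} (con 0ℤ) ++ encodeTerm {n + m} (con 0ℤ)) ++ I) o) (cost u 122) (inj₂ tt)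
                         (S I ((R ∷ encodePoly κ (conₚ κ {v} 0ℤ) ++ encodePoly κ (conₚ κ {v} 0ℤ)) ʳ++ o))) (sym eq)
        (run (emits-put R ⨾ᴱ (emits-copyCon 0ℤ ⨾ᴱ emits-copyCon 0ℤ)) o ⨾ constant 1 run-ret))

    emits-copyBounds : ∀ r xs {I} → Emits copyBounds (S (encode (bound {terms} r xs) ++ I)) (S I) (250 * suc (length xs))
                         (encode (bound {κ} r (map (shift (suc k) n m) xs)))
    emits-copyBounds lt []       {I} = emits λ o → run-done (run-copyLast ⟨<⟩ I o refl)
    emits-copyBounds le []       {I} = emits λ o → run-done (run-copyLast ⟨≤⟩ I o refl)
    emits-copyBounds lt (x ∷ xs) {I} = emits λ o →
      Run-start (cong (λ z → S (⟨∨⟩ ∷ z) o) (sym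
          (++-assoc (encode {terms} (neg (con (ℤ.- 1ℤ) ≼ var x ∧ var x ≼ con 1ℤ))) (encode (bound {terms} lt xs)) I)))
        (Run-mono (ℕ.≤-reflexive (trans (cost-+ u 250 _) (cong (cost u) (sym (ℕ.*-suc 250 (suc (length xs)))))))
          (run-again (run-copyEntry refl (emits-copyVar x) (emits-copyCon (ℤ.- 1ℤ)) (emits-copyCon 1ℤ) (emits-copyVar x) _ o)
            (Run-end (cong (λ z → S I z) (sym (++-ʳ++ entry)))
              (run (emits-copyBounds lt xs) ((⟨∨⟩ ∷ entry) ʳ++ o)))))
      where
      entry : List Letter
      entry = encode {κ} (neg (conₚ κ (ℤ.- 1ℤ) ≼ varₚ κ (shift (suc k) n m x) ∧ varₚ κ (shift (suc k) n m x) ≼ conₚ κ 1ℤ))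
    emits-copyBounds le (x ∷ xs) {I} = emits λ o →
      Run-start (cong (λ z → S (⟨∧⟩ ∷ z) o) (sym
          (++-assoc (encode {terms} (con (ℤ.- 1ℤ) ≼ var x ∧ var x ≼ con 1ℤ)) (encode (bound {terms} le xs)) I)))
        (Run-mono (ℕ.≤-reflexive (trans (cost-+ u 250 _) (cong (cost u) (sym (ℕ.*-suc 250 (suc (length xs)))))))
          (run-again (run-copyEntry refl (emits-copyCon (ℤ.- 1ℤ)) (emits-copyVar x) (emits-copyVar x) (emits-copyCon 1ℤ) _ o)
            (Run-end (cong (λ z → S I z) (sym (++-ʳ++ entry)))
              (run (emits-copyBounds le xs) ((⟨∧⟩ ∷ entry) ʳ++ o)))))
      where
      entry : List Letter
      entry = encode {κ} (conₚ κ (ℤ.- 1ℤ) ≼ varₚ κ (shift (suc k) n m x) ∧ varₚ κ (shift (suc k) n m x) ≼ conₚ κ 1ℤ)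

    boundWord : Fin v → List Letter
    boundWord x = ⟨∨⟩ ∷ encode {κ} (neg (conₚ κ (ℤ.- 1ℤ) ≼ varₚ κ x ∧ varₚ κ x ≼ conₚ κ 1ℤ))

    emits-newBound : ∀ x {I p} → Emits newBound (st I (ones (toℕ x)) p [] [] [] []) (st I (ones (toℕ x)) p [] [] [] []) 100 (boundWord x)
    emits-newBound x {I} {p} = relaxᴱ 100 (emits-put ⟨∨⟩ ⨾ᴱ emits-or
      (emits-atom lt (varₚ κ x) (conₚ κ (ℤ.- 1ℤ)) counter (emits-const v κ (ℤ.- 1ℤ)))
      (emits-atom lt (conₚ κ 1ℤ) (varₚ κ x) (emits-const v κ 1ℤ) counter))
      where
      counter : Emits emitCounter (st I (ones (toℕ x)) p [] [] [] []) (st I (ones (toℕ x)) p [] [] [] []) 27 (encodePoly κ (varₚ κ x))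
      counter = silent (st I (ones (toℕ x)) p [] [] (ones (toℕ x)) [])
        (λ o → Run-end (cong (λ z → st I (ones (toℕ x)) p [] [] z [] o) (trans (ones-ʳ++ (toℕ x) 0) (cong ones (ℕ.+-identityʳ (toℕ x)))))
          (linear 7 4 (length (ones (toℕ x))) (ones≤v (ℕ.<⇒≤ (toℕ<n x))) (run-dup rCtr rA (st I (ones (toℕ x)) p [] [] [] [] o) refl)))
        ⨾ᴱ emits-var v κ x

    run-newBounds : ∀ w (f : Fin w → Fin v) j {I} → (∀ i → toℕ (f i) ≡ j + toℕ i) → ∀ o →
      Run (iter (λ _ → get rPar >>= newBoundsStep) tt) (st I (ones j) (ones w) [] [] [] [] o) (cost u (2 + 103 * w)) tt
          (st I (ones (w + j)) [] [] [] [] [] (concatMap boundWord (tabulate f) ʳ++ o))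
    run-newBounds zero    f j eq o = run-done (constant 1 run-get ⨾= constant 1 run-ret)
    run-newBounds (suc w) f j {I} eq o = Run-mono (ℕ.≤-reflexive (trans (cost-+ u 103 _) (cong (cost u) (time w))))
      (run-again {s′ = st I (ones (suc j)) (ones w) [] [] [] [] (boundWord (f zero) ʳ++ o)}
        (constant 1 run-get ⨾=
          (subst (λ c → Run newBound (st I (ones c) (ones w) [] [] [] [] o) (cost u 100) tt
              (st I (ones c) (ones w) [] [] [] [] (boundWord (f zero) ʳ++ o)))
            (trans (eq zero) (ℕ.+-identityʳ j)) (run (emits-newBound (f zero)) o) ⨾
          (constant 1 run-put ⨾ constant 1 run-ret)))
        (subst₂ (λ c z → Run (iter (λ _ → get rPar >>= newBoundsStep) tt)
            (st I (ones (suc j)) (ones w) [] [] [] [] (boundWord (f zero) ʳ++ o)) (cost u (2 + 103 * w)) tt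
                (st I (ones c) [] [] [] [] [] z))
          (ℕ.+-suc w j) (sym (++-ʳ++ (boundWord (f zero))))
          (run-newBounds w (f ∘ suc) (suc j) (λ i → trans (eq (suc i)) (ℕ.+-suc j (toℕ i))) (boundWord (f zero) ʳ++ o))))
      where
      time : ∀ w → 103 + (2 + 103 * w) ≡ 2 + 103 * (1 + w)
      time = solve-∀

    newVariables : List (Fin v)
    newVariables = tabulate {n = suc k} (λ i → (i ↑ˡ n) ↑ˡ m)

    emits-newBounds : ∀ {I} → Emits newBounds (S I) (S I) (11 + 103 * suc k) (concatMap boundWord newVariables)
    emits-newBounds {I} = emits λ o → Run-mono (ℕ.≤-reflexive (cong (cost u) (time (suc k))))
      (Run-end (cong (λ z → st I [] z [] [] [] [] o) (trans (ones-ʳ++ (suc k) 0) (cong ones (ℕ.+-identityʳ (suc k)))))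
        (linear 7 4 (length (ones (suc k))) (ones≤v k≤v) (run-dup rK rPar (S I o) refl))
      ⨾ (run-newBounds (suc k) (λ i → (i ↑ˡ n) ↑ˡ m) 0 (λ i → trans (toℕ-↑ˡ (i ↑ˡ n) m) (toℕ-↑ˡ i n)) o
      ⨾ linear 2 2 (length (ones (suc k + 0))) (ones≤v (ℕ.≤-trans (ℕ.≤-reflexive (ℕ.+-identityʳ (suc k))) k≤v))
          (run-clear rCtr (st I (ones (suc k + 0)) [] [] [] [] [] _) (ones (suc k + 0)) refl)))
      where
      time : ∀ w → 7 + ((2 + 103 * w) + 2) ≡ 11 + 103 * w
      time = solve-∀

    bound-++ : ∀ xs ys → concatMap boundWord xs ++ encode (bound {κ} lt ys) ≡ encode (bound {κ} lt (xs ++ ys))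
    bound-++ []       ys = refl
    bound-++ (x ∷ xs) ys = trans (++-assoc (boundWord x) (concatMap boundWord xs) _) (cong (boundWord x ++_) (bound-++ xs ys))

    -- The list of universal variables begins with the new ones, so the text produced is literally
    -- the bound of the new sentence.
    Ys-shift : newVariables ++ map (shift (suc k) n m) (Ys m n) ≡ Ys m (suc k + n)
    Ys-shift = trans (cong (newVariables ++_)
        (trans (cong (map (shift (suc k) n m)) (map-tabulate id (_↑ˡ m)))
        (trans (map-tabulate (_↑ˡ m) (shift (suc k) n m)) (tabulate-cong (shift-↑ˡ (suc k) n m)))))
      (trans (tabulate-+ (suc k) n (_↑ˡ m)) (sym (map-tabulate id (_↑ˡ m))))

    Xs-shift : map (shift (suc k) n m) (Xs m n) ≡ Xs m (suc k + n)
    Xs-shift = trans (cong (map (shift (suc k) n m)) (map-tabulate id (n ↑ʳ_)))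
      (trans (map-tabulate (n ↑ʳ_) (shift (suc k) n m))
          (trans (tabulate-cong (shift-↑ʳ (suc k) n m)) (sym (map-tabulate id ((suc k + n) ↑ʳ_)))))

    boundsTime : ℕ
    boundsTime = 2 + ((11 + 103 * suc k) + (250 * suc n + (2 + 250 * suc m)))

    run-bounds : ∀ b {Φ : Formula terms (n + m)} o → ∃ λ o′ →
      Run (bounds b) (S (encode (matrix b m n Φ)) o) (cost u boundsTime) tt (S (encode Φ) o′) ×
      (∀ (Ψ : Formula κ v) → encode Ψ ʳ++ o′ ≡ encode (matrix b m (suc k + n) Ψ) ʳ++ o)
    run-bounds false o = o , relaxed , λ Ψ → refl
      where
      relaxed = Run-mono (cost-mono u (s≤s z≤n)) (constant 1 run-ret)
    run-bounds true {Φ} o = _ , run whole o , words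
      where
      wY wX w₀ : List Letter
      wY = encode (bound {κ} lt (map (shift (suc k) n m) (Ys m n)))
      wX = encode (bound {κ} le (map (shift (suc k) n m) (Xs m n)))
      w₀ = [ ⟨∨⟩ ] ++ (concatMap boundWord newVariables ++ (wY ++ ([ ⟨∧⟩ ] ++ wX)))
      len-allFin : ∀ n → length (Ys m n) ≡ n
      len-allFin n = trans (length-map (_↑ˡ m) (allFin n)) (length-tabulate id)
      len-allFin′ : length (Xs m n) ≡ m
      len-allFin′ = trans (length-map (n ↑ʳ_) (allFin m)) (length-tabulate id)
      copyY : ∀ {I} → Emits copyBounds (S (encode (bound {terms} lt (Ys m n)) ++ I)) (S I) (250 * suc n) wY
      copyY {I} = subst (λ l → Emits copyBounds (S (encode (bound {terms} lt (Ys m n)) ++ I)) (S I) (250 * suc l) wY) (len-allFin n)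
          (emits-copyBounds lt (Ys m n))
      copyX : ∀ {I} → Emits copyBounds (S (encode (bound {terms} le (Xs m n)) ++ I)) (S I) (250 * suc m) wX
      copyX {I} = subst (λ l → Emits copyBounds (S (encode (bound {terms} le (Xs m n)) ++ I)) (S I) (250 * suc l) wX) len-allFin′
          (emits-copyBounds le (Xs m n))
      whole : Emits (bounds true) (S (encode (matrix true m n Φ))) (S (encode Φ)) boundsTime w₀
      whole = emits-pass ⟨∨⟩ ⨾ᴱ (emits-newBounds ⨾ᴱ (copyY ⨾ᴱ (emits-pass ⟨∧⟩ ⨾ᴱ copyX)))
      words : ∀ Ψ → encode Ψ ʳ++ (w₀ ʳ++ o) ≡ encode (matrix true m (suc k + n) Ψ) ʳ++ o
      words Ψ = trans (sym (++-ʳ++ w₀)) (cong (_ʳ++ o) (cong (⟨∨⟩ ∷_)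
        (trans (cong (_++ encode Ψ) (sym (++-assoc (concatMap boundWord newVariables) wY (⟨∧⟩ ∷ wX))))
        (trans (cong (λ z → (z ++ (⟨∧⟩ ∷ wX)) ++ encode Ψ) (trans (bound-++ newVariables _) (cong (encode ∘ bound {κ} lt) Ys-shift)))
        (trans (++-assoc (encode (bound {κ} lt (Ys m (suc k + n)))) (⟨∧⟩ ∷ wX) (encode Ψ))
               (cong (λ z → encode (bound {κ} lt (Ys m (suc k + n))) ++ (⟨∧⟩ ∷ encode (bound {κ} le z) ++ encode Ψ)) Xs-shift))))))

-- The running time bounds the length of the output, which has to be reversed
-- at the end.

size : ∀ {n} → Vec (List Letter) n → ℕ
size []       = 0
size (x ∷ xs) = length x + size xs

lookup≤size : ∀ {n} (s : Vec (List Letter) n) r → length (lookup s r) ≤ size s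
lookup≤size (x ∷ s) zero    = ℕ.m≤m+n _ _
lookup≤size (x ∷ s) (suc r) = ℕ.≤-trans (lookup≤size s r) (ℕ.m≤n+m _ _)

size-update : ∀ {n} (s : Vec (List Letter) n) r {x} → length x ≤ suc (length (lookup s r)) → size (s [ r ]≔ x) ≤ suc (size s)
size-update (y ∷ s) zero    h = ℕ.+-monoˡ-≤ (size s) h
size-update (y ∷ s) (suc r) h = ℕ.≤-trans (ℕ.+-monoʳ-≤ (length y) (size-update s r h)) (ℕ.≤-reflexive (ℕ.+-suc (length y) (size s)))

size-exec : ∀ {X} (i : Instruction X) s {x s′} → exec i s ≡ (x , s′) → size s′ ≤ suc (size s)
size-exec (skip x)     s refl = ℕ.n≤1+n _
size-exec (push r a x) s refl = size-update s r ℕ.≤-refl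
size-exec (pop r k)    s refl = size-update s r (drop≤ (lookup s r))
  where
  drop≤ : ∀ (x : List Letter) → length (List.drop 1 x) ≤ suc (length x)
  drop≤ []      = z≤n
  drop≤ (a ∷ x) = ℕ.≤-trans (ℕ.n≤1+n _) (ℕ.n≤1+n _)

size-run : ∀ {X} {p : Program X} {q s n x s′} → Steps p q s n x s′ → size s′ ≤ n + size s
size-run (exit {n = n} eq) = ℕ.≤-trans (size-exec _ _ eq) (s≤s (ℕ.m≤n+m _ n))
size-run (next {n = n} eq r) = ℕ.≤-trans (size-run r) (ℕ.≤-trans (ℕ.+-monoʳ-≤ n (size-exec _ _ eq)) (ℕ.≤-reflexive (ℕ.+-suc n _)))

-- The quantifier prefix and the program as a whole.

raw : (i k m v o : List Letter) → Store
raw i k m v o = mk i [] [] [] [] [] [] [] k m v o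

-- Every letter of the input accounts for one digit of the scale and for two new variables. The
-- constant 4 and the input's own variables are added to the tallies later.
tallyStep : Maybe Letter → Program (⊤ ⊎ ⊤)
tallyStep nothing  = ret (inj₂ tt)
tallyStep (just a) = put rTmp a >> (put rM ⟨1⟩ >> (putOnes 2 rK >> (putOnes 2 rV >> ret (inj₁ tt))))

tally : Program ⊤
tally = iter (λ _ → get rIn >>= tallyStep) tt

quantifierStep : Maybe Letter → Program (⊤ ⊎ ⊤)
quantifierStep nothing    = ret (inj₂ tt)
quantifierStep (just ⟨∃⟩) = put rOut ⟨∃⟩ >> (put rV ⟨1⟩ >> ret (inj₁ tt))
quantifierStep (just ⟨∀⟩) = put rOut ⟨∀⟩ >> (put rV ⟨1⟩ >> ret (inj₁ tt))
quantifierStep (just l)   = put rIn l >> ret (inj₂ tt)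

quantifiers : Program ⊤
quantifiers = iter (λ _ → get rIn >>= quantifierStep) tt

universalStep : Maybe Letter → Program (⊤ ⊎ ⊤)
universalStep nothing  = ret (inj₂ tt)
universalStep (just a) = put rTmp a >> (put rOut ⟨∀⟩ >> ret (inj₁ tt))

-- The new quantifiers are written behind the old ones, hence innermost, which gives their variables
-- the numbers from 0 to `k`.
universals : Program ⊤
universals = iter (λ _ → get rK >>= universalStep) tt >> move rTmp rK

prelude : Program ⊤
prelude = tally >> (move rTmp rIn >> (putOnes 4 rK >> (putOnes 4 rV >> (quantifiers >> universals))))

-- The last move undoes the reversal and also brings the result to the first tape, which is empty
-- once the input has been read.
simplify : Notation → Bool → Program ⊤
simplify κ b = (prelude >> (bounds κ b >> loop κ le)) >> move rOut rIn

run-tally : ∀ w {t a b c o} →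
  Run tally (mk w t [] [] [] [] [] [] (ones a) (ones b) (ones c) o) (2 + 10 * length w) tt
      (mk [] (w ʳ++ t) [] [] [] [] [] [] (ones ((length w + length w) + a)) (ones (length w + b)) (ones ((length w + length w) + c)) o)
run-tally []      = run-done (run-bind run-get run-ret)
run-tally (l ∷ w) {t} {a} {b} {c} {o} = Run-mono (ℕ.≤-reflexive (time (length w))) (run-again
  (run-bind run-get (run-bind run-put (run-bind run-put
      (run-bind (run-putOnes 2 rK _ a refl) (run-bind (run-putOnes 2 rV _ c refl) run-ret)))))
  (subst₂ (λ x z → Run tally (mk w (l ∷ t) [] [] [] [] [] [] (ones (2 + a)) (ones (1 + b)) (ones (2 + c)) o) (2 + 10 * length w) tt
      (mk [] (w ʳ++ (l ∷ t)) [] [] [] [] [] [] (ones x) (ones (suc (length w + b))) (ones z) o))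
    (two (length w) a) (two (length w) c)
    (Run-end (cong (λ y → mk [] (w ʳ++ (l ∷ t)) [] [] [] [] [] [] (ones ((length w + length w) + (2 + a))) (ones y)
        (ones ((length w + length w) + (2 + c))) o) (ℕ.+-suc (length w) b)) (run-tally w))))
  where
  time : ∀ n → 10 + (2 + 10 * n) ≡ 2 + 10 * (1 + n)
  time = solve-∀
  two : ∀ n a → (n + n) + (2 + a) ≡ ((1 + n) + (1 + n)) + a
  two = solve-∀

data Quantifier : Letter → Set where
  ∃# : Quantifier ⟨∃⟩
  ∀# : Quantifier ⟨∀⟩

Stops : Letter → Set₁
Stops l = quantifierStep (just l) ≡ (put rIn l >> ret (inj₂ tt))

run-quantifiers : ∀ w l {I c k m o} → All Quantifier w → Stops l →
  Run quantifiers (raw (w ++ l ∷ I) k m (ones c) o) (3 + 4 * length w) tt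
      (raw (l ∷ I) k m (ones (length w + c)) (w ʳ++ o))
run-quantifiers [] l {I} {c} {k} {m} {o} [] stops = run-done (run-bind run-get
  (subst (λ P → Run P (raw I k m (ones c) o) 2 (inj₂ tt) (raw (l ∷ I) k m (ones c) o)) (sym stops)
    (run-bind run-put run-ret)))
run-quantifiers (q ∷ w) l {I} {c} {k} {m} {o} (Q ∷ Qs) stops = Run-mono (ℕ.≤-reflexive (time (length w)))
    (run-again (run-bind run-get (step Q))
  (Run-end (cong (λ z → raw (l ∷ I) k m (ones z) (w ʳ++ (q ∷ o))) (ℕ.+-suc (length w) c))
    (run-quantifiers w l Qs stops)))
  where
  time : ∀ n → 4 + (3 + 4 * n) ≡ 3 + 4 * (1 + n)
  time = solve-∀
  step : Quantifier q → Run (quantifierStep (just q)) (raw (w ++ l ∷ I) k m (ones c) o) 3 (inj₁ tt)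
                            (raw (w ++ l ∷ I) k m (ones (suc c)) (q ∷ o))
  step ∃# = run-bind run-put (run-bind run-put run-ret)
  step ∀# = run-bind run-put (run-bind run-put run-ret)

run-universals : ∀ j {i t m v o} →
  Run (iter (λ _ → get rK >>= universalStep) tt) (mk i t [] [] [] [] [] [] (ones j) m v o) (2 + 4 * j) tt
      (mk i (ones j ʳ++ t) [] [] [] [] [] [] [] m v (replicate j ⟨∀⟩ ʳ++ o))
run-universals zero    = run-done (run-bind run-get run-ret)
run-universals (suc j) = Run-mono (ℕ.≤-reflexive (time j))
  (run-again (run-bind run-get (run-bind run-put (run-bind run-put run-ret))) (run-universals j))
  where
  time : ∀ n → 4 + (2 + 4 * n) ≡ 2 + 4 * (1 + n)
  time = solve-∀

replicate-∷ : ∀ m (l : Letter) w → replicate m l ++ (l ∷ w) ≡ l ∷ replicate m l ++ w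
replicate-∷ zero    l w = refl
replicate-∷ (suc m) l w = cong (l ∷_) (replicate-∷ m l w)

replicate-+ : ∀ m n (l : Letter) → replicate n l ++ replicate m l ≡ replicate (m + n) l
replicate-+ zero    n l = ++-identityʳ _
replicate-+ (suc m) n l = trans (replicate-∷ n l (replicate m l)) (cong (l ∷_) (replicate-+ m n l))

encode-existsBlock : ∀ {κ} m (φ : Formula κ m) → encode (existsBlock m φ) ≡ replicate m ⟨∃⟩ ++ encode φ
encode-existsBlock zero    φ = refl
encode-existsBlock (suc m) φ = trans (encode-existsBlock m (exists φ)) (replicate-∷ m ⟨∃⟩ (encode φ))

encode-allBlock : ∀ {κ} n {m} (φ : Formula κ (n + m)) → encode (allBlock n φ) ≡ replicate n ⟨∀⟩ ++ encode φ
encode-allBlock zero    φ = refl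
encode-allBlock (suc n) φ = trans (encode-allBlock n (all φ)) (replicate-∷ n ⟨∀⟩ (encode φ))

prefix : ℕ → ℕ → List Letter
prefix m n = replicate m ⟨∃⟩ ++ replicate n ⟨∀⟩

prefix-quantifiers : ∀ m n → All Quantifier (prefix m n)
prefix-quantifiers m n = All.++⁺ (All.replicate⁺ m ∃#) (All.replicate⁺ n ∀#)

encode-quantify : ∀ {κ} b m n (Φ : Formula κ (n + m)) → encode (quantify b m n Φ) ≡ prefix m n ++ encode (matrix b m n Φ)
encode-quantify {κ} b m n Φ = trans (blocks b) (sym (++-assoc (replicate m ⟨∃⟩) (replicate n ⟨∀⟩) _))
  where
  block : ∀ Ψ → encode {κ} (∃∀ m n Ψ) ≡ replicate m ⟨∃⟩ ++ (replicate n ⟨∀⟩ ++ encode Ψ)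
  block Ψ = trans (encode-existsBlock m (allBlock n Ψ)) (cong (replicate m ⟨∃⟩ ++_) (encode-allBlock n Ψ))
  blocks : ∀ b → encode (quantify b m n Φ) ≡ replicate m ⟨∃⟩ ++ (replicate n ⟨∀⟩ ++ encode (matrix b m n Φ))
  blocks false = block Φ
  blocks true  = block _

matrix-head : ∀ b m n {Φ : Formula terms (n + m)} → QuantifierFree Φ →
  ∃ λ l → ∃ λ w → encode (matrix b m n Φ) ≡ l ∷ w × Stops l
matrix-head true  m n qf      = ⟨∨⟩ , _ , refl , refl
matrix-head false m n (p ≺ q) = ⟨<⟩ , _ , refl , refl
matrix-head false m n (p ≼ q) = ⟨≤⟩ , _ , refl , refl
matrix-head false m n (f ∧ g) = ⟨∧⟩ , _ , refl , refl
matrix-head false m n (f ∨ g) = ⟨∨⟩ , _ , refl , refl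

-- The number 2^N - 1; in bijective base 2 its digits are N ones.
onesᵇ : ℕ → ℕᵇ
onesᵇ zero    = ℕᵇ.zero
onesᵇ (suc N) = 1+[2 onesᵇ N ]

scale : ℕ → ℕ
scale N = ℕᵇ.toℕ (onesᵇ N)

binary-scale : ∀ N → binary (ℤ.+ scale N) ≡ ⟨pos⟩ ∷ ones N ++ [ ⟨end⟩ ]
binary-scale N = cong (⟨pos⟩ ∷_) (trans (cong binaryDigits (ℕᵇ.fromℕ-toℕ (onesᵇ N))) (digits N))
  where
  digits : ∀ N → binaryDigits (onesᵇ N) ≡ ones N ++ [ ⟨end⟩ ]
  digits zero    = refl
  digits (suc N) = cong (⟨1⟩ ∷_) (digits N)

suc-scale : ∀ N → suc (scale N) ≡ 2 ^ N
suc-scale zero    = refl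
suc-scale (suc N) = trans (double (scale N)) (cong (2 *_) (suc-scale N))
  where
  double : ∀ n → 2 + 2 * n ≡ 2 * (1 + n)
  double = solve-∀

-- `2 + 2 ^ ℓ ≤ 2 ^ ℓ + 2 ^ ℓ ≤ 2 ^ N`, where `1 ≤ ℓ` is what the first step needs; then 1 is
-- subtracted.
scale-large : ∀ {N ℓ} → 1 ≤ ℓ → suc ℓ ≤ N → suc (2 ^ ℓ) ≤ scale N
scale-large {N} {ℓ} 1≤ℓ ℓ<N = ℕ.s≤s⁻¹ (ℕ.≤-trans (ℕ.≤-trans (ℕ.≤-trans (ℕ.+-monoˡ-≤ (2 ^ ℓ) (ℕ.^-monoʳ-≤ 2 1≤ℓ))
  (ℕ.≤-reflexive (cong (2 ^ ℓ +_) (sym (ℕ.+-identityʳ (2 ^ ℓ)))))) (ℕ.^-monoʳ-≤ 2 ℓ<N)) (ℕ.≤-reflexive (sym (suc-scale N))))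

1≤scale : ∀ {N} → 1 ≤ N → 1 ≤ scale N
1≤scale {suc N} _ = s≤s z≤n

-- Running time, and the theorem.

-- The shape of `units` with variables for its numerals, so that the identities about it are
-- polynomial ones with small coefficients.
linearForm : (A B C D E F N n m ℓ : ℕ) → ℕ
linearForm A B C D E F N n m ℓ = A + ((B + ((C + D * (4 + (N + N))) + (E * suc n + (2 + E * suc m)))) + (F * ℓ + 2))

linearForm-mono : ∀ A B C D E F N {n m ℓ} → n ≤ N → m ≤ N → ℓ ≤ N → linearForm A B C D E F N n m ℓ ≤ linearForm A B C D E F N N N N
linearForm-mono A B C D E F N n≤N m≤N ℓ≤N = ℕ.+-monoʳ-≤ A (ℕ.+-mono-≤
  (ℕ.+-monoʳ-≤ B (ℕ.+-monoʳ-≤ (C + D * (4 + (N + N))) (ℕ.+-mono-≤ (ℕ.*-monoʳ-≤ E (s≤s n≤N)) (ℕ.+-monoʳ-≤ 2 (ℕ.*-monoʳ-≤ E (s≤s m≤N))))))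
  (ℕ.+-monoˡ-≤ 2 (ℕ.*-monoʳ-≤ F ℓ≤N)))

linearForm-≤ : ∀ A B C D E F N → 1 ≤ N → linearForm A B C D E F N N N N ≤ ((A + B + C + D * 4 + E * 2 + 4) + (D * 2 + E * 2 + F)) * N
linearForm-≤ A B C D E F (suc x) _ = ℕ.≤-trans (ℕ.m≤m+n _ ((A + B + C + D * 4 + E * 2 + 4) * x)) (ℕ.≤-reflexive (slack A B C D E F x))
  where
  slack : ∀ A B C D E F x →
    (A + ((B + ((C + D * (4 + ((1 + x) + (1 + x)))) + (E * (1 + (1 + x)) + (2 + E * (1 + (1 + x)))))) + (F * (1 + x) + 2))) +
        (A + B + C + D * 4 + E * 2 + 4) * x
    ≡ ((A + B + C + D * 4 + E * 2 + 4) + (D * 2 + E * 2 + F)) * (1 + x)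
  slack = solve-∀

-- The coefficient from `linearForm-≤` at 40, 2, 11, 103, 250 and `T`: the prelude, the bounds and
-- the cost per letter of the matrix.
unitFactor : ℕ
unitFactor = (40 + 2 + 11 + 103 * 4 + 250 * 2 + 4) + (103 * 2 + 250 * 2 + 1500)

-- Abstract, since products with this large numeral must not be unfolded.
abstract
  timeFactor : ℕ
  timeFactor = (4 * (unitFactor * 9) + 5) * 2

  timeFactor-def : timeFactor ≡ (4 * (unitFactor * 9) + 5) * 2
  timeFactor-def = refl

-- `c` is the time of the pass and `c + N` bounds the length of the output, whose reversal takes
-- three steps per letter. The factor 2 is that of the simulation by a machine.
total-≤ : ∀ G {c N x} → c ≤ G * x → N ≤ x → (c + (2 + 3 * (c + N))) * 2 ≤ ((4 * G + 5) * 2) * x + (4 * G + 5) * 2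
total-≤ G {c} {N} {x} c≤ N≤ = ℕ.≤-trans (ℕ.*-monoˡ-≤ 2 (ℕ.+-mono-≤ c≤ (ℕ.+-monoʳ-≤ 2 (ℕ.*-monoʳ-≤ 3 (ℕ.+-mono-≤ c≤ N≤)))))
  (ℕ.≤-trans (ℕ.m≤m+n _ (4 * x + (8 * G + 6))) (ℕ.≤-reflexive (slack G x)))
  where
  slack : ∀ G x → (G * x + (2 + 3 * (G * x + x))) * 2 + (4 * x + (8 * G + 6)) ≡ ((4 * G + 5) * 2) * x + (4 * G + 5) * 2
  slack = solve-∀

module Simplified (κ : Notation) (b : Bool) (m n : ℕ) {Φ : Formula terms (n + m)} (qf : QuantifierFree Φ) where

  input : List Letter
  input = encode (quantify b m n Φ)

  N : ℕ
  N = length input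

  open Translating κ m n N (ℤ.+ scale N) (binary-scale N)
  open Emission v

  Φ′ : Formula κ v
  Φ′ = simplified κ k m n (ℤ.+ scale N) Φ

  result : List Letter
  result = encode (quantify b m (suc k + n) Φ′)

  private
    rest : List Letter
    rest = encode (matrix b m n Φ)

    input≡ : input ≡ prefix m n ++ rest
    input≡ = encode-quantify b m n Φ

    length-prefix : length (prefix m n) ≡ m + n
    length-prefix = trans (length-++ (replicate m ⟨∃⟩)) (cong₂ _+_ (length-replicate m) (length-replicate n))

    N≡ : N ≡ (m + n) + length rest
    N≡ = trans (cong length input≡) (trans (length-++ (prefix m n)) (cong (_+ length rest) length-prefix))

    length-matrix : ∀ b → length (encode Φ) ≤ length (encode (matrix b m n Φ))
    length-matrix false = ℕ.≤-refl
    length-matrix true  = ℕ.m≤n⇒m≤1+n (ℕ.≤-trans (length-++-≤ʳ _ {encode (bound {terms} le (Xs m n))})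
      (ℕ.≤-trans (ℕ.n≤1+n _) (length-++-≤ʳ _ {encode (bound {terms} lt (Ys m n))})))

    rest≤N : length rest ≤ N
    rest≤N = ℕ.≤-trans (ℕ.m≤n+m _ (m + n)) (ℕ.≤-reflexive (sym N≡))

    m+n≤N : m + n ≤ N
    m+n≤N = ℕ.≤-trans (ℕ.m≤m+n (m + n) _) (ℕ.≤-reflexive (sym N≡))

  Φ≤N : length (encode Φ) ≤ N
  Φ≤N = ℕ.≤-trans (length-matrix b) rest≤N

  1≤N : 1 ≤ N
  1≤N with matrix-head b m n qf
  ... | l , w , eq , _ = ℕ.≤-trans (ℕ.≤-trans (s≤s z≤n) (ℕ.≤-reflexive (cong length (sym eq)))) rest≤N

  run-prelude : Run prelude (raw input [] [] [] []) (cost u 40) tt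
                    (st rest [] [] [] [] [] [] (prefix m (suc k + n) ʳ++ []))
  run-prelude with matrix-head b m n qf
  ... | l , w , eq , stops = relax 40
    (tallied ⨾ (moved ⨾ (constant 5 (run-putOnes 4 rK _ (N + N) refl) ⨾ (constant 5 (run-putOnes 4 rV _ (N + N) refl) ⨾
      (prefixed ⨾ (linear 4 2 (suc k) k≤v (run-universals (suc k)) ⨾ restored))))))
    where
    tallied : Run tally (raw input [] [] [] []) (cost u 10) tt
                  (mk [] (input ʳ++ []) [] [] [] [] [] [] (ones (N + N)) (ones N) (ones (N + N)) [])
    tallied = linear 10 2 N N≤v (subst₂ (λ x y → Run tally (raw input [] [] [] []) (2 + 10 * N) tt
        (mk [] (input ʳ++ []) [] [] [] [] [] [] (ones x) (ones y) (ones x) []))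
      (ℕ.+-identityʳ (N + N)) (ℕ.+-identityʳ N) (run-tally input))
    moved : Run (move rTmp rIn) (mk [] (input ʳ++ []) [] [] [] [] [] [] (ones (N + N)) (ones N) (ones (N + N)) []) (cost u 3) tt
                (raw (prefix m n ++ l ∷ w) (ones (N + N)) (ones N) (ones (N + N)) [])
    moved = Run-end (cong (λ z → raw z (ones (N + N)) (ones N) (ones (N + N)) [])
        (trans (ʳ++-ʳ++ input) (trans (++-identityʳ input) (trans input≡ (cong (prefix m n ++_) eq)))))
      (linear 3 2 _ (ℕ.≤-trans (ℕ.≤-reflexive (trans (length-ʳ++ input) (ℕ.+-identityʳ N))) N≤v)
        (run-move rTmp rIn (mk [] (input ʳ++ []) [] [] [] [] [] [] (ones (N + N)) (ones N) (ones (N + N)) [])))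
    V≡ : length (prefix m n) + (4 + (N + N)) ≡ v
    V≡ = trans (cong (_+ (4 + (N + N))) length-prefix) (arith m n (N + N))
      where
      arith : ∀ m n x → (m + n) + (4 + x) ≡ ((4 + x) + n) + m
      arith = solve-∀
    prefixed : Run quantifiers (raw (prefix m n ++ l ∷ w) (ones (suc k)) (ones N) (ones (4 + (N + N))) []) (cost u 4) tt
                   (st rest [] [] [] [] [] [] (prefix m n ʳ++ []))
    prefixed = subst₂ (λ y z → Run quantifiers (raw (prefix m n ++ l ∷ w) (ones (suc k)) (ones N) (ones (4 + (N + N))) []) (cost u 4) tt
                   (raw y (ones (suc k)) (ones N) (ones z) (prefix m n ʳ++ []))) (sym eq) V≡
      (linear 4 3 (length (prefix m n)) (ℕ.≤-trans (ℕ.≤-reflexive length-prefix) (ℕ.≤-trans m+n≤N N≤v))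
          (run-quantifiers (prefix m n) l (prefix-quantifiers m n) stops))
    out : List Letter
    out = replicate (suc k) ⟨∀⟩ ʳ++ (prefix m n ʳ++ [])
    before : Store
    before = mk rest (ones (suc k) ʳ++ []) [] [] [] [] [] [] [] (ones N) (ones v) out
    out≡ : out ≡ prefix m (suc k + n) ʳ++ []
    out≡ = trans (sym (++-ʳ++ (prefix m n))) (cong (_ʳ++ [])
      (trans (++-assoc (replicate m ⟨∃⟩) _ _) (cong (replicate m ⟨∃⟩ ++_) (replicate-+ (suc k) n ⟨∀⟩))))
    restored : Run (move rTmp rK) before (cost u 3) tt (st rest [] [] [] [] [] [] (prefix m (suc k + n) ʳ++ []))
    restored = subst₂ (λ y z → Run (move rTmp rK) before (cost u 3) tt (raw rest y (ones N) (ones v) z))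
      (trans (ʳ++-ʳ++ (ones (suc k))) (++-identityʳ _)) out≡
      (linear 3 2 _ (ℕ.≤-trans (ℕ.≤-reflexive (trans (length-ʳ++ (ones (suc k))) (ℕ.+-identityʳ _))) (ones≤v k≤v))
          (run-move rTmp rK before))

  units : ℕ
  units = 40 + (boundsTime κ m n N (ℤ.+ scale N) (binary-scale N) + (T * length (encode Φ) + 2))

  run-body : Run (prelude >> (bounds κ b >> loop κ le)) (raw input [] [] [] []) (cost u units) tt
                 (st [] (ones (nodes Φ)) [] [] [] [] [] (result ʳ++ []))
  run-body with run-bounds κ m n N (ℤ.+ scale N) (binary-scale N) b {Φ} (prefix m (suc k + n) ʳ++ [])
  ... | o , bounded , eq = run-prelude ⨾ (bounded ⨾
    Run-end (cong (λ z → st [] (ones (nodes Φ)) [] [] [] [] [] z)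
        (trans (eq Φ′) (trans (sym (++-ʳ++ (prefix m (suc k + n)))) (cong (_ʳ++ []) (sym (encode-quantify b m (suc k + n) Φ′))))))
      (matrix-run qf (ℕ.≤-trans (nodes≤length Φ) Φ≤N) (ℕ.≤-trans Φ≤N N≤v) o))

  time : ℕ
  time = cost u units + (2 + 3 * (cost u units + N))

  run-simplify : Run (simplify κ b) (raw input [] [] [] []) time tt (st result (ones (nodes Φ)) [] [] [] [] [] [])
  run-simplify = run-bind run-body (Run-mono (ℕ.+-monoʳ-≤ 2 (ℕ.*-monoʳ-≤ 3 out-length))
    (Run-end (cong (λ z → st z (ones (nodes Φ)) [] [] [] [] [] []) (trans (ʳ++-ʳ++ result) (++-identityʳ result)))
        (run-move rOut rIn before)))
    where
    before : Store
    before = st [] (ones (nodes Φ)) [] [] [] [] [] (result ʳ++ [])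
    out-length : length (result ʳ++ []) ≤ cost u units + N
    out-length = ℕ.≤-trans (lookup≤size before rOut)
        (ℕ.≤-trans (size-run run-body) (ℕ.≤-reflexive (cong (cost u units +_) (ℕ.+-identityʳ N))))

  private
    m≤N : m ≤ N
    m≤N = ℕ.≤-trans (ℕ.m≤m+n m n) m+n≤N

    n≤N : n ≤ N
    n≤N = ℕ.≤-trans (ℕ.m≤n+m n m) m+n≤N

  units≤ : units ≤ unitFactor * N
  units≤ = ℕ.≤-trans (linearForm-mono 40 2 11 103 250 T N n≤N m≤N Φ≤N) (linearForm-≤ 40 2 11 103 250 T N 1≤N)

  -- `v` is `4 + 2N + n + m`, at most `4 + 4N`, and the constants are absorbed by `1 ≤ N`.
  u≤ : u ≤ 9 * N
  u≤ = ℕ.≤-trans (s≤s (ℕ.+-mono-≤ (ℕ.+-monoʳ-≤ (suc k) n≤N) m≤N)) (polynomial N 1≤N)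
    where
    slack : ∀ x → (1 + (((4 + ((1 + x) + (1 + x))) + (1 + x)) + (1 + x))) + 5 * x ≡ 9 * (1 + x)
    slack = solve-∀
    polynomial : ∀ N → 1 ≤ N → suc (((4 + (N + N)) + N) + N) ≤ 9 * N
    polynomial (suc x) _ = ℕ.≤-trans (ℕ.m≤m+n _ (5 * x)) (ℕ.≤-reflexive (slack x))

  -- The number of units and the length of a unit are both linear in `N`, hence the exponent 2.
  time≤ : time * 2 ≤ timeFactor * N ^ 2 + timeFactor
  time≤ = subst (λ K → time * 2 ≤ K * N ^ 2 + K) (sym timeFactor-def)
      (total-≤ (unitFactor * 9) (ℕ.≤-trans (ℕ.≤-reflexive (cost-def u units))
          (ℕ.≤-trans (ℕ.*-mono-≤ units≤ u≤) (ℕ.≤-reflexive (square unitFactor N)))) N≤N²)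
    where
    square : ∀ F x → (F * x) * (9 * x) ≡ (F * 9) * (x * (x * 1))
    square = solve-∀
    N≤N² : N ≤ N ^ 2
    N≤N² = ℕ.≤-trans (ℕ.≤-reflexive (sym (ℕ.*-identityʳ N))) (ℕ.*-monoʳ-≤ N (ℕ.≤-trans 1≤N (ℕ.≤-reflexive (sym (ℕ.*-identityʳ N)))))

  equivalent : Equivalent (quantify b m n Φ) (quantify b m (suc k + n) Φ′)
  equivalent ℝ = Sentences.Simplification.simplified-⇔ ℝ κ m n (scale N) N (1≤scale 1≤N) scale-large b qf Φ≤N

-- The class enters the machine only through `bounded 𝒞`: an implication of the third class is read
-- as a disjunction like any other, and where its premise ends need not be found.
simplify-polyTime : ∀ 𝒞 κ (P : Sentence κ → Set) →
  (∀ b m n k M (Φ : Formula terms (n + m)) → P (quantify b m (suc k + n) (simplified κ k m n M Φ))) →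
  PolyTimeEquivalent 𝒞 κ P
simplify-polyTime 𝒞 κ P holds = machine (simplify κ (bounded 𝒞)) , timeFactor , 2 , λ (φ , φ∈𝒞) → compute φ φ∈𝒞
  where
  compute : ∀ φ → φ ∈ 𝒞 → ∃ λ (ψ : SentenceIn 𝒞 κ) → (Equivalent φ (proj₁ ψ) × P (proj₁ ψ)) ×
    (let open Machine (machine (simplify κ (bounded 𝒞))) in
     Computes (encode (proj₁ ψ)) from (encode φ) within (timeFactor * length (encode φ) ^ 2 + timeFactor))
  compute φ φ∈𝒞 with simplified-∈ 𝒞 κ (3 + (length (encode φ) + length (encode φ))) (ℤ.+ scale (length (encode φ))) φ∈𝒞
  ... | m , n , Φ , qf , refl , ψ∈𝒞 =
      (_ , ψ∈𝒞) , (equivalent , holds (bounded 𝒞) m n k (ℤ.+ scale N) Φ)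
    , within (machine-computes (simplify κ (bounded 𝒞)) run-simplify)
    where
    open Simplified κ (bounded 𝒞) m n qf
    open Translating κ m n N (ℤ.+ scale N) (binary-scale N) using (k)
    open Machine (machine (simplify κ (bounded 𝒞)))
    within : Computes result from input within (time * 2) → Computes result from input within (timeFactor * N ^ 2 + timeFactor)
    within (d , halts , out) = d , ↓-mono (simplify κ (bounded 𝒞)) time≤ halts , out

mainTheorem12 : (𝒞 : Class) → PolyTimeEquivalent 𝒞 terms (AtomsOfDegree≤ 4) × PolyTimeEquivalent 𝒞 standard (λ _ → ⊤)
mainTheorem12 𝒞 =
    simplify-polyTime 𝒞 terms (AtomsOfDegree≤ 4) (λ b m n k M Φ → quantify-degree b m _ (translate-degree _ _ M Φ 0))
  , simplify-polyTime 𝒞 standard (λ _ → ⊤) (λ _ _ _ _ _ _ → tt)
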